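{- Let $G$ be a virtually polycyclic group whose Hirsch number is different from $1$. Then $G$ admits a strongly aperiodic SFT.
   Context: A group is polycyclic if it admits a subnormal series with cyclic factors; virtually polycyclic if it has a polycyclic subgroup of finite index. The Hirsch number $h(G)$ is the number of infinite factors in a subnormal series of $G$ whose factors are cyclic or finite (it is independent of the series). For a finite set $A$ and a group $G$, $A^G$ is the set of functions $G\to A$ with the product topology, with $G$-action $(g\cdot x)_h = x_{g^{ -1}h}$. A pattern is a partial function from $G$ to $A$ with finite support. A subshift of finite type (SFT) on $G$ is a set of the form $\{x\in A^G : \forall g\in G, \forall P\in\mathcal{P}, \exists h\in\mathrm{Supp}(P), (g\cdot x)_h\neq P_h\}$ for a finite set $\mathcal{P}$ of patterns. A subshift $X$ is strongly aperiodic if it is nonempty and every point $x\in X$ has finite stabilizer $\{g : g\cdot x = x\}$. -}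

module Defs where

open import Level using (Level; _⊔_; suc; Lift)
open import Algebra.Bundles using (Group)
open import Data.Nat using (ℕ; zero)
import Data.Nat as ℕ
open import Data.Integer using (ℤ; +_; -[1+_])
open import Data.Fin using (Fin)
open import Data.List using (List)
open import Data.List.Relation.Unary.All using (All)
open import Data.List.Relation.Unary.Any using (Any)
open import Data.Product using (Σ; ∃; _×_; _,_)
open import Data.Unit.Polymorphic using (⊤)
open import Relation.Nullary using (¬_)
open import Relation.Binary.PropositionalEquality using (_≡_; _≢_)

module _ {c ℓ : Level} (G : Group c ℓ) where
  open Group G

  natPow : Carrier → ℕ → Carrier
  natPow g zero = ε
  natPow g (ℕ.suc n) = g ∙ natPow g n

  pow : Carrier → ℤ → Carrier
  pow g (+ n) = natPow g n
  pow g -[1+ n ] = natPow (g ⁻¹) (ℕ.suc n)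

  record Subgroup (p : Level) : Set (c ⊔ ℓ ⊔ suc p) where
    field
      mem  : Carrier → Set p
      resp : ∀ {x y} → x ≈ y → mem x → mem y
      ε∈   : mem ε
      ∙∈   : ∀ {x y} → mem x → mem y → mem (x ∙ y)
      ⁻¹∈  : ∀ {x} → mem x → mem (x ⁻¹)
  open Subgroup public

  wholeGroup : (p : Level) → Subgroup p
  wholeGroup p = record
    { mem = λ _ → ⊤ ; resp = λ _ _ → _ ; ε∈ = _ ; ∙∈ = λ _ _ → _ ; ⁻¹∈ = λ _ → _ }

  _⊆_ : ∀ {p} → Subgroup p → Subgroup p → Set (c ⊔ p)
  K ⊆ H = ∀ {x} → mem K x → mem H x

  NormalIn : ∀ {p} → Subgroup p → Subgroup p → Set (c ⊔ p)
  NormalIn K H = ∀ {g n} → mem H g → mem K n → mem K ((g ∙ n) ∙ g ⁻¹)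

  CyclicFactor : ∀ {p} → Subgroup p → Subgroup p → Set (c ⊔ p)
  CyclicFactor H K =
    Σ Carrier λ g → mem H g × (∀ {h} → mem H h → Σ ℤ λ k → mem K ((pow g k) ⁻¹ ∙ h))

  FiniteFactor : ∀ {p} → Subgroup p → Subgroup p → Set (c ⊔ p)
  FiniteFactor H K =
    Σ (List Carrier) λ L → All (mem H) L × (∀ {h} → mem H h → Any (λ l → mem K (l ⁻¹ ∙ h)) L)

  data SeriesFrom {p q : Level} (F : Subgroup p → Subgroup p → Set q)
       : Subgroup p → Set (c ⊔ ℓ ⊔ suc p ⊔ q) where
    done : ∀ {H} → (∀ {x} → mem H x → x ≈ ε) → SeriesFrom F H
    step : ∀ {H} (K : Subgroup p) → K ⊆ H → NormalIn K H → F H K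
         → SeriesFrom F K → SeriesFrom F H

  IsPolycyclic : ∀ {p} → Subgroup p → Set (c ⊔ ℓ ⊔ suc p)
  IsPolycyclic H = SeriesFrom CyclicFactor H

  IsVirtuallyPolycyclic : (p : Level) → Set (c ⊔ ℓ ⊔ suc p)
  IsVirtuallyPolycyclic p =
    Σ (Subgroup p) λ H → FiniteFactor (wholeGroup p) H × IsPolycyclic H

  data FactorKind {p} (H K : Subgroup p) : Set (c ⊔ p) where
    finiteF   : FiniteFactor H K → FactorKind H K
    infiniteF : CyclicFactor H K → ¬ FiniteFactor H K → FactorKind H K

  countInfinite : ∀ {p} {H : Subgroup p} → SeriesFrom FactorKind H → ℕ
  countInfinite (done _) = 0
  countInfinite (step K _ _ (finiteF _) s) = countInfinite s
  countInfinite (step K _ _ (infiniteF _ _) s) = ℕ.suc (countInfinite s)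

  -- h(G) = n : witnessed by a subnormal series of G with cyclic-or-finite factors
  -- having exactly n infinite factors (independent of the series)
  HirschNumber : (p : Level) → ℕ → Set (c ⊔ ℓ ⊔ suc p)
  HirschNumber p n =
    Σ (SeriesFrom FactorKind (wholeGroup p)) λ s → countInfinite s ≡ n

  record Config (k : ℕ) : Set (c ⊔ ℓ) where
    field
      val   : Carrier → Fin k
      respC : ∀ {g h} → g ≈ h → val g ≡ val h
  open Config public

  shiftAt : ∀ {k} → Carrier → Config k → Carrier → Fin k
  shiftAt g x h = val x (g ⁻¹ ∙ h)

  Pattern : ℕ → Set c
  Pattern k = List (Σ Carrier λ _ → Fin k)

  InSFT : ∀ {k} → List (Pattern k) → Config k → Set c
  InSFT 𝒫 x = ∀ (g : Carrier) →
    All (λ P → Any (λ { (h , a) → shiftAt g x h ≢ a }) P) 𝒫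

  FiniteStabilizer : ∀ {k} → Config k → Set (c ⊔ ℓ)
  FiniteStabilizer x = Σ (List Carrier) λ L →
    ∀ g → (∀ h → shiftAt g x h ≡ val x h) → Any (λ l → g ≈ l) L

  StronglyAperiodicSFT : ∀ {k} → List (Pattern k) → Set (c ⊔ ℓ)
  StronglyAperiodicSFT 𝒫 =
    (Σ (Config _) λ x → InSFT 𝒫 x) × (∀ x → InSFT 𝒫 x → FiniteStabilizer x)

  AdmitsStronglyAperiodicSFT : Set (c ⊔ ℓ)
  AdmitsStronglyAperiodicSFT =
    Σ ℕ λ k → Σ (List (Pattern k)) λ 𝒫 → StronglyAperiodicSFT 𝒫

{-# OPTIONS --safe #-}
module Submission where

-- Equality and membership in the given subgroups are not decidable, so the given series is first replaced
-- by a better one. Its topmost infinite factor gives a homomorphism τ to ℤ on a subgroup E of finite index,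
-- and τ extends to the homogeneous function g ↦ τ(g^R)/R. Among the elements whose conjugation fixes τ,
-- those whose left translation fixes this function form a decidable subgroup, with one infinite factor less.
-- Recursively this yields a decidable subgroup P of finite index and a finite subgroup N, the set of
-- torsion elements of P, such that P/N is poly-ℤ.
--
-- Let P = K ⋊ ⟨t⟩ modulo N, with K/N infinite. In the manner of Kari, a point gives every coset of K a density,
-- and passing from a coset to the next one multiplies the density by 2 or by 2/3, up to a local flow along
-- a direction w ∈ K. If a point were fixed by an element of nonzero t-exponent, the sequence of factors would be
-- periodic; summing over almost invariant subsets of K then makes arbitrarily high powers of 2^m and 3^k
-- comparable, with m > 0. Points exist because the Beatty sequences ⌊αj⌋ realise all densities α in [1,3).
-- The elements of K are treated by recursion, down to Hirsch number 2, where t and the generator of K/N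
-- commute modulo N and may be exchanged. Colouring G by the cosets of P disposes of all elements outside the
-- conjugates of P, which leaves the finitely many conjugates of N under the coset representatives.

open import Defs
open import Level using (Level; _⊔_; Lift; lift; lower; 0ℓ)
open import Algebra.Bundles using (Group; AbelianGroup)
open import Data.Bool using (Bool; true; false; not; T)
open import Data.Nat using (ℕ; zero; suc; _+_; _*_; _^_; _!; _≤_; _<_; z≤n; s≤s; NonZero)
import Data.Nat as ℕ
import Data.Nat.Properties as ℕₚ
import Data.Nat.Divisibility as ℕ∣
open import Data.Integer using (ℤ; +_; -[1+_]; 0ℤ; 1ℤ)
import Data.Integer as ℤ
import Data.Integer.Properties as ℤₚ
import Data.Integer.DivMod as ℤ÷
import Data.Integer.Divisibility.Signed as ℤ∣
open import Data.Fin using (Fin; toℕ; fromℕ<)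
import Data.Fin as Fin
import Data.Fin.Properties as Finₚ
open import Data.List using (List; []; _∷_; _++_; map; concatMap; length; lookup; upTo; allFin)
import Data.List.Properties
import Algebra.Construct.Terminal as Terminal
open import Data.List.Relation.Unary.All using (All; []; _∷_)
import Data.List.Relation.Unary.All as All
import Data.List.Relation.Unary.All.Properties as Allₚ
open import Data.List.Relation.Unary.Any using (Any; here; there)
import Data.List.Relation.Unary.Any as Any
import Data.List.Relation.Unary.Any.Properties as Anyₚ
open import Data.List.Membership.Propositional using (_∈_; find; lose)
import Data.List.Membership.Propositional.Properties as ∈ₚ
open import Data.Product using (Σ; _×_; _,_; proj₁; proj₂)
open import Data.Sum using (_⊎_; inj₁; inj₂)
open import Data.Empty using (⊥; ⊥-elim)
open import Data.Unit using (⊤; tt)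
open import Data.Vec using (Vec)
import Data.Vec as Vec
open import Function using (_∘_; id; case_of_)
open import Relation.Nullary using (¬_; Dec; yes; no; contradiction)
open import Relation.Nullary.Decidable using (map′; ⌊_⌋; toWitness; fromWitness)
open import Relation.Binary.PropositionalEquality using (_≡_; _≢_; cong; cong₂; subst)
import Relation.Binary.PropositionalEquality as ≡
import Relation.Binary.Reflection as Reflection
import Relation.Binary.Reasoning.Setoid as SetoidReasoning
import Algebra.Properties.Group as GroupProperties
import Data.Integer.Tactic.RingSolver as ℤRing
import Data.Nat.Tactic.RingSolver as ℕRing

-- A letter is bounded, so a density is never stored: it is the average along w of increments of
-- ⌊αj⌋, and this needs an infinite K/N. A virtually infinite cyclic group offers no such room and
-- has no strongly aperiodic SFT, whence the excluded value 1. Doubling alone would leave every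
-- bounded range of densities; 2/3 is the companion that keeps the orbit in [1,3), and the product
-- of the factors over a period, 2^m/3^k, is not 1 by parity.
--
-- The rule between g and gt compares an increment along w with one along wᵗ. They run over equal
-- lengths only if some homomorphism K → ℤ takes the same nonzero value at w and wᵗ. In the Klein
-- bottle group t inverts K and no such w exists, so t is replaced by its square; in general a power
-- of t suffices, at the cost of a finite index.
--
-- Without decidable membership a list of cosets can be neither thinned out nor checked, so finite
-- index means a covering list that may repeat cosets. Decisions are instead made by comparing
-- integers, values of homomorphisms at finitely many elements.

ℤ-+-cancelˡ : ∀ i {j k} → i ℤ.+ j ≡ i ℤ.+ k → j ≡ k
ℤ-+-cancelˡ i {j} {k} = GroupProperties.∙-cancelˡ (AbelianGroup.group ℤₚ.+-0-abelianGroup) i j k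

-- The bound on the period is kept because `exponent` turns it into one exponent, a factorial, good
-- for all elements.
repeats : ∀ {m} (f : ℕ → Fin m) → Σ ℕ λ i → Σ ℕ λ r → suc r ≤ m × f i ≡ f (i + suc r)
repeats {m} f =
  let i , j , i<j , eq = Finₚ.pigeonhole (ℕₚ.n<1+n m) (λ i → f (toℕ i))
      r , si+r≡j       = ℕₚ.m≤n⇒∃[o]m+o≡n i<j
      j≡i+sr           = ≡.trans (≡.sym si+r≡j) (≡.sym (ℕₚ.+-suc (toℕ i) r))
  in toℕ i , r ,
     ℕₚ.≤-trans (ℕₚ.m≤n+m (suc r) (toℕ i)) (ℕₚ.≤-trans (ℕₚ.≤-reflexive (≡.sym j≡i+sr)) (ℕₚ.≤-pred (Finₚ.toℕ<n j))) ,
     ≡.trans eq (cong f j≡i+sr)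

-- Words in a group, powers and conjugation

module GroupLemmas {c ℓ : Level} (G : Group c ℓ) where
  open Group G
  open GroupProperties G using (⁻¹-involutive; ⁻¹-anti-homo-∙; ε⁻¹≈ε; ∙-cancelˡ; ∙-cancelʳ; inverseˡ-unique)
  open SetoidReasoning setoid

  data Expr (n : ℕ) : Set where
    var : Fin n → Expr n
    e₀  : Expr n
    _⊙_ : Expr n → Expr n → Expr n
    inv : Expr n → Expr n

  infixl 7 _⊙_

  private
    Word : ℕ → Set
    Word n = List (Bool × Fin n)

    letter : ∀ {n} → Vec Carrier n → Bool → Fin n → Carrier
    letter ρ true  i = Vec.lookup ρ i
    letter ρ false i = Vec.lookup ρ i ⁻¹

    ⟦_⟧ʷ : ∀ {n} → Word n → Vec Carrier n → Carrier
    ⟦ [] ⟧ʷ          ρ = ε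
    ⟦ (b , i) ∷ w ⟧ʷ ρ = letter ρ b i ∙ ⟦ w ⟧ʷ ρ

    -- Only cancellation at the head is tested: words arise by pushing onto freely reduced words, so
    -- they stay freely reduced.
    push : ∀ {n} → Bool → Fin n → Word n → Word n
    push b i [] = (b , i) ∷ []
    push b i ((b′ , j) ∷ w) with i Fin.≟ j
    push true  i ((false , j) ∷ w) | yes _ = w
    push false i ((true  , j) ∷ w) | yes _ = w
    push b     i ((b′    , j) ∷ w) | _     = (b , i) ∷ (b′ , j) ∷ w

    -- The Boolean is the sign given by the enclosing inverses; the last argument is the word
    -- already accumulated on the right.
    flatten : ∀ {n} → Bool → Expr n → Word n → Word n
    flatten b     (var i) w = push b i w
    flatten b     e₀      w = w
    flatten true  (x ⊙ y) w = flatten true x (flatten true y w)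
    flatten false (x ⊙ y) w = flatten false y (flatten false x w)
    flatten b     (inv x) w = flatten (not b) x w

    ⟦_⟧ : ∀ {n} → Expr n → Vec Carrier n → Carrier
    ⟦ var i ⟧ ρ = Vec.lookup ρ i
    ⟦ e₀ ⟧    ρ = ε
    ⟦ x ⊙ y ⟧ ρ = ⟦ x ⟧ ρ ∙ ⟦ y ⟧ ρ
    ⟦ inv x ⟧ ρ = ⟦ x ⟧ ρ ⁻¹

    ⟦_⇓⟧ : ∀ {n} → Expr n → Vec Carrier n → Carrier
    ⟦ x ⇓⟧ ρ = ⟦ flatten true x [] ⟧ʷ ρ

    push-sound : ∀ {n} (ρ : Vec Carrier n) b i w → ⟦ push b i w ⟧ʷ ρ ≈ letter ρ b i ∙ ⟦ w ⟧ʷ ρ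
    push-sound ρ b i [] = refl
    push-sound ρ b i ((b′ , j) ∷ w) with i Fin.≟ j
    push-sound ρ true  i ((true  , j) ∷ w) | yes _ = refl
    push-sound ρ false i ((false , j) ∷ w) | yes _ = refl
    push-sound ρ true  i ((false , j) ∷ w) | yes ≡.refl = begin
      ⟦ w ⟧ʷ ρ                                          ≈⟨ identityˡ _ ⟨
      ε ∙ ⟦ w ⟧ʷ ρ                                      ≈⟨ ∙-congʳ (inverseʳ _) ⟨
      (Vec.lookup ρ i ∙ Vec.lookup ρ i ⁻¹) ∙ ⟦ w ⟧ʷ ρ  ≈⟨ assoc _ _ _ ⟩
      Vec.lookup ρ i ∙ (Vec.lookup ρ i ⁻¹ ∙ ⟦ w ⟧ʷ ρ)  ∎
    push-sound ρ false i ((true  , j) ∷ w) | yes ≡.refl = begin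
      ⟦ w ⟧ʷ ρ                                          ≈⟨ identityˡ _ ⟨
      ε ∙ ⟦ w ⟧ʷ ρ                                      ≈⟨ ∙-congʳ (inverseˡ _) ⟨
      (Vec.lookup ρ i ⁻¹ ∙ Vec.lookup ρ i) ∙ ⟦ w ⟧ʷ ρ  ≈⟨ assoc _ _ _ ⟩
      Vec.lookup ρ i ⁻¹ ∙ (Vec.lookup ρ i ∙ ⟦ w ⟧ʷ ρ)  ∎
    push-sound ρ true  i ((true  , j) ∷ w) | no _ = refl
    push-sound ρ true  i ((false , j) ∷ w) | no _ = refl
    push-sound ρ false i ((true  , j) ∷ w) | no _ = refl
    push-sound ρ false i ((false , j) ∷ w) | no _ = refl

    signed : Bool → Carrier → Carrier
    signed true  x = x
    signed false x = x ⁻¹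

    flatten-sound : ∀ {n} (ρ : Vec Carrier n) b x w → ⟦ flatten b x w ⟧ʷ ρ ≈ signed b (⟦ x ⟧ ρ) ∙ ⟦ w ⟧ʷ ρ
    flatten-sound ρ true  (var i) w = push-sound ρ true i w
    flatten-sound ρ false (var i) w = push-sound ρ false i w
    flatten-sound ρ true  e₀ w = sym (identityˡ _)
    flatten-sound ρ false e₀ w = sym (trans (∙-congʳ ε⁻¹≈ε) (identityˡ _))
    flatten-sound ρ true  (x ⊙ y) w = begin
      _ ≈⟨ flatten-sound ρ true x _ ⟩
      _ ≈⟨ ∙-congˡ (flatten-sound ρ true y w) ⟩
      _ ≈⟨ assoc _ _ _ ⟨
      _ ∎
    flatten-sound ρ false (x ⊙ y) w = begin
      _ ≈⟨ flatten-sound ρ false y _ ⟩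
      _ ≈⟨ ∙-congˡ (flatten-sound ρ false x w) ⟩
      _ ≈⟨ assoc _ _ _ ⟨
      _ ≈⟨ ∙-congʳ (⁻¹-anti-homo-∙ _ _) ⟨
      _ ∎
    flatten-sound ρ true  (inv x) w = flatten-sound ρ false x w
    flatten-sound ρ false (inv x) w = trans (flatten-sound ρ true x w) (∙-congʳ (sym (⁻¹-involutive _)))

    ⇓-sound : ∀ {n} (x : Expr n) ρ → ⟦ x ⇓⟧ ρ ≈ ⟦ x ⟧ ρ
    ⇓-sound x ρ = trans (flatten-sound ρ true x []) (identityʳ _)

  open Reflection setoid var ⟦_⟧ ⟦_⇓⟧ ⇓-sound public using (solve; _⊜_)

  infixr 8 _^ⁿ_ _^ᶻ_
  _^ⁿ_ : Carrier → ℕ → Carrier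
  _^ⁿ_ = natPow G
  _^ᶻ_ : Carrier → ℤ → Carrier
  _^ᶻ_ = pow G

  ^ⁿ-cong : ∀ {x y} n → x ≈ y → x ^ⁿ n ≈ y ^ⁿ n
  ^ⁿ-cong zero    x≈y = refl
  ^ⁿ-cong (suc n) x≈y = ∙-cong x≈y (^ⁿ-cong n x≈y)

  ^ⁿ-+ : ∀ x m n → x ^ⁿ (m + n) ≈ x ^ⁿ m ∙ x ^ⁿ n
  ^ⁿ-+ x zero    n = sym (identityˡ _)
  ^ⁿ-+ x (suc m) n = trans (∙-congˡ (^ⁿ-+ x m n)) (sym (assoc _ _ _))

  ^ⁿ-* : ∀ x m n → x ^ⁿ (n * m) ≈ (x ^ⁿ m) ^ⁿ n
  ^ⁿ-* x m zero    = refl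
  ^ⁿ-* x m (suc n) = trans (^ⁿ-+ x m (n * m)) (∙-congˡ (^ⁿ-* x m n))

  ^ⁿ-comm : ∀ x n → x ∙ x ^ⁿ n ≈ x ^ⁿ n ∙ x
  ^ⁿ-comm x zero    = trans (identityʳ x) (sym (identityˡ x))
  ^ⁿ-comm x (suc n) = trans (∙-congˡ (^ⁿ-comm x n)) (sym (assoc _ _ _))

  ^ⁿ-⁻¹ : ∀ x n → (x ⁻¹) ^ⁿ n ≈ (x ^ⁿ n) ⁻¹
  ^ⁿ-⁻¹ x zero    = sym ε⁻¹≈ε
  ^ⁿ-⁻¹ x (suc n) = begin
    x ⁻¹ ∙ (x ⁻¹) ^ⁿ n  ≈⟨ ∙-congˡ (^ⁿ-⁻¹ x n) ⟩
    x ⁻¹ ∙ (x ^ⁿ n) ⁻¹  ≈⟨ ⁻¹-anti-homo-∙ _ _ ⟨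
    (x ^ⁿ n ∙ x) ⁻¹     ≈⟨ ⁻¹-cong (^ⁿ-comm x n) ⟨
    (x ∙ x ^ⁿ n) ⁻¹     ∎

  infixl 8 _^ᶜ_
  _^ᶜ_ : Carrier → Carrier → Carrier
  x ^ᶜ d = (d ⁻¹ ∙ x) ∙ d

  ^ᶜ-cong : ∀ {x y} d → x ≈ y → x ^ᶜ d ≈ y ^ᶜ d
  ^ᶜ-cong d x≈y = ∙-congʳ (∙-congˡ x≈y)

  ^ᶜ-congʳ : ∀ x {d e} → d ≈ e → x ^ᶜ d ≈ x ^ᶜ e
  ^ᶜ-congʳ x d≈e = ∙-cong (∙-congʳ (⁻¹-cong d≈e)) d≈e

  ^ᶜ-∙ : ∀ x y d → (x ∙ y) ^ᶜ d ≈ x ^ᶜ d ∙ y ^ᶜ d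
  ^ᶜ-∙ = solve 3 (λ x y d → (inv d ⊙ (x ⊙ y)) ⊙ d ⊜ ((inv d ⊙ x) ⊙ d) ⊙ ((inv d ⊙ y) ⊙ d)) refl

  ^ᶜ-ε : ∀ d → ε ^ᶜ d ≈ ε
  ^ᶜ-ε = solve 1 (λ d → (inv d ⊙ e₀) ⊙ d ⊜ e₀) refl

  ^ᶜ-⁻¹ : ∀ x d → (x ⁻¹) ^ᶜ d ≈ (x ^ᶜ d) ⁻¹
  ^ᶜ-⁻¹ = solve 2 (λ x d → (inv d ⊙ inv x) ⊙ d ⊜ inv ((inv d ⊙ x) ⊙ d)) refl

  ^ᶜ-^ᶜ : ∀ x d e → (x ^ᶜ d) ^ᶜ e ≈ x ^ᶜ (d ∙ e)
  ^ᶜ-^ᶜ = solve 3 (λ x d e → (inv e ⊙ ((inv d ⊙ x) ⊙ d)) ⊙ e ⊜ (inv (d ⊙ e) ⊙ x) ⊙ (d ⊙ e)) refl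

  ^ᶜ-by-ε : ∀ x → x ^ᶜ ε ≈ x
  ^ᶜ-by-ε = solve 1 (λ x → (inv e₀ ⊙ x) ⊙ e₀ ⊜ x) refl

  ^ᶜ-cancel : ∀ x d → (x ^ᶜ (d ⁻¹)) ^ᶜ d ≈ x
  ^ᶜ-cancel = solve 2 (λ x d → (inv d ⊙ ((inv (inv d) ⊙ x) ⊙ inv d)) ⊙ d ⊜ x) refl

  ^ᶜ-^ⁿ : ∀ x d n → (x ^ᶜ d) ^ⁿ n ≈ (x ^ⁿ n) ^ᶜ d
  ^ᶜ-^ⁿ x d zero    = sym (^ᶜ-ε d)
  ^ᶜ-^ⁿ x d (suc n) = trans (∙-congˡ (^ᶜ-^ⁿ x d n)) (sym (^ᶜ-∙ x (x ^ⁿ n) d))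

  ^ᶻ-suc : ∀ x i → x ^ᶻ (ℤ.suc i) ≈ x ∙ x ^ᶻ i
  ^ᶻ-suc x (+ n)           = refl
  ^ᶻ-suc x -[1+ zero ]     = solve 1 (λ x → e₀ ⊜ x ⊙ (inv x ⊙ e₀)) refl x
  ^ᶻ-suc x -[1+ suc n ]    = solve 2 (λ x y → y ⊜ x ⊙ (inv x ⊙ y)) refl x (x ⁻¹ ∙ (x ⁻¹) ^ⁿ n)

  ^ᶻ-pred : ∀ x i → x ^ᶻ (ℤ.pred i) ≈ x ⁻¹ ∙ x ^ᶻ i
  ^ᶻ-pred x (+ zero)    = refl
  ^ᶻ-pred x (+ (suc n)) = solve 2 (λ x y → y ⊜ inv x ⊙ (x ⊙ y)) refl x (x ^ⁿ n)
  ^ᶻ-pred x -[1+ n ]    = refl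

  ^ᶻ-+ : ∀ x i j → x ^ᶻ (i ℤ.+ j) ≈ x ^ᶻ i ∙ x ^ᶻ j
  ^ᶻ-+ x (+ zero) j = trans (reflexive (cong (x ^ᶻ_) (ℤₚ.+-identityˡ j))) (sym (identityˡ _))
  ^ᶻ-+ x (+ suc n) j = begin
    x ^ᶻ (+ suc n ℤ.+ j)         ≡⟨ cong (x ^ᶻ_) (ℤₚ.suc-+ n j) ⟩
    x ^ᶻ (ℤ.suc (+ n ℤ.+ j))     ≈⟨ ^ᶻ-suc x (+ n ℤ.+ j) ⟩
    x ∙ x ^ᶻ (+ n ℤ.+ j)         ≈⟨ ∙-congˡ (^ᶻ-+ x (+ n) j) ⟩
    x ∙ (x ^ᶻ (+ n) ∙ x ^ᶻ j)    ≈⟨ assoc _ _ _ ⟨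
    x ^ᶻ (+ suc n) ∙ x ^ᶻ j      ∎
  ^ᶻ-+ x -[1+ zero ] j = trans (^ᶻ-pred x j) (∙-congʳ (sym (identityʳ _)))
  ^ᶻ-+ x -[1+ suc n ] j = begin
    x ^ᶻ (-[1+ suc n ] ℤ.+ j)       ≡⟨ cong (x ^ᶻ_) (ℤₚ.+-assoc -[1+ 0 ] -[1+ n ] j) ⟩
    x ^ᶻ (ℤ.pred (-[1+ n ] ℤ.+ j))  ≈⟨ ^ᶻ-pred x (-[1+ n ] ℤ.+ j) ⟩
    x ⁻¹ ∙ x ^ᶻ (-[1+ n ] ℤ.+ j)    ≈⟨ ∙-congˡ (^ᶻ-+ x -[1+ n ] j) ⟩
    x ⁻¹ ∙ (x ^ᶻ -[1+ n ] ∙ x ^ᶻ j) ≈⟨ assoc _ _ _ ⟨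
    x ^ᶻ -[1+ suc n ] ∙ x ^ᶻ j      ∎

  ^ᶻ-neg : ∀ x i → x ^ᶻ (ℤ.- i) ≈ (x ^ᶻ i) ⁻¹
  ^ᶻ-neg x i = inverseˡ-unique _ _ (trans (sym (^ᶻ-+ x (ℤ.- i) i)) (reflexive (cong (x ^ᶻ_) (ℤₚ.+-inverseˡ i))))

  ^ᶻ-cong : ∀ {x y} i → x ≈ y → x ^ᶻ i ≈ y ^ᶻ i
  ^ᶻ-cong (+ n)    x≈y = ^ⁿ-cong n x≈y
  ^ᶻ-cong -[1+ n ] x≈y = ^ⁿ-cong (suc n) (⁻¹-cong x≈y)

  ^ᶻ-ε : ∀ i → ε ^ᶻ i ≈ ε
  ^ᶻ-ε (+ n)    = go n
    where
    go : ∀ n → ε ^ⁿ n ≈ ε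
    go zero    = refl
    go (suc n) = trans (identityˡ _) (go n)
  ^ᶻ-ε -[1+ n ] = trans (^ⁿ-⁻¹ ε (suc n)) (trans (⁻¹-cong (^ᶻ-ε (+ suc n))) ε⁻¹≈ε)

  ^ᶻ-*ⁿ : ∀ x n j → x ^ᶻ (+ n ℤ.* j) ≈ (x ^ⁿ n) ^ᶻ j
  ^ᶻ-*ⁿ x n (+ m) = begin
    x ^ᶻ (+ n ℤ.* + m)  ≡⟨ cong (x ^ᶻ_) (≡.trans (≡.sym (ℤₚ.pos-* n m)) (cong +_ (ℕₚ.*-comm n m))) ⟩
    x ^ⁿ (m * n)        ≈⟨ ^ⁿ-* x n m ⟩
    (x ^ⁿ n) ^ⁿ m       ∎
  ^ᶻ-*ⁿ x n -[1+ m ] = begin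
    x ^ᶻ (+ n ℤ.* -[1+ m ])      ≡⟨ cong (x ^ᶻ_) (≡.sym (ℤₚ.neg-distribʳ-* (+ n) (+ suc m))) ⟩
    x ^ᶻ (ℤ.- (+ n ℤ.* + suc m)) ≈⟨ ^ᶻ-neg x (+ n ℤ.* + suc m) ⟩
    (x ^ᶻ (+ n ℤ.* + suc m)) ⁻¹  ≈⟨ ⁻¹-cong (^ᶻ-*ⁿ x n (+ suc m)) ⟩
    ((x ^ⁿ n) ^ⁿ suc m) ⁻¹       ≈⟨ ^ⁿ-⁻¹ (x ^ⁿ n) (suc m) ⟨
    ((x ^ⁿ n) ⁻¹) ^ⁿ suc m       ∎

  ^ᶻ-divMod : ∀ x r j → x ^ᶻ j ≈ x ^ⁿ (j ℤ÷.%ℕ suc r) ∙ (x ^ⁿ suc r) ^ᶻ (j ℤ÷./ℕ suc r)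
  ^ᶻ-divMod x r j = begin
    x ^ᶻ j                                       ≡⟨ cong (x ^ᶻ_) (ℤ÷.a≡a%ℕn+[a/ℕn]*n j R) ⟩
    x ^ᶻ (+ (j ℤ÷.%ℕ R) ℤ.+ q ℤ.* + R)           ≈⟨ ^ᶻ-+ x (+ (j ℤ÷.%ℕ R)) (q ℤ.* + R) ⟩
    x ^ⁿ (j ℤ÷.%ℕ R) ∙ x ^ᶻ (q ℤ.* + R)          ≡⟨ cong (λ i → x ^ⁿ (j ℤ÷.%ℕ R) ∙ x ^ᶻ i) (ℤₚ.*-comm q (+ R)) ⟩
    x ^ⁿ (j ℤ÷.%ℕ R) ∙ x ^ᶻ (+ R ℤ.* q)          ≈⟨ ∙-congˡ (^ᶻ-*ⁿ x R q) ⟩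
    x ^ⁿ (j ℤ÷.%ℕ R) ∙ (x ^ⁿ R) ^ᶻ q             ∎
    where
    R = suc r
    q = j ℤ÷./ℕ R

  ^ᶜ-^ᶻ : ∀ x d i → (x ^ᶜ d) ^ᶻ i ≈ (x ^ᶻ i) ^ᶜ d
  ^ᶜ-^ᶻ x d (+ n)    = ^ᶜ-^ⁿ x d n
  ^ᶜ-^ᶻ x d -[1+ n ] = trans (^ⁿ-cong (suc n) (sym (^ᶜ-⁻¹ x d))) (^ᶜ-^ⁿ (x ⁻¹) d (suc n))

-- Integer homomorphisms, finite index and series with undecided membership

module Subgroups {c ℓ p : Level} (G : Group c ℓ) where
  open Group G
  open GroupLemmas G
  open SetoidReasoning setoid

  Sub : Set _
  Sub = Subgroup G (c ⊔ p)

  mem-^ⁿ : ∀ (H : Sub) {x} n → mem H x → mem H (x ^ⁿ n)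
  mem-^ⁿ H zero    x∈ = ε∈ H
  mem-^ⁿ H (suc n) x∈ = ∙∈ H x∈ (mem-^ⁿ H n x∈)

  mem-^ᶻ : ∀ (H : Sub) {x} i → mem H x → mem H (x ^ᶻ i)
  mem-^ᶻ H (+ n)    x∈ = mem-^ⁿ H n x∈
  mem-^ᶻ H -[1+ n ] x∈ = mem-^ⁿ H (suc n) (⁻¹∈ H x∈)

  mem-^ᶜ : ∀ (H : Sub) {x d} → mem H x → mem H d → mem H (x ^ᶜ d)
  mem-^ᶜ H x∈ d∈ = ∙∈ H (∙∈ H (⁻¹∈ H d∈) x∈) d∈

  _∩_ : Sub → Sub → Sub
  H ∩ U = record
    { mem  = λ x → mem H x × mem U x
    ; resp = λ { eq (a , b) → resp H eq a , resp U eq b }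
    ; ε∈   = ε∈ H , ε∈ U
    ; ∙∈   = λ { (a , b) (a′ , b′) → ∙∈ H a a′ , ∙∈ U b b′ }
    ; ⁻¹∈  = λ { (a , b) → ⁻¹∈ H a , ⁻¹∈ U b }
    }

  -- The value takes the membership proof as an argument, since membership is not decided; `fn-cong`
  -- makes it independent of that proof.
  record Hom (E : Sub) : Set (c ⊔ ℓ ⊔ p) where
    field
      fn      : ∀ x → mem E x → ℤ
      fn-cong : ∀ {x y} p q → x ≈ y → fn x p ≡ fn y q
      fn-∙    : ∀ {x y} p q r → fn (x ∙ y) r ≡ fn x p ℤ.+ fn y q

    fn-irr : ∀ {x} p q → fn x p ≡ fn x q
    fn-irr p q = fn-cong p q refl

    fn-ε : ∀ {x} p → x ≈ ε → fn x p ≡ 0ℤ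
    fn-ε {x} p eq = ℤ-+-cancelˡ (fn x p) (≡.trans (≡.trans (≡.sym (fn-∙ p p (∙∈ E p p))) (fn-cong _ p (trans (∙-congˡ eq) (identityʳ x)))) (≡.sym (ℤₚ.+-identityʳ _)))

    fn-⁻¹ : ∀ {x} p q → fn (x ⁻¹) q ≡ ℤ.- fn x p
    fn-⁻¹ {x} p q = ℤ-+-cancelˡ (fn x p) (≡.trans (≡.sym (fn-∙ p q (∙∈ E p q))) (≡.trans (fn-ε _ (inverseʳ x)) (≡.sym (ℤₚ.+-inverseʳ (fn x p)))))

    fn-^ⁿ : ∀ {x} n p q → fn (x ^ⁿ n) q ≡ + n ℤ.* fn x p
    fn-^ⁿ zero    p q = fn-ε q refl
    fn-^ⁿ {x} (suc n) p q = ≡.trans (fn-∙ p (mem-^ⁿ E n p) q) (≡.trans (cong (λ z → fn x p ℤ.+ z) (fn-^ⁿ n p _)) (≡.sym (ℤₚ.suc-* (+ n) (fn x p))))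

    fn-^ᶻ : ∀ {x} i p q → fn (x ^ᶻ i) q ≡ i ℤ.* fn x p
    fn-^ᶻ (+ n)    p q = fn-^ⁿ n p q
    fn-^ᶻ {x} -[1+ n ] p q = ≡.trans (fn-^ⁿ (suc n) (⁻¹∈ E p) q) (≡.trans (cong (+ suc n ℤ.*_) (fn-⁻¹ p _)) (≡.trans (≡.sym (ℤₚ.neg-distribʳ-* (+ suc n) (fn x p))) (ℤₚ.neg-distribˡ-* (+ suc n) (fn x p))))

    -- ℤ is torsion-free: an equality of values may be checked on powers, hence on a subgroup of
    -- finite index.
    fn-root : ∀ {x y} n (p : mem E x) (q : mem E y) p′ q′ → fn (x ^ⁿ suc n) p′ ≡ fn (y ^ⁿ suc n) q′ → fn x p ≡ fn y q
    fn-root {x} {y} n p q p′ q′ eq = ℤₚ.*-cancelˡ-≡ (+ suc n) (fn x p) (fn y q) (≡.trans (≡.sym (fn-^ⁿ (suc n) p p′)) (≡.trans eq (fn-^ⁿ (suc n) q q′)))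

    fn-^ᶜ : ∀ {x d} p q → mem E d → fn (x ^ᶜ d) q ≡ fn x p
    fn-^ᶜ {x} {d} p q d∈ = ≡.trans (fn-∙ (∙∈ E (⁻¹∈ E d∈) p) d∈ q)
      (≡.trans (cong (ℤ._+ fn d d∈) (≡.trans (fn-∙ (⁻¹∈ E d∈) p _) (cong (ℤ._+ fn x p) (fn-⁻¹ d∈ _))))
               (conjugate (fn d d∈) (fn x p)))
      where
      conjugate : ∀ d x → ℤ.- d ℤ.+ x ℤ.+ d ≡ x
      conjugate = ℤRing.solve-∀

  open Hom public

  restrictHom : ∀ {E E′ : Sub} → (∀ {x} → mem E′ x → mem E x) → Hom E → Hom E′
  restrictHom ⊆ τ = record
    { fn      = λ x p → fn τ x (⊆ p)
    ; fn-cong = λ p q → fn-cong τ (⊆ p) (⊆ q)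
    ; fn-∙    = λ p q r → fn-∙ τ (⊆ p) (⊆ q) (⊆ r)
    }

  -- Finite index without decisions: the listed left cosets of U may repeat, and a representative
  -- may lie outside D.
  Cover : Sub → Sub → List Carrier → Set (c ⊔ p)
  Cover D U L = ∀ {x} → mem D x → Any (λ l → mem U (l ⁻¹ ∙ x)) L

  Enumerated : Sub → List Carrier → Set (c ⊔ ℓ ⊔ p)
  Enumerated D L = ∀ {x} → mem D x → Any (x ≈_) L

  ≈-quotient : ∀ (U : Sub) {l x} → x ≈ l → mem U (l ⁻¹ ∙ x)
  ≈-quotient U eq = resp U (trans (sym (inverseˡ _)) (∙-congˡ (sym eq))) (ε∈ U)

  -- Two powers of x fall into the same listed coset, and their quotient is a power of x in U.
  power-in : ∀ {D U L} → Cover D U L → ∀ {x} → mem D x → Σ ℕ λ r → suc r ≤ length L × mem U (x ^ⁿ suc r)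
  power-in {D} {U} {L} cov {x} x∈ =
    let i , r , r< , eq = repeats (λ i → Any.index (cov (mem-^ⁿ D i x∈)))
        memᵢ = Anyₚ.lookup-index (cov (mem-^ⁿ D i x∈))
        memⱼ = subst (λ k → mem U (lookup L k ⁻¹ ∙ x ^ⁿ (i + suc r))) (≡.sym eq) (Anyₚ.lookup-index (cov (mem-^ⁿ D (i + suc r) x∈)))
    in r , r< , resp U (trans (∙-congˡ (∙-congˡ (^ⁿ-+ x i (suc r)))) (solve 3 (λ l a b → inv (inv l ⊙ a) ⊙ (inv l ⊙ (a ⊙ b)) ⊜ b) refl _ (x ^ⁿ i) (x ^ⁿ suc r)))
         (∙∈ U (⁻¹∈ U memᵢ) memⱼ)

  -- Every exponent found by `power-in` is at most the number of cosets, hence divides its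
  -- factorial.
  exponent : ∀ {D U L} → Cover D U L → Σ ℕ λ r → ∀ {x} → mem D x → mem U (x ^ⁿ suc r)
  exponent {D} {U} {L} cov = ℕ.pred (length L !) , λ {x} x∈ →
    let r , r≤ , m = power-in {D} {U} cov x∈
        ℕ∣.divides q eq = ℕ∣.∣-trans (ℕ∣.m∣m*n {suc r} (r !)) (ℕ∣.m≤n⇒m!∣n! r≤)
    in subst (λ k → mem U (x ^ⁿ k)) (≡.trans (≡.sym eq) (≡.sym (ℕₚ.suc-pred (length L !) {{ℕ.>-nonZero (ℕₚ.1≤n! (length L))}})))
         (resp U (sym (^ⁿ-* x (suc r) q)) (mem-^ⁿ U q m))

  -- One infinite factor, in a form that survives passage to subgroups of finite index: `τ` need not
  -- be onto, since `t` gets replaced by powers, and `E` need only have finite index in D.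
  record Layer {v} (D : Sub) (X : Sub → Set v) : Set (Level.suc (c ⊔ p) ⊔ ℓ ⊔ v) where
    field
      E K   : Sub
      E⊆D   : ∀ {x} → mem E x → mem D x
      τ     : Hom E
      t     : Carrier
      t∈E   : mem E t
      τt≢0  : fn τ t t∈E ≢ 0ℤ
      K⊆E   : ∀ {x} → mem K x → mem E x
      K⇒0   : ∀ {x} → mem K x → (e : mem E x) → fn τ x e ≡ 0ℤ
      0⇒K   : ∀ {x} (e : mem E x) → fn τ x e ≡ 0ℤ → mem K x
      reps  : List Carrier
      cover : ∀ {x} → mem D x → Any (λ l → Σ ℤ λ j → mem K ((l ∙ t ^ᶻ j) ⁻¹ ∙ x)) reps
      rest  : X K

    K-normal : ∀ {x d} → mem K x → mem E d → mem K (x ^ᶜ d)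
    K-normal x∈ d∈ = let m = mem-^ᶜ E (K⊆E x∈) d∈ in 0⇒K m (≡.trans (fn-^ᶜ τ (K⊆E x∈) m d∈) (K⇒0 x∈ _))

    coverE : Cover D E reps
    coverE {x} x∈ = Any.map (λ { {l} (j , k∈) → resp E (lem l (t ^ᶻ j) x) (∙∈ E (mem-^ᶻ E j t∈E) (K⊆E k∈)) }) (cover x∈)
      where
      lem : ∀ l a x → a ∙ ((l ∙ a) ⁻¹ ∙ x) ≈ l ⁻¹ ∙ x
      lem = solve 3 (λ l a x → a ⊙ (inv (l ⊙ a) ⊙ x) ⊜ inv l ⊙ x) refl

  -- Only infinite factors are counted; finite ones are absorbed into the lists of representatives.
  data VS : ℕ → Sub → Set (Level.suc (c ⊔ p) ⊔ ℓ) where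
    fin   : ∀ {D} L → Enumerated D L → VS 0 D
    layer : ∀ {n D} → Layer D (VS n) → VS (suc n) D

  products : List Carrier → List Carrier → List Carrier
  products M L = concatMap (λ m → map (m ∙_) L) M

  products⁺ : ∀ {ℓ′} {P : Carrier → Set ℓ′} M {L} → Any (λ m → Any (λ l → P (m ∙ l)) L) M → Any P (products M L)
  products⁺ M a = Anyₚ.concatMap⁺ _ (Any.map Anyₚ.map⁺ a)

  module _ {D K : Sub} {M : List Carrier} (cov : Cover D K M) where
    finiteIndexLayer : ∀ {v} {X : Sub → Set v} → (∀ {x} → mem K x → mem D x) → Layer K X → Layer D X
    finiteIndexLayer K⊆D y = record
      { E = E ; K = Layer.K y ; E⊆D = λ e → K⊆D (E⊆D e) ; τ = τ ; t = t ; t∈E = t∈E ; τt≢0 = τt≢0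
      ; K⊆E = K⊆E ; K⇒0 = K⇒0 ; 0⇒K = 0⇒K ; reps = products M reps
      ; cover = λ {x} x∈ → products⁺ M (Any.map (λ {m} k∈ → Any.map (λ { {l} (j , k′∈) → j , resp (Layer.K y) (lem m l (t ^ᶻ j) x) k′∈ }) (cover k∈)) (cov x∈))
      ; rest = rest }
      where
      open Layer y
      lem : ∀ m l a x → (l ∙ a) ⁻¹ ∙ (m ⁻¹ ∙ x) ≈ ((m ∙ l) ∙ a) ⁻¹ ∙ x
      lem = solve 4 (λ m l a x → inv (l ⊙ a) ⊙ (inv m ⊙ x) ⊜ inv ((m ⊙ l) ⊙ a) ⊙ x) refl

    finiteIndexVS : ∀ {n} → (∀ {x} → mem K x → mem D x) → VS n K → VS n D
    finiteIndexVS K⊆D (fin L enum) = fin (products M L) λ {x} x∈ →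
      products⁺ M (Any.map (λ {m} k∈ → Any.map (λ {l} eq → trans (lem m x) (∙-congˡ eq)) (enum k∈)) (cov x∈))
      where
      lem : ∀ m x → x ≈ m ∙ (m ⁻¹ ∙ x)
      lem = solve 2 (λ m x → x ⊜ m ⊙ (inv m ⊙ x)) refl
    finiteIndexVS K⊆D (layer y) = layer (finiteIndexLayer K⊆D y)

  -- The representatives need not lie in D ∩ U, since membership in U is not decided.
  module _ (U : Sub) (r : ℕ) where
    private R = suc r

    restrictVS : ∀ {n D} → (∀ {x} → mem D x → mem U (x ^ⁿ R)) → VS n D → VS n (D ∩ U) × Σ (List Carrier) (Cover D (D ∩ U))
    restrictLayer : ∀ {n D} → (∀ {x} → mem D x → mem U (x ^ⁿ R)) → (y : Layer D (VS n)) → Σ (Layer (D ∩ U) (VS n)) (λ z → Cover D (D ∩ U) (Layer.reps z) × (∀ {x} → mem (Layer.E z) x → mem (Layer.E y) x × mem U x) × (∀ {x} → mem (Layer.E y) x → mem U x → mem (Layer.E z) x))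

    restrictVS {D = D} pow∈ (fin L enum) = fin L (λ x∈ → enum (proj₁ x∈)) , L , λ x∈ → Any.map (≈-quotient (D ∩ U)) (enum x∈)
    restrictVS pow∈ (layer y) = let z , cov , _ = restrictLayer pow∈ y in layer z , _ , cov

    restrictLayer {n} {D} pow∈ y = z , coverDU , id , (_,_)
      where
      open Layer y
      below = restrictVS {D = K} (λ k → pow∈ (E⊆D (K⊆E k))) rest
      M     = proj₁ (proj₂ below)
      covK  = proj₂ (proj₂ below)
      t′ = t ^ⁿ R
      t′∈ : mem (E ∩ U) t′
      t′∈ = mem-^ⁿ E R t∈E , pow∈ (E⊆D t∈E)
      L′ = products (products reps (map (t ^ⁿ_) (upTo R))) M
      identity₁ : ∀ l a b m x → (m ⁻¹ ∙ (((l ∙ (a ∙ b)) ⁻¹ ∙ x) ^ᶜ (b ⁻¹))) ^ᶜ b ≈ (((l ∙ a) ∙ m) ∙ b) ⁻¹ ∙ x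
      identity₁ = solve 5 (λ l a b m x → (inv b ⊙ (inv m ⊙ ((inv (inv b) ⊙ (inv (l ⊙ (a ⊙ b)) ⊙ x)) ⊙ inv b))) ⊙ b ⊜ inv (((l ⊙ a) ⊙ m) ⊙ b) ⊙ x) refl
      cover′ : ∀ {x} → mem D x → Any (λ l → Σ ℤ λ j → mem (K ∩ U) ((l ∙ t′ ^ᶻ j) ⁻¹ ∙ x)) L′
      cover′ {x} x∈ = products⁺ (products reps (map (t ^ⁿ_) (upTo R))) (products⁺ reps (Any.map step₁ (cover x∈)))
        where
        Goal : Carrier → Set _
        Goal l = Σ ℤ λ j → mem (K ∩ U) ((l ∙ t′ ^ᶻ j) ⁻¹ ∙ x)
        -- Here x = l a b k with b a power of `t′`. Writing b k b⁻¹ = m u with u in K ∩ U gives x =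
        -- l a m b uᵇ, so the list of the m does not depend on the exponent of b.
        step₁ : ∀ {l} → (Σ ℤ λ j → mem K ((l ∙ t ^ᶻ j) ⁻¹ ∙ x)) → Any (λ a → Any (λ m → Goal ((l ∙ a) ∙ m)) M) (map (t ^ⁿ_) (upTo R))
        step₁ {l} (j , k∈) = Anyₚ.map⁺ (lose (∈ₚ.∈-upTo⁺ (ℤ÷.n%ℕd<d j R)) (Any.map step₂ (covK (K-normal k∈′ (⁻¹∈ E (proj₁ b∈))))))
          where
          a = t ^ⁿ (j ℤ÷.%ℕ R)
          q = j ℤ÷./ℕ R
          b = t′ ^ᶻ q
          b∈ : mem (E ∩ U) b
          b∈ = mem-^ᶻ (E ∩ U) q t′∈
          k∈′ : mem K ((l ∙ (a ∙ b)) ⁻¹ ∙ x)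
          k∈′ = resp K (∙-congʳ (⁻¹-cong (∙-congˡ (^ᶻ-divMod t r j)))) k∈
          step₂ : ∀ {m} → mem (K ∩ U) (m ⁻¹ ∙ (((l ∙ (a ∙ b)) ⁻¹ ∙ x) ^ᶜ (b ⁻¹))) → Goal ((l ∙ a) ∙ m)
          step₂ {m} (u∈K , u∈U) = q , resp K (identity₁ l a b m x) (K-normal u∈K (proj₁ b∈)) , resp U (identity₁ l a b m x) (mem-^ᶜ U u∈U (proj₂ b∈))
      z : Layer (D ∩ U) (VS n)
      z = record
        { E = E ∩ U ; K = K ∩ U ; E⊆D = λ { (e , u) → E⊆D e , u } ; τ = restrictHom proj₁ τ
        ; t = t′ ; t∈E = t′∈
        ; τt≢0 = λ eq → τt≢0 (case ℤₚ.i*j≡0⇒i≡0∨j≡0 (+ R) (≡.trans (≡.sym (fn-^ⁿ τ R t∈E (proj₁ t′∈))) eq) of λ { (inj₁ ()) ; (inj₂ e) → e })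
        ; K⊆E = λ { (k , u) → K⊆E k , u } ; K⇒0 = λ { (k , u) (e , _) → K⇒0 k e }
        ; 0⇒K = λ { (e , u) eq → 0⇒K e eq , u }
        ; reps = L′ ; cover = λ x∈ → cover′ (proj₁ x∈) ; rest = proj₁ below }
      coverDU : Cover D (D ∩ U) L′
      coverDU {x} x∈ = Any.map (λ { {l} (j , k∈ , u∈) → resp (D ∩ U) (lem l (t′ ^ᶻ j) x) (∙∈ (D ∩ U) (E⊆D (proj₁ (mem-^ᶻ (E ∩ U) j t′∈)) , proj₂ (mem-^ᶻ (E ∩ U) j t′∈)) (E⊆D (K⊆E k∈) , u∈)) }) (cover′ x∈)
        where
        lem : ∀ l a x → a ∙ ((l ∙ a) ⁻¹ ∙ x) ≈ l ⁻¹ ∙ x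
        lem = solve 3 (λ l a x → a ⊙ (inv (l ⊙ a) ⊙ x) ⊜ inv l ⊙ x) refl

  tops : ∀ {n D} → VS n D → List Carrier
  tops (fin _ _) = []
  tops (layer y) = Layer.t y ∷ tops (Layer.rest y)

  tops⊆ : ∀ {n D} (v : VS n D) → All (mem D) (tops v)
  tops⊆ (fin _ _) = []
  tops⊆ (layer y) = E⊆D t∈E ∷ All.map (λ k → E⊆D (K⊆E k)) (tops⊆ rest)
    where open Layer y

  -- An element is l b k with b a power of `t`. Moving b to the right of k by normality leaves, by
  -- induction, only representatives in front of an element of U. Thus finitely many memberships
  -- certify that finitely many cosets of U cover D.
  cover-from-tops : ∀ (U : Sub) {n D} (v : VS n D) → All (mem U) (tops v) → Σ (List Carrier) (Cover D U)
  cover-from-tops U (fin L enum) [] = L , λ x∈ → Any.map (≈-quotient U) (enum x∈)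
  cover-from-tops U {D = D} (layer y) (t∈U ∷ tops∈U) = products reps M , λ x∈ → products⁺ reps (Any.map (shift x∈) (cover x∈))
    where
    open Layer y
    below = cover-from-tops U rest tops∈U
    M     = proj₁ below
    covK  = proj₂ below
    lem : ∀ l m b x → (m ⁻¹ ∙ (((l ∙ b) ⁻¹ ∙ x) ^ᶜ (b ⁻¹))) ∙ b ≈ (l ∙ m) ⁻¹ ∙ x
    lem = solve 4 (λ l m b x → (inv m ⊙ ((inv (inv b) ⊙ (inv (l ⊙ b) ⊙ x)) ⊙ inv b)) ⊙ b ⊜ inv (l ⊙ m) ⊙ x) refl
    shift : ∀ {x} → mem D x → ∀ {l} → (Σ ℤ λ j → mem K ((l ∙ t ^ᶻ j) ⁻¹ ∙ x)) → Any (λ m → mem U ((l ∙ m) ⁻¹ ∙ x)) M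
    shift {x} x∈ {l} (j , k∈) = Any.map (λ {m} u∈ → resp U (lem l m (t ^ᶻ j) x) (∙∈ U u∈ (mem-^ᶻ U j t∈U))) (covK (K-normal k∈ (⁻¹∈ E (mem-^ᶻ E j t∈E))))

  -- The list may contain elements outside D, so each factor that is used brings its own membership
  -- proof.
  data Gen (D : Sub) (S : List Carrier) : Carrier → Set (c ⊔ ℓ ⊔ p) where
    nil  : ∀ {x} → x ≈ ε → Gen D S x
    cons : ∀ {s x y} → s ∈ S → mem D s → Gen D S y → x ≈ s ∙ y → Gen D S x

  gen-∙ : ∀ {D S x y z} → Gen D S x → Gen D S y → z ≈ x ∙ y → Gen D S z
  gen-∙ (nil x≈ε) (nil y≈ε) eq = nil (trans eq (trans (∙-cong x≈ε y≈ε) (identityˡ ε)))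
  gen-∙ (nil x≈ε) (cons s∈ s∈D g e) eq = cons s∈ s∈D g (trans eq (trans (∙-cong x≈ε e) (identityˡ _)))
  gen-∙ (cons s∈ s∈D g e) h eq = cons s∈ s∈D (gen-∙ g h refl) (trans eq (trans (∙-congʳ e) (assoc _ _ _)))

  gen-map : ∀ {D D′ S S′ x} → (∀ {s} → s ∈ S → mem D s → s ∈ S′ × mem D′ s) → Gen D S x → Gen D′ S′ x
  gen-map f (nil e)            = nil e
  gen-map f (cons s∈ s∈D g e) = let s∈′ , s∈D′ = f s∈ s∈D in cons s∈′ s∈D′ (gen-map f g) e

  gen-^ⁿ : ∀ {D S s} → s ∈ S → mem D s → ∀ n → Gen D S (s ^ⁿ n)
  gen-^ⁿ s∈ s∈D zero    = nil refl
  gen-^ⁿ s∈ s∈D (suc n) = cons s∈ s∈D (gen-^ⁿ s∈ s∈D n) refl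

  generators : ∀ {n D} → VS n D → Σ (List Carrier) λ S → ∀ {x} → mem D x → Gen D S x
  generators {D = D} (fin L enum) = L , λ x∈ → let l , l∈ , eq = find (enum x∈) in cons l∈ (resp D eq x∈) (nil refl) (trans eq (sym (identityʳ l)))
  generators {D = D} (layer y) = S , λ {x} x∈ →
      let l , l∈ , j , k∈ = find (cover x∈)
          l∈D = resp D (lem₁ x l (t ^ᶻ j)) (∙∈ D x∈ (⁻¹∈ D (∙∈ D (E⊆D (mem-^ᶻ E j t∈E)) (E⊆D (K⊆E k∈)))))
      in cons (∈ₚ.∈-++⁺ʳ (t ∷ t ⁻¹ ∷ []) (∈ₚ.∈-++⁺ˡ l∈)) l∈D (gen-∙ (gen-t j) (gen-map (λ s∈ s∈K → ∈ₚ.∈-++⁺ʳ (t ∷ t ⁻¹ ∷ []) (∈ₚ.∈-++⁺ʳ reps s∈) , E⊆D (K⊆E s∈K)) (proj₂ below k∈)) refl) (lem₂ x l (t ^ᶻ j))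
    where
    open Layer y
    below = generators rest
    S = (t ∷ t ⁻¹ ∷ []) ++ (reps ++ proj₁ below)
    lem₁ : ∀ x l a → x ∙ (a ∙ ((l ∙ a) ⁻¹ ∙ x)) ⁻¹ ≈ l
    lem₁ = solve 3 (λ x l a → x ⊙ inv (a ⊙ (inv (l ⊙ a) ⊙ x)) ⊜ l) refl
    lem₂ : ∀ x l a → x ≈ l ∙ (a ∙ ((l ∙ a) ⁻¹ ∙ x))
    lem₂ = solve 3 (λ x l a → x ⊜ l ⊙ (a ⊙ (inv (l ⊙ a) ⊙ x))) refl
    gen-t : ∀ j → Gen D S (t ^ᶻ j)
    gen-t (+ n)    = gen-^ⁿ (here ≡.refl) (E⊆D t∈E) n
    gen-t -[1+ n ] = gen-^ⁿ (there (here ≡.refl)) (E⊆D (⁻¹∈ E t∈E)) (suc n)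

-- Peeling off the top infinite factor by a decidable subgroup

ℤ-*-cancelʳ : ∀ i j k → k ≢ 0ℤ → i ℤ.* k ≡ j ℤ.* k → i ≡ j
ℤ-*-cancelʳ i j k k≢0 = ℤₚ.*-cancelʳ-≡ i j k {{ℤ.≢-nonZero k≢0}}

module Peeling {c ℓ p : Level} (G : Group c ℓ) where
  open Group G
  open GroupLemmas G
  open Subgroups {c} {ℓ} {p} G
  open SetoidReasoning setoid

  -- In contrast to `Layer`, the subgroup below is decidable, and no nontrivial power of `t` lies in
  -- it. `cyclic?` finds exponents of `t`, which later makes the subgroups built from powers of `t`
  -- decidable.
  record Peeled (n : ℕ) (D : Sub) : Set (Level.suc (c ⊔ p) ⊔ ℓ) where
    field
      D′       : Sub
      D′⊆D     : ∀ {x} → mem D′ x → mem D x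
      D′?      : ∀ x → Dec (mem D′ x)
      series   : VS n D′
      t        : Carrier
      t∈D      : mem D t
      normal   : ∀ {x} → mem D′ x → mem D′ (x ^ᶜ t)
      normal⁻¹ : ∀ {x} → mem D′ x → mem D′ (x ^ᶜ (t ⁻¹))
      unique   : ∀ {j} → mem D′ (t ^ᶻ j) → j ≡ 0ℤ
      cyclic?  : ∀ x → Dec (Σ ℤ λ j → mem D′ ((t ^ᶻ j) ⁻¹ ∙ x))
      reps     : List Carrier
      cover    : ∀ {x} → mem D x → Any (λ l → Σ ℤ λ j → mem D′ ((l ∙ t ^ᶻ j) ⁻¹ ∙ x)) reps

  module _ {n : ℕ} {D : Sub} (D? : ∀ x → Dec (mem D x)) (y : Layer D (VS n))
           (E-normal : ∀ {x d} → mem (Layer.E y) x → mem D d → mem (Layer.E y) (x ^ᶜ d))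
           (r : ℕ) (pow∈ : ∀ {x} → mem D x → mem (Layer.E y) (x ^ⁿ suc r)) where
    open Layer y

    private
      R = suc r

    -- R times the extension of τ to a homogeneous function on D
    φ : ∀ x → mem D x → ℤ
    φ x x∈ = fn τ (x ^ⁿ R) (pow∈ x∈)

    φ-cong : ∀ {x x′} p q → x ≈ x′ → φ x p ≡ φ x′ q
    φ-cong p q eq = fn-cong τ (pow∈ p) (pow∈ q) (^ⁿ-cong R eq)

    -- The stabiliser of `τ` under conjugation. An element inverting `τ`, as in the infinite
    -- dihedral group, would break the additivity of `φ` along E that `φ-∙E` states.
    F : Sub
    F = record
      { mem  = λ d → mem D d × (∀ {e} (e∈ : mem E e) (q : mem E (e ^ᶜ d)) → fn τ (e ^ᶜ d) q ≡ fn τ e e∈)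
      ; resp = λ { d≈d′ (d∈ , f) → resp D d≈d′ d∈ , λ {e} e∈ q → ≡.trans (fn-cong τ q (E-normal e∈ d∈) (^ᶜ-congʳ e (sym d≈d′))) (f e∈ _) }
      ; ε∈   = ε∈ D , λ {e} e∈ q → fn-cong τ q e∈ (^ᶜ-by-ε e)
      ; ∙∈   = λ { {d} {d′} (d∈ , f) (d′∈ , f′) → ∙∈ D d∈ d′∈ , λ {e} e∈ q →
                 ≡.trans (fn-cong τ q (E-normal (E-normal e∈ d∈) d′∈) (sym (^ᶜ-^ᶜ e d d′)))
                         (≡.trans (f′ (E-normal e∈ d∈) _) (f e∈ _)) }
      ; ⁻¹∈  = λ { {d} (d∈ , f) → ⁻¹∈ D d∈ , λ {e} e∈ q →
                 ≡.trans (≡.sym (f q (E-normal q d∈))) (fn-cong τ _ e∈ (^ᶜ-cancel e d)) }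
      }

    E⊆F : ∀ {e} → mem E e → mem F e
    E⊆F e∈ = E⊆D e∈ , λ e′∈ q → fn-^ᶜ τ e′∈ q e∈

    private
     module _ {d} (d∈ : mem D d) where
      Fixes : ∀ {e} → mem E e → Set
      Fixes {e} e∈ = fn τ (e ^ᶜ d) (E-normal e∈ d∈) ≡ fn τ e e∈
      -- The part of E on which `τ` agrees with its conjugate by d. Once it contains the tops it has
      -- finite index, and by `fn-root` it is all of E; so finitely many comparisons of integers
      -- decide whether d lies in `F`.
      fixed : Sub
      fixed = record
        { mem  = λ e → Σ (mem E e) Fixes
        ; resp = λ { eq (e∈ , h) → resp E eq e∈ , ≡.trans (fn-cong τ _ (E-normal e∈ d∈) (^ᶜ-cong d (sym eq))) (≡.trans h (fn-cong τ e∈ _ eq)) }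
        ; ε∈   = ε∈ E , ≡.trans (fn-ε τ _ (^ᶜ-ε d)) (≡.sym (fn-ε τ _ refl))
        ; ∙∈   = λ { {e} {e′} (e∈ , h) (e′∈ , h′) → ∙∈ E e∈ e′∈ ,
                   ≡.trans (fn-cong τ _ (∙∈ E (E-normal e∈ d∈) (E-normal e′∈ d∈)) (^ᶜ-∙ e e′ d))
                   (≡.trans (fn-∙ τ (E-normal e∈ d∈) (E-normal e′∈ d∈) _) (≡.trans (cong₂ ℤ._+_ h h′) (≡.sym (fn-∙ τ e∈ e′∈ _)))) }
        ; ⁻¹∈  = λ { {e} (e∈ , h) → ⁻¹∈ E e∈ ,
                   ≡.trans (fn-cong τ _ (⁻¹∈ E (E-normal e∈ d∈)) (^ᶜ-⁻¹ e d))
                   (≡.trans (fn-⁻¹ τ (E-normal e∈ d∈) _) (≡.trans (cong ℤ.-_ h) (≡.sym (fn-⁻¹ τ e∈ _)))) }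
        }
      v : VS (suc n) D
      v = layer y
      tops∈E : All (mem E) (tops v)
      tops∈E = t∈E ∷ All.map K⊆E (tops⊆ rest)
      allFixed? : ∀ {xs} → All (mem E) xs → Dec (All (mem fixed) xs)
      allFixed? [] = yes []
      allFixed? {e ∷ _} (e∈ ∷ es∈) with fn τ (e ^ᶜ d) (E-normal e∈ d∈) ℤ.≟ fn τ e e∈ | allFixed? es∈
      ... | no ≢   | _       = no λ { ((x∈′ , h) ∷ _) → ≢ (≡.trans (fn-irr τ _ _) (≡.trans h (fn-irr τ _ _))) }
      ... | yes _  | no ∉    = no λ { (_ ∷ hs) → ∉ hs }
      ... | yes eq | yes hs  = yes ((e∈ , eq) ∷ hs)
      F⇒fixed : mem F d → All (mem fixed) (tops v)
      F⇒fixed f = All.map (λ x∈ → x∈ , proj₂ f x∈ _) tops∈E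
      invariant : ∀ {L} → Cover D fixed L → ∀ {e} (e∈ : mem E e) (q : mem E (e ^ᶜ d)) → fn τ (e ^ᶜ d) q ≡ fn τ e e∈
      invariant cov {e} e∈ q =
        let s , _ , es∈ , h = power-in {D} {fixed} cov (E⊆D e∈)
        in fn-root τ s q e∈ (mem-^ⁿ E (suc s) q) es∈ (≡.trans (fn-cong τ (mem-^ⁿ E (suc s) q) (E-normal es∈ d∈) (^ᶜ-^ⁿ e d (suc s))) h)
      fixed⇒F : All (mem fixed) (tops v) → mem F d
      fixed⇒F hs = d∈ , invariant (proj₂ (cover-from-tops fixed v hs))

    F? : ∀ d → Dec (mem F d)
    F? d with D? d
    ... | no d∉ = no (d∉ ∘ proj₁)
    ... | yes d∈ = map′ (fixed⇒F d∈) (F⇒fixed d∈) (allFixed? d∈ (tops∈E d∈))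

    private
      -- The factor e′ is a product of m conjugates of e by powers of x, on each of which `τ` has
      -- the same value as at e because x lies in `F`.
      twist : ∀ {x e} → mem F x → (e∈ : mem E e) → ∀ m → Σ Carrier λ e′ → Σ (mem E e′) λ e′∈ → ((x ∙ e) ^ⁿ m ≈ x ^ⁿ m ∙ e′) × fn τ e′ e′∈ ≡ + m ℤ.* fn τ e e∈
      twist x∈ e∈ zero = ε , ε∈ E , sym (identityˡ ε) , fn-ε τ _ refl
      twist {x} {e} x∈ e∈ (suc m) with e′ , e′∈ , eq , val ← twist {x} {e} x∈ e∈ m =
        e ^ᶜ (x ^ⁿ m) ∙ e′ , ∙∈ E q e′∈ ,
        trans (∙-congˡ eq) (solve 4 (λ x e a b → (x ⊙ e) ⊙ (a ⊙ b) ⊜ (x ⊙ a) ⊙ (((inv a ⊙ e) ⊙ a) ⊙ b)) refl x e (x ^ⁿ m) e′) ,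
        ≡.trans (fn-∙ τ q e′∈ _) (≡.trans (cong₂ ℤ._+_ (proj₂ xm∈ e∈ q) val) (≡.sym (ℤₚ.suc-* (+ m) (fn τ e e∈))))
        where
        xm∈ = mem-^ⁿ F m x∈
        q = E-normal e∈ (proj₁ xm∈)

    φ-∙E : ∀ {x e} (x∈ : mem F x) (e∈ : mem E e) q → φ (x ∙ e) q ≡ φ x (proj₁ x∈) ℤ.+ + R ℤ.* fn τ e e∈
    φ-∙E {x} {e} x∈ e∈ q =
      let e′ , e′∈ , eq , val = twist {x} {e} x∈ e∈ R
      in ≡.trans (fn-cong τ _ (∙∈ E (pow∈ (proj₁ x∈)) e′∈) eq) (≡.trans (fn-∙ τ _ e′∈ _) (cong (λ z → φ x (proj₁ x∈) ℤ.+ z) val))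

    φ-E∙ : ∀ {x e} (x∈ : mem F x) (e∈ : mem E e) q → φ (e ∙ x) q ≡ φ x (proj₁ x∈) ℤ.+ + R ℤ.* fn τ e e∈
    φ-E∙ {x} {e} x∈ e∈ q =
      ≡.trans (φ-cong q (∙∈ D (proj₁ x∈) (E⊆D ex∈)) (solve 2 (λ e x → e ⊙ x ⊜ x ⊙ ((inv x ⊙ e) ⊙ x)) refl e x))
      (≡.trans (φ-∙E x∈ ex∈ _) (cong (λ z → φ x (proj₁ x∈) ℤ.+ + R ℤ.* z) (proj₂ x∈ e∈ ex∈)))
      where ex∈ = E-normal e∈ (proj₁ x∈)

    φ-^ᶜ : ∀ {x f} (x∈ : mem F x) → mem F f → ∀ q → φ (x ^ᶜ f) q ≡ φ x (proj₁ x∈)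
    φ-^ᶜ {x} {f} x∈ f∈ q = ≡.trans (fn-cong τ _ (E-normal (pow∈ (proj₁ x∈)) (proj₁ f∈)) (^ᶜ-^ⁿ x f R)) (proj₂ f∈ (pow∈ (proj₁ x∈)) _)

    φ-ε : ∀ {q} → φ ε q ≡ 0ℤ
    φ-ε {q} = fn-ε τ _ (^ᶻ-ε (+ R))

    -- On `F` the function `φ` is in fact a homomorphism, by transfer into the central subgroup E/K
    -- of F/K, and this is its kernel. Stating it by left translations gives the subgroup laws
    -- without that argument.
    peel : Sub
    peel = record
      { mem  = λ g → mem F g × (∀ {x} (x∈ : mem F x) (q : mem F (g ∙ x)) → φ (g ∙ x) (proj₁ q) ≡ φ x (proj₁ x∈))
      ; resp = λ { eq (g∈ , h) → resp F eq g∈ , λ x∈ q → ≡.trans (φ-cong _ (proj₁ (∙∈ F g∈ x∈)) (∙-congʳ (sym eq))) (h x∈ (∙∈ F g∈ x∈)) }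
      ; ε∈   = ε∈ F , λ {x} x∈ q → φ-cong _ _ (identityˡ x)
      ; ∙∈   = λ { {g} {g′} (g∈ , h) (g′∈ , h′) → ∙∈ F g∈ g′∈ , λ {x} x∈ q →
                 ≡.trans (φ-cong _ (proj₁ (∙∈ F g∈ (∙∈ F g′∈ x∈))) (assoc g g′ x)) (≡.trans (h (∙∈ F g′∈ x∈) (∙∈ F g∈ (∙∈ F g′∈ x∈))) (h′ x∈ (∙∈ F g′∈ x∈))) }
      ; ⁻¹∈  = λ { {g} (g∈ , h) → ⁻¹∈ F g∈ , λ {x} x∈ q →
                 ≡.trans (≡.sym (h q (∙∈ F g∈ q))) (φ-cong _ _ (solve 2 (λ g x → g ⊙ (inv g ⊙ x) ⊜ x) refl g x)) }
      }

    private
      MR : ℤ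
      MR = + R ℤ.* fn τ t t∈E
      MR≢0 : MR ≢ 0ℤ
      MR≢0 eq = τt≢0 (case ℤₚ.i*j≡0⇒i≡0∨j≡0 (+ R) eq of λ { (inj₁ ()) ; (inj₂ e) → e })
      R*j : ∀ j u → + R ℤ.* (j ℤ.* u) ≡ j ℤ.* (+ R ℤ.* u)
      R*j j u = lem (+ R) j u
        where lem : ∀ r j u → r ℤ.* (j ℤ.* u) ≡ j ℤ.* (r ℤ.* u)
              lem = ℤRing.solve-∀

    K⊆peel : ∀ {x} → mem K x → mem peel x
    K⊆peel {k} k∈ = E⊆F (K⊆E k∈) , λ {x} x∈ q →
      ≡.trans (φ-E∙ x∈ (K⊆E k∈) (proj₁ q)) (≡.trans (cong (λ z → φ x (proj₁ x∈) ℤ.+ + R ℤ.* z) (K⇒0 k∈ _)) (≡.trans (cong (λ z → φ x (proj₁ x∈) ℤ.+ z) (ℤₚ.*-zeroʳ (+ R))) (ℤₚ.+-identityʳ _)))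

    peel-0 : ∀ {x} → (x∈ : mem peel x) → φ x (proj₁ (proj₁ x∈)) ≡ 0ℤ
    peel-0 {x} (x∈ , h) = ≡.trans (φ-cong _ (proj₁ (∙∈ F x∈ (ε∈ F))) (sym (identityʳ x))) (≡.trans (h (ε∈ F) (∙∈ F x∈ (ε∈ F))) φ-ε)

    peel-normal : ∀ {x f} → mem peel x → mem F f → mem peel (x ^ᶜ f)
    peel-normal {g} {f} (g∈ , h) f∈ = mem-^ᶜ F g∈ f∈ , λ {x} x∈ q →
      let x′∈ = mem-^ᶜ F x∈ (⁻¹∈ F f∈)
          gx′∈ = ∙∈ F g∈ x′∈
      in ≡.trans (φ-cong _ (proj₁ (mem-^ᶜ F gx′∈ f∈)) (solve 3 (λ g f x → ((inv f ⊙ g) ⊙ f) ⊙ x ⊜ (inv f ⊙ (g ⊙ ((inv (inv f) ⊙ x) ⊙ inv f))) ⊙ f) refl g f x))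
         (≡.trans (φ-^ᶜ gx′∈ f∈ _) (≡.trans (h x′∈ gx′∈) (φ-^ᶜ x∈ (⁻¹∈ F f∈) _)))

    -- By `φ-∙E` the condition depends only on the coset of E that contains x, so it is tested at
    -- those representatives that lie in `F`.
    peel? : ∀ g → Dec (mem peel g)
    peel? g with F? g
    ... | no g∉  = no (g∉ ∘ proj₁)
    ... | yes g∈ = map′ to from (All.all? test reps)
      where
      Test : Carrier → Set (c ⊔ p)
      Test l = ∀ (l∈ : mem F l) → φ (g ∙ l) (proj₁ (∙∈ F g∈ l∈)) ≡ φ l (proj₁ l∈)
      test : ∀ l → Dec (Test l)
      test l with F? l
      ... | no l∉  = yes (λ l∈ → contradiction l∈ l∉)
      ... | yes l∈ = map′ (λ eq l∈′ → ≡.trans (φ-cong _ _ refl) (≡.trans eq (φ-cong _ _ refl))) (λ f → f l∈)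
                          (φ (g ∙ l) (proj₁ (∙∈ F g∈ l∈)) ℤ.≟ φ l (proj₁ l∈))
      from : mem peel g → All Test reps
      from (_ , h) = All.universal (λ l l∈ → h l∈ (∙∈ F g∈ l∈)) reps
      to : All Test reps → mem peel g
      to tests = g∈ , λ {x} x∈ q →
        let l , l∈reps , e∈ = find (coverE (proj₁ x∈))
            e = l ⁻¹ ∙ x
            l∈ = resp F (solve 2 (λ l x → x ⊙ inv (inv l ⊙ x) ⊜ l) refl l x) (∙∈ F x∈ (⁻¹∈ F (E⊆F e∈)))
            gl∈ = ∙∈ F g∈ l∈
        in ≡.trans (φ-cong _ (proj₁ (∙∈ F gl∈ (E⊆F e∈))) (solve 3 (λ g l x → g ⊙ x ⊜ (g ⊙ l) ⊙ (inv l ⊙ x)) refl g l x))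
           (≡.trans (φ-∙E gl∈ e∈ _)
           (≡.trans (cong (ℤ._+ + R ℤ.* fn τ e e∈) (All.lookup tests l∈reps l∈))
           (≡.trans (≡.sym (φ-∙E l∈ e∈ (proj₁ (∙∈ F l∈ (E⊆F e∈)))))
                    (φ-cong _ _ (solve 2 (λ l x → l ⊙ (inv l ⊙ x) ⊜ x) refl l x)))))

    private
      -- Among the cosets l t^j K at most one exponent makes `φ` vanish, namely j = -φ(l)/MR. If
      -- there is none, these cosets miss `peel` and the value l is arbitrary.
      candidate : Carrier → Carrier
      candidate l with F? l
      ... | no _ = l
      ... | yes l∈ with MR ℤ∣.∣? φ l (proj₁ l∈)
      ... | no _ = l
      ... | yes (ℤ∣.divides q _) = l ∙ t ^ᶻ (ℤ.- q)

      candidate-correct : ∀ {x l j} → mem peel x → mem K ((l ∙ t ^ᶻ j) ⁻¹ ∙ x) → mem K (candidate l ⁻¹ ∙ x)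
      candidate-correct {x} {l} {j} x∈ k∈ = go
        where
        k = (l ∙ t ^ᶻ j) ⁻¹ ∙ x
        e = t ^ᶻ j ∙ k
        tj∈ = mem-^ᶻ E j t∈E
        e∈ : mem E e
        e∈ = ∙∈ E tj∈ (K⊆E k∈)
        x≈le : x ≈ l ∙ e
        x≈le = solve 3 (λ l a x → x ⊜ l ⊙ (a ⊙ (inv (l ⊙ a) ⊙ x))) refl l (t ^ᶻ j) x
        l∈F : mem F l
        l∈F = resp F (trans (∙-congʳ x≈le) (solve 2 (λ l e → (l ⊙ e) ⊙ inv e ⊜ l) refl l e)) (∙∈ F (proj₁ x∈) (⁻¹∈ F (E⊆F e∈)))
        τe : fn τ e e∈ ≡ j ℤ.* fn τ t t∈E
        τe = ≡.trans (fn-∙ τ tj∈ (K⊆E k∈) e∈) (≡.trans (cong₂ ℤ._+_ (fn-^ᶻ τ j t∈E tj∈) (K⇒0 k∈ _)) (ℤₚ.+-identityʳ _))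
        φl+ : φ l (proj₁ l∈F) ℤ.+ j ℤ.* MR ≡ 0ℤ
        φl+ = ≡.trans (cong (λ z → φ l (proj₁ l∈F) ℤ.+ z) (≡.trans (≡.sym (R*j j (fn τ t t∈E))) (cong (+ R ℤ.*_) (≡.sym τe))))
              (≡.trans (≡.sym (φ-∙E l∈F e∈ (proj₁ (∙∈ F l∈F (E⊆F e∈))))) (≡.trans (φ-cong _ _ (sym x≈le)) (peel-0 x∈)))
        φl : φ l (proj₁ l∈F) ≡ (ℤ.- j) ℤ.* MR
        φl = ℤ-+-cancelˡ (j ℤ.* MR) (≡.trans (ℤₚ.+-comm (j ℤ.* MR) _) (≡.trans φl+ (≡.sym (lem j MR))))
          where lem : ∀ j m → j ℤ.* m ℤ.+ (ℤ.- j) ℤ.* m ≡ 0ℤ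
                lem = ℤRing.solve-∀
        go : mem K (candidate l ⁻¹ ∙ x)
        go with F? l
        ... | no l∉ = contradiction l∈F l∉
        ... | yes l∈ with MR ℤ∣.∣? φ l (proj₁ l∈)
        ... | no ∤ = contradiction (ℤ∣.divides (ℤ.- j) (≡.trans (φ-cong _ _ refl) φl)) ∤
        ... | yes (ℤ∣.divides q eq) = subst (λ i → mem K ((l ∙ t ^ᶻ i) ⁻¹ ∙ x)) j≡ k∈
          where
          j≡ : j ≡ ℤ.- q
          j≡ = ≡.trans (≡.sym (ℤₚ.neg-involutive j)) (cong ℤ.-_ (ℤ-*-cancelʳ (ℤ.- j) q MR MR≢0 (≡.trans (≡.sym φl) (≡.trans (φ-cong _ _ refl) eq))))

    peel-series : VS n peel
    peel-series = finiteIndexVS {D = peel} {K = K} {M = map candidate reps}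
      (λ x∈ → Anyₚ.map⁺ (Any.map (λ { {l} (j , k∈) → candidate-correct {l = l} {j} x∈ k∈ }) (cover (proj₁ (proj₁ x∈))))) K⊆peel rest

    φ-t : ∀ {j d} (d∈ : mem peel d) q → φ (t ^ᶻ j ∙ d) q ≡ j ℤ.* MR
    φ-t {j} {d} d∈ q = ≡.trans (φ-E∙ (proj₁ d∈) (mem-^ᶻ E j t∈E) q)
      (≡.trans (cong₂ (λ a b → a ℤ.+ + R ℤ.* b) (peel-0 d∈) (fn-^ᶻ τ j t∈E _)) (≡.trans (ℤₚ.+-identityˡ _) (R*j j (fn τ t t∈E))))

    peeled : Peeled n D
    peeled = record
      { D′ = peel ; D′⊆D = λ x∈ → proj₁ (proj₁ x∈) ; D′? = peel? ; series = peel-series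
      ; t = t ; t∈D = E⊆D t∈E
      ; normal = λ x∈ → peel-normal x∈ (E⊆F t∈E)
      ; normal⁻¹ = λ x∈ → peel-normal x∈ (⁻¹∈ F (E⊆F t∈E))
      ; unique = λ {j} x∈ → ℤ-*-cancelʳ j 0ℤ MR MR≢0 (≡.trans (≡.sym (φ-t {j} (ε∈ peel) (E⊆D (∙∈ E (mem-^ᶻ E j t∈E) (ε∈ E))))) (≡.trans (φ-cong _ _ (identityʳ _)) (peel-0 x∈)))
      ; cyclic? = cyclic?
      ; reps = reps
      ; cover = λ x∈ → Any.map (λ { (j , k∈) → j , K⊆peel k∈ }) (cover x∈)
      }
      where
      -- `φ` equals j MR on the coset of t^j, so only one exponent can occur.
      cyclic? : ∀ x → Dec (Σ ℤ λ j → mem peel ((t ^ᶻ j) ⁻¹ ∙ x))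
      cyclic? x with F? x
      ... | no x∉ = no λ { (j , d∈) → x∉ (resp F (solve 2 (λ a x → a ⊙ (inv a ⊙ x) ⊜ x) refl (t ^ᶻ j) x) (∙∈ F (E⊆F (mem-^ᶻ E j t∈E)) (proj₁ d∈))) }
      ... | yes x∈ with MR ℤ∣.∣? φ x (proj₁ x∈)
      ... | no ∤ = no λ { (j , d∈) → ∤ (ℤ∣.divides j (exact j d∈)) }
        where
        exact : ∀ j → mem peel ((t ^ᶻ j) ⁻¹ ∙ x) → φ x (proj₁ x∈) ≡ j ℤ.* MR
        exact j d∈ = ≡.trans (φ-cong _ (∙∈ D (E⊆D (mem-^ᶻ E j t∈E)) (proj₁ (proj₁ d∈))) (solve 2 (λ a x → x ⊜ a ⊙ (inv a ⊙ x)) refl (t ^ᶻ j) x)) (φ-t {j} d∈ _)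
      ... | yes (ℤ∣.divides q eq) = map′ (q ,_) (λ { (j , d∈) → subst (λ i → mem peel ((t ^ᶻ i) ⁻¹ ∙ x)) (ℤ-*-cancelʳ j q MR MR≢0 (≡.trans (≡.sym (exact j d∈)) eq)) d∈ }) (peel? ((t ^ᶻ q) ⁻¹ ∙ x))
        where
        exact : ∀ j → mem peel ((t ^ᶻ j) ⁻¹ ∙ x) → φ x (proj₁ x∈) ≡ j ℤ.* MR
        exact j d∈ = ≡.trans (φ-cong _ (∙∈ D (E⊆D (mem-^ᶻ E j t∈E)) (proj₁ (proj₁ d∈))) (solve 2 (λ a x → x ⊜ a ⊙ (inv a ⊙ x)) refl (t ^ᶻ j) x)) (φ-t {j} d∈ _)

  -- C is the normal core of E in D. A uniform exponent for E serves all conjugates at once, so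
  -- every element has this power in C; the layer is restricted to C and then extended back to D.
  normalise : ∀ {n D} → (y : Layer D (VS n)) → Σ (Layer D (VS n)) λ z → ∀ {x d} → mem (Layer.E z) x → mem D d → mem (Layer.E z) (x ^ᶜ d)
  normalise {n} {D} y = finiteIndexLayer (proj₁ (proj₂ res)) proj₁ (proj₁ res) ,
      λ {x} {d} x∈ d∈ → let e∈ , u∈ = proj₁ (proj₂ (proj₂ res)) x∈ in proj₂ (proj₂ (proj₂ res)) (proj₂ u∈ d∈) (C-normal u∈ d∈)
    where
    open Layer y
    ex = exponent {D} {E} coverE
    C : Sub
    C = record
      { mem  = λ x → mem D x × (∀ {d} → mem D d → mem E (x ^ᶜ d))
      ; resp = λ { eq (x∈ , f) → resp D eq x∈ , λ {d} d∈ → resp E (^ᶜ-cong d eq) (f d∈) }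
      ; ε∈   = ε∈ D , λ {d} d∈ → resp E (sym (^ᶜ-ε d)) (ε∈ E)
      ; ∙∈   = λ { {x} {x′} (x∈ , f) (x′∈ , f′) → ∙∈ D x∈ x′∈ , λ {d} d∈ → resp E (sym (^ᶜ-∙ x x′ d)) (∙∈ E (f d∈) (f′ d∈)) }
      ; ⁻¹∈  = λ { {x} (x∈ , f) → ⁻¹∈ D x∈ , λ {d} d∈ → resp E (sym (^ᶜ-⁻¹ x d)) (⁻¹∈ E (f d∈)) }
      }
    C-normal : ∀ {x d} → mem C x → mem D d → mem C (x ^ᶜ d)
    C-normal {x} {d} (x∈ , f) d∈ = mem-^ᶜ D x∈ d∈ , λ {d′} d′∈ → resp E (sym (^ᶜ-^ᶜ x d d′)) (f (∙∈ D d∈ d′∈))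
    res = restrictLayer C (proj₁ ex) (λ {x} x∈ → mem-^ⁿ D (suc (proj₁ ex)) x∈ , λ {d} d∈ → resp E (^ᶜ-^ⁿ x d (suc (proj₁ ex))) (proj₂ ex (mem-^ᶜ D x∈ d∈))) y

  peelLayer : ∀ {n D} → (∀ x → Dec (mem D x)) → VS (suc n) D → Peeled n D
  peelLayer {n} {D} D? (layer y) =
    let z , z-normal = normalise y
        r , pow∈     = exponent {D} {Layer.E z} (Layer.coverE z)
    in peeled D? z z-normal r pow∈

-- From the given subnormal series to layers

module FromSeries {c ℓ p : Level} (G : Group c ℓ) where
  open Group G
  open GroupLemmas G
  open Subgroups {c} {ℓ} {p} G
  open SetoidReasoning setoid

  -- `F` and `peel` quantify over the carrier, which raises the level of membership; all subgroups
  -- start at the raised level.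
  liftSub : Subgroup G p → Sub
  liftSub H = record
    { mem  = λ x → Lift c (mem H x)
    ; resp = λ eq x∈ → lift (resp H eq (lower x∈))
    ; ε∈   = lift (ε∈ H)
    ; ∙∈   = λ x∈ y∈ → lift (∙∈ H (lower x∈) (lower y∈))
    ; ⁻¹∈  = λ x∈ → lift (⁻¹∈ H (lower x∈))
    }

  module InfiniteCyclic (H K : Subgroup G p) (K⊆H : ∀ {x} → mem K x → mem H x) (normal : NormalIn G K H)
                        (cyclic : CyclicFactor G H K) (infinite : ¬ FiniteFactor G H K) where
    g : Carrier
    g = proj₁ cyclic
    g∈ : mem H g
    g∈ = proj₁ (proj₂ cyclic)
    degree : ∀ {x} → mem H x → Σ ℤ λ k → mem K ((g ^ᶻ k) ⁻¹ ∙ x)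
    degree = proj₂ (proj₂ cyclic)

    mem-H^ᶻ : ∀ {x} i → mem H x → mem H (x ^ᶻ i)
    mem-H^ᶻ i x∈ = lower (mem-^ᶻ (liftSub H) i (lift x∈))

    mem-K^ᶻ : ∀ {x} i → mem K x → mem K (x ^ᶻ i)
    mem-K^ᶻ i x∈ = lower (mem-^ᶻ (liftSub K) i (lift x∈))

    -- Otherwise the powers of g with exponents up to n would represent all cosets of K in H.
    no-power : ∀ n → ¬ mem K (g ^ⁿ suc n)
    no-power n gn∈ = infinite (map (g ^ⁿ_) (upTo (suc n)) , Allₚ.map⁺ (All.universal (λ i → mem-H^ᶻ (+ i) g∈) (upTo (suc n))) , λ {h} h∈ →
      let j , k∈ = degree h∈
          q = j ℤ÷./ℕ suc n
          a = g ^ⁿ (j ℤ÷.%ℕ suc n)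
          b = (g ^ⁿ suc n) ^ᶻ q
      in Anyₚ.map⁺ (lose (∈ₚ.∈-upTo⁺ (ℤ÷.n%ℕd<d j (suc n)))
           (resp K (lem a b h) (∙∈ K (mem-K^ᶻ q gn∈) (resp K (∙-congʳ (⁻¹-cong (^ᶻ-divMod g n j))) k∈)))))
      where
      lem : ∀ a b h → b ∙ ((a ∙ b) ⁻¹ ∙ h) ≈ a ⁻¹ ∙ h
      lem = solve 3 (λ a b h → b ⊙ (inv (a ⊙ b) ⊙ h) ⊜ inv a ⊙ h) refl

    no-power-ℤ : ∀ k → mem K (g ^ᶻ k) → k ≡ 0ℤ
    no-power-ℤ (+ zero)  _  = ≡.refl
    no-power-ℤ (+ suc n) k∈ = contradiction k∈ (no-power n)
    no-power-ℤ -[1+ n ]  k∈ = contradiction (resp K (trans (⁻¹-cong (^ᶻ-neg g (+ suc n))) (solve 1 (λ x → inv (inv x) ⊜ x) refl _)) (⁻¹∈ K k∈)) (no-power n)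

    degree-unique : ∀ {x} i j → mem K ((g ^ᶻ i) ⁻¹ ∙ x) → mem K ((g ^ᶻ j) ⁻¹ ∙ x) → i ≡ j
    degree-unique {x} i j i∈ j∈ = ≡.sym (ℤₚ.i-j≡0⇒i≡j j i (no-power-ℤ (j ℤ.- i) (resp K eq (∙∈ K i∈ (⁻¹∈ K j∈)))))
      where
      eq : ((g ^ᶻ i) ⁻¹ ∙ x) ∙ ((g ^ᶻ j) ⁻¹ ∙ x) ⁻¹ ≈ g ^ᶻ (j ℤ.- i)
      eq = begin
        ((g ^ᶻ i) ⁻¹ ∙ x) ∙ ((g ^ᶻ j) ⁻¹ ∙ x) ⁻¹  ≈⟨ solve 3 (λ a b x → (inv a ⊙ x) ⊙ inv (inv b ⊙ x) ⊜ inv a ⊙ b) refl (g ^ᶻ i) (g ^ᶻ j) x ⟩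
        (g ^ᶻ i) ⁻¹ ∙ g ^ᶻ j                      ≈⟨ ∙-congʳ (^ᶻ-neg g i) ⟨
        g ^ᶻ (ℤ.- i) ∙ g ^ᶻ j                     ≈⟨ ^ᶻ-+ g (ℤ.- i) j ⟨
        g ^ᶻ (ℤ.- i ℤ.+ j)                        ≡⟨ cong (g ^ᶻ_) (ℤₚ.+-comm (ℤ.- i) j) ⟩
        g ^ᶻ (j ℤ.- i)                            ∎

    cyclicLayer : ∀ {v} {X : Sub → Set v} → X (liftSub K) → Layer (liftSub H) X
    cyclicLayer rest = record
      { E = liftSub H ; K = liftSub K ; E⊆D = id
      ; τ = record
        { fn = λ x x∈ → proj₁ (degree (lower x∈))
        ; fn-cong = λ {x} {y} p q eq → degree-unique _ _ (proj₂ (degree (lower p))) (resp K (∙-congˡ (sym eq)) (proj₂ (degree (lower q))))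
        ; fn-∙ = λ {x} {y} p q r →
            let i , i∈ = degree (lower p) ; j , j∈ = degree (lower q)
            in degree-unique _ (i ℤ.+ j) (proj₂ (degree (lower r)))
                 (resp K (trans (lem (g ^ᶻ i) (g ^ᶻ j) x y) (∙-congʳ (⁻¹-cong (sym (^ᶻ-+ g i j)))))
                   (∙∈ K (normal (⁻¹∈ H (mem-H^ᶻ j g∈)) i∈) j∈))
        }
      ; t = g ; t∈E = lift g∈
      ; τt≢0 = λ eq → case ≡.trans (≡.sym (degree-unique _ 1ℤ (proj₂ (degree g∈)) (resp K (trans (sym (inverseˡ g)) (∙-congʳ (⁻¹-cong (sym (identityʳ g))))) (ε∈ K)))) eq of λ ()
      ; K⊆E = λ k → lift (K⊆H (lower k))
      ; K⇒0 = λ {x} k e → degree-unique _ 0ℤ (proj₂ (degree (lower e))) (resp K (sym (ε⁻¹∙ x)) (lower k))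
      ; 0⇒K = λ {x} e eq → lift (resp K (ε⁻¹∙ x) (subst (λ i → mem K ((g ^ᶻ i) ⁻¹ ∙ x)) eq (proj₂ (degree (lower e)))))
      ; reps = ε ∷ []
      ; cover = λ {x} x∈ → here (let j , j∈ = degree (lower x∈) in j , lift (resp K (∙-congʳ (⁻¹-cong (sym (identityˡ _)))) j∈))
      ; rest = rest
      }
      where
      lem : ∀ a b x y → ((b ⁻¹ ∙ (a ⁻¹ ∙ x)) ∙ (b ⁻¹) ⁻¹) ∙ (b ⁻¹ ∙ y) ≈ (a ∙ b) ⁻¹ ∙ (x ∙ y)
      lem = solve 4 (λ a b x y → ((inv b ⊙ (inv a ⊙ x)) ⊙ inv (inv b)) ⊙ (inv b ⊙ y) ⊜ inv (a ⊙ b) ⊙ (x ⊙ y)) refl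
      ε⁻¹∙ : ∀ x → ε ⁻¹ ∙ x ≈ x
      ε⁻¹∙ = solve 1 (λ x → inv e₀ ⊙ x ⊜ x) refl

  fromSeries : ∀ {H : Subgroup G p} (s : SeriesFrom G (FactorKind G) H) → VS (countInfinite G s) (liftSub H)
  fromSeries (done trivial) = fin (ε ∷ []) (λ x∈ → here (trivial (lower x∈)))
  fromSeries {H} (step K K⊆H normal (finiteF (L , _ , cov)) s) =
    finiteIndexVS {D = liftSub H} {K = liftSub K} {M = L} (λ x∈ → Any.map lift (cov (lower x∈))) (λ k → lift (K⊆H (lower k))) (fromSeries s)
  fromSeries {H} (step K K⊆H normal (infiniteF cyclic infinite) s) = layer (InfiniteCyclic.cyclicLayer H K K⊆H normal cyclic infinite (fromSeries s))

-- Powers of an element that normalise a subgroup of finite index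

module Polycyclic {c ℓ p : Level} (G : Group c ℓ) where
  open Group G
  open GroupLemmas G
  open Subgroups {c} {ℓ} {p} G
  open Peeling {c} {ℓ} {p} G
  open SetoidReasoning setoid

  -- Both inclusions are recorded, since conjugation might carry H onto a proper subgroup of itself.
  Normalises : Carrier → Sub → Set (c ⊔ p)
  Normalises t H = (∀ {x} → mem H x → mem H (x ^ᶜ t)) × (∀ {x} → mem H x → mem H (x ^ᶜ (t ⁻¹)))

  normalises-resp : ∀ {H s t} → s ≈ t → Normalises s H → Normalises t H
  normalises-resp {H} s≈t (f , g) = (λ {x} x∈ → resp H (^ᶜ-congʳ x s≈t) (f x∈)) , (λ {x} x∈ → resp H (^ᶜ-congʳ x (⁻¹-cong s≈t)) (g x∈))

  normalises-∙ : ∀ {H s t} → Normalises s H → Normalises t H → Normalises (s ∙ t) H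
  normalises-∙ {H} {s} {t} (f , g) (f′ , g′) =
    (λ {x} x∈ → resp H (^ᶜ-^ᶜ x s t) (f′ (f x∈))) ,
    (λ {x} x∈ → resp H (trans (^ᶜ-^ᶜ x (t ⁻¹) (s ⁻¹)) (^ᶜ-congʳ x (solve 2 (λ s t → inv t ⊙ inv s ⊜ inv (s ⊙ t)) refl s t))) (g (g′ x∈)))

  normalises-⁻¹ : ∀ {H t} → Normalises t H → Normalises (t ⁻¹) H
  normalises-⁻¹ {H} {t} (f , g) = g , λ {x} x∈ → resp H (^ᶜ-congʳ x (solve 1 (λ t → t ⊜ inv (inv t)) refl t)) (f x∈)

  normalises-^ⁿ : ∀ {H t} n → Normalises t H → Normalises (t ^ⁿ n) H
  normalises-^ⁿ {H} zero    N = (λ {x} x∈ → resp H (sym (^ᶜ-by-ε x)) x∈) , (λ {x} x∈ → resp H (solve 1 (λ x → x ⊜ (inv (inv e₀) ⊙ x) ⊙ inv e₀) refl x) x∈)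
  normalises-^ⁿ {H} {t} (suc n) N = normalises-∙ {H} N (normalises-^ⁿ {H} n N)

  normalises-^ᶻ : ∀ {H t} i → Normalises t H → Normalises (t ^ᶻ i) H
  normalises-^ᶻ {H} (+ n)    N = normalises-^ⁿ {H} n N
  normalises-^ᶻ {H} -[1+ n ] N = normalises-^ⁿ {H} (suc n) (normalises-⁻¹ {H} N)

  -- Two powers of t with the same coset table for the conjugates of P have the same conjugate of P.
  -- Equality of cosets of P is never decided, so the table may list a coset several times.
  module _ {D P : Sub} {t : Carrier} (D? : ∀ x → Dec (mem D x)) (P⊆D : ∀ {x} → mem P x → mem D x) (N : Normalises t D)
           {S : List Carrier} (gen : ∀ {x} → mem D x → Gen D S x) {M : List Carrier} (cov : Cover D P M) where

    private
      rep : Fin (length M) → Carrier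
      rep = lookup M

      conj∈ : ∀ j {s} → mem D s → mem D (s ^ᶜ (t ^ⁿ j))
      conj∈ j = proj₁ (normalises-^ⁿ {D} j N)

      table : ℕ → Fin (length S) → Fin (length M) → Fin (length M)
      table j s i with D? (lookup S s) | D? (rep i)
      ... | yes s∈ | yes i∈ = Any.index (cov (∙∈ D (conj∈ j s∈) i∈))
      ... | _      | _      = i

      table-correct : ∀ j s i → mem D (lookup S s) → mem D (rep i) → mem P (rep (table j s i) ⁻¹ ∙ ((lookup S s) ^ᶜ (t ^ⁿ j) ∙ rep i))
      table-correct j s i s∈ i∈ with D? (lookup S s) | D? (rep i)
      ... | yes s∈′ | yes i∈′ = Anyₚ.lookup-index (cov (∙∈ D (conj∈ j s∈′) i∈′))
      ... | no s∉   | _       = contradiction s∈ s∉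
      ... | yes _   | no i∉   = contradiction i∈ i∉

      code : ℕ → Fin ((length M ^ length M) ^ length S)
      code j = Fin.funToFin (λ s → Fin.funToFin (table j s))

      code-injective : ∀ j j′ → code j ≡ code j′ → ∀ s i → table j s i ≡ table j′ s i
      code-injective j j′ eq s i =
        ≡.trans (≡.sym (decode j)) (≡.trans (cong (λ z → Fin.finToFun {length M} {length M} (Fin.finToFun z s) i) eq) (decode j′))
        where
        decode : ∀ j → Fin.finToFun {length M} {length M} (Fin.finToFun (code j) s) i ≡ table j s i
        decode j = ≡.trans (cong (λ z → Fin.finToFun {length M} {length M} z i) (Finₚ.finToFun-funToFin (λ s → Fin.funToFin (table j s)) s)) (Finₚ.finToFun-funToFin (table j s) i)

      module _ (j j′ : ℕ) (same : ∀ s i → table j s i ≡ table j′ s i) where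
        Moves : ℕ → Carrier → Fin (length M) → Fin (length M) → Set (c ⊔ p)
        Moves j h i i′ = mem P (rep i′ ⁻¹ ∙ (h ^ᶜ (t ^ⁿ j) ∙ rep i))

        moves-ε : ∀ j {h} i → h ≈ ε → Moves j h i i
        moves-ε j {h} i h≈ε = resp P (sym (trans (∙-congˡ (∙-congʳ (trans (^ᶜ-cong _ h≈ε) (^ᶜ-ε _)))) (solve 1 (λ m → inv m ⊙ (e₀ ⊙ m) ⊜ e₀) refl (rep i)))) (ε∈ P)

        moves-∙ : ∀ j {h s y} i i₁ i₂ → h ≈ s ∙ y → Moves j y i i₁ → Moves j s i₁ i₂ → Moves j h i i₂
        moves-∙ j {h} {s} {y} i i₁ i₂ eq my ms = resp P (sym (trans (∙-congˡ (∙-congʳ (^ᶜ-cong _ eq)))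
          (solve 6 (λ s y d m m₁ m₂ → inv m₂ ⊙ (((inv d ⊙ (s ⊙ y)) ⊙ d) ⊙ m) ⊜ (inv m₂ ⊙ (((inv d ⊙ s) ⊙ d) ⊙ m₁)) ⊙ (inv m₁ ⊙ (((inv d ⊙ y) ⊙ d) ⊙ m))) refl s y (t ^ⁿ j) (rep i) (rep i₁) (rep i₂)))) (∙∈ P ms my)

        rep∈ : ∀ j {h i i′} → mem D h → mem D (rep i) → Moves j h i i′ → mem D (rep i′)
        rep∈ j {h} {i} {i′} h∈ i∈ m = resp D (solve 2 (λ x m → x ⊙ inv (inv m ⊙ x) ⊜ m) refl (h ^ᶜ (t ^ⁿ j) ∙ rep i) (rep i′)) (∙∈ D (∙∈ D (conj∈ j h∈) i∈) (⁻¹∈ D (P⊆D m)))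

        moves : ∀ {h} → Gen D S h → ∀ i → mem D (rep i) → Σ (Fin (length M)) λ i′ → Moves j h i i′ × Moves j′ h i i′ × mem D (rep i′)
        moves (nil h≈ε) i i∈ = i , moves-ε j i h≈ε , moves-ε j′ i h≈ε , i∈
        moves (cons {s} {h} {y} s∈S s∈D g eq) i i∈ =
          let i₁ , my , my′ , i₁∈ = moves g i i∈
              k = Any.index s∈S
              s≡ : s ≡ lookup S k
              s≡ = Anyₚ.lookup-index s∈S
              s∈ = subst (mem D) s≡ s∈D
              i₂ = table j k i₁
              ms : Moves j s i₁ i₂
              ms = subst (λ z → Moves j z i₁ i₂) (≡.sym s≡) (table-correct j k i₁ s∈ i₁∈)
              ms′ : Moves j′ s i₁ i₂
              ms′ = ≡.subst₂ (λ z w → Moves j′ z i₁ w) (≡.sym s≡) (≡.sym (same k i₁)) (table-correct j′ k i₁ s∈ i₁∈)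
          in i₂ , moves-∙ j i i₁ i₂ eq my ms , moves-∙ j′ i i₁ i₂ eq my′ ms′ , rep∈ j s∈D i₁∈ ms

        moves-det : ∀ j j′ {h i i′} → mem P (rep i) → Moves j h i i′ → Moves j′ h i i′ → mem P (h ^ᶜ (t ^ⁿ j)) → mem P (h ^ᶜ (t ^ⁿ j′))
        moves-det j j′ {h} {i} {i′} i∈ m m′ h∈ = resp P (lem′ (h ^ᶜ (t ^ⁿ j′)) (rep i) (rep i′)) (∙∈ P (∙∈ P i′∈ m′) (⁻¹∈ P i∈))
          where
          lem : ∀ x m m′ → (x ∙ m) ∙ (m′ ⁻¹ ∙ (x ∙ m)) ⁻¹ ≈ m′
          lem = solve 3 (λ x m m′ → (x ⊙ m) ⊙ inv (inv m′ ⊙ (x ⊙ m)) ⊜ m′) refl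
          i′∈ : mem P (rep i′)
          i′∈ = resp P (lem (h ^ᶜ (t ^ⁿ j)) (rep i) (rep i′)) (∙∈ P (∙∈ P h∈ i∈) (⁻¹∈ P m))
          lem′ : ∀ x m m′ → (m′ ∙ (m′ ⁻¹ ∙ (x ∙ m))) ∙ m ⁻¹ ≈ x
          lem′ = solve 3 (λ x m m′ → (m′ ⊙ (inv m′ ⊙ (x ⊙ m))) ⊙ inv m ⊜ x) refl

        base-coset : Σ (Fin (length M)) λ i → mem P (rep i)
        base-coset = Any.index (cov (ε∈ D)) , resp P (solve 1 (λ m → inv (inv m ⊙ e₀) ⊜ m) refl _) (⁻¹∈ P (Anyₚ.lookup-index (cov (ε∈ D))))

        -- A conjugate of h lies in P exactly when it sends the coset P to itself, and along a word
        -- for h this is read from the common table.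
        conj-⇔ : ∀ {h} → mem D h → (mem P (h ^ᶜ (t ^ⁿ j)) → mem P (h ^ᶜ (t ^ⁿ j′))) × (mem P (h ^ᶜ (t ^ⁿ j′)) → mem P (h ^ᶜ (t ^ⁿ j)))
        conj-⇔ h∈ = let i , i∈ = base-coset ; i′ , m , m′ , _ = moves (gen h∈) i (P⊆D i∈)
                    in moves-det j j′ i∈ m m′ , moves-det j′ j i∈ m′ m

        same-table⇒normalises : ∀ k → j′ ≡ j + k → Normalises (t ^ⁿ k) P
        same-table⇒normalises k j′≡ =
          (λ {x} x∈ → resp P (trans (^ᶜ-^ᶜ x _ _) (^ᶜ-congʳ x (trans (∙-congˡ split) (solve 2 (λ a b → inv a ⊙ (a ⊙ b) ⊜ b) refl (t ^ⁿ j) (t ^ⁿ k)))))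
             (proj₁ (conj-⇔ (proj₂ (normalises-^ⁿ {D} j N) (P⊆D x∈))) (resp P (sym (^ᶜ-cancel x (t ^ⁿ j))) x∈))) ,
          (λ {x} x∈ → resp P (trans (^ᶜ-^ᶜ x _ _) (^ᶜ-congʳ x (trans (∙-congʳ (⁻¹-cong split)) (solve 2 (λ a b → inv (a ⊙ b) ⊙ a ⊜ inv b) refl (t ^ⁿ j) (t ^ⁿ k)))))
             (proj₂ (conj-⇔ (proj₂ (normalises-^ⁿ {D} j′ N) (P⊆D x∈))) (resp P (sym (^ᶜ-cancel x (t ^ⁿ j′))) x∈)))
          where
          split : t ^ⁿ j′ ≈ t ^ⁿ j ∙ t ^ⁿ k
          split = trans (reflexive (cong (t ^ⁿ_) j′≡)) (^ⁿ-+ t j k)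

    some-power-normalises : Σ ℕ λ k → Normalises (t ^ⁿ suc k) P
    some-power-normalises =
      let i , k , _ , eq = repeats code
      in k , same-table⇒normalises i (i + suc k) (code-injective i (i + suc k) eq) (suc k) ≡.refl

-- Poly-ℤ subgroups of finite index and directions

module PolyZ {c ℓ p : Level} (G : Group c ℓ) where
  open Group G
  open GroupLemmas G
  open Subgroups {c} {ℓ} {p} G
  open Peeling {c} {ℓ} {p} G
  open Polycyclic {c} {ℓ} {p} G
  open SetoidReasoning setoid

  -- The density carried by a coset of K is computed along w-lines, and conjugation by t must preserve it.
  record Direction (K : Sub) (t : Carrier) : Set (c ⊔ ℓ ⊔ p) where
    field
      ℓ₀   : Hom K
      w    : Carrier
      w∈   : mem K w
      wᵗ∈  : mem K (w ^ᶜ t)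
      a    : ℕ
      ℓw   : fn ℓ₀ w w∈ ≡ + suc a
      ℓwᵗ  : fn ℓ₀ (w ^ᶜ t) wᵗ∈ ≡ + suc a

  -- At the bottom K is the finite N, which has no nonzero homomorphism to ℤ and hence no direction.
  Direction⁺ : ℕ → Sub → Carrier → Set (c ⊔ ℓ ⊔ p)
  Direction⁺ zero    K t = Level.Lift _ ⊤
  Direction⁺ (suc _) K t = Direction K t

  record Extension {v} (P : Sub) (X : Sub → Set v) : Set (Level.suc (c ⊔ p) ⊔ ℓ ⊔ v) where
    field
      K    : Sub
      K⊆P  : ∀ {x} → mem K x → mem P x
      θ    : Hom P
      t    : Carrier
      t∈   : mem P t
      θt≡1 : fn θ t t∈ ≡ 1ℤ
      K⇒0  : ∀ {x} → mem K x → (x∈ : mem P x) → fn θ x x∈ ≡ 0ℤ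
      0⇒K  : ∀ {x} (x∈ : mem P x) → fn θ x x∈ ≡ 0ℤ → mem K x
      rest : X K

    K-normal : ∀ {x d} → mem K x → mem P d → mem K (x ^ᶜ d)
    K-normal x∈ d∈ = let m = mem-^ᶜ P (K⊆P x∈) d∈ in 0⇒K m (≡.trans (fn-^ᶜ θ (K⊆P x∈) m d∈) (K⇒0 x∈ _))

  data Poly (N : Sub) : ℕ → Sub → Set (Level.suc (c ⊔ p) ⊔ ℓ) where
    base   : ∀ {P} → (∀ {x} → mem P x → mem N x) → (∀ {x} → mem N x → mem P x) → Poly N 0 P
    extend : ∀ {n P} (e : Extension P (Poly N n)) → Direction⁺ n (Extension.K e) (Extension.t e) → Poly N (suc n) P

  direction : ∀ {K t w} (ℓ₀ : Hom K) (w∈ : mem K w) (wᵗ∈ : mem K (w ^ᶜ t)) {d : ℤ} → d ≢ 0ℤ → fn ℓ₀ w w∈ ≡ d → fn ℓ₀ (w ^ᶜ t) wᵗ∈ ≡ d → Direction K t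
  direction ℓ₀ w∈ wᵗ∈ {+ zero} d≢0 _ _ = contradiction ≡.refl d≢0
  direction ℓ₀ w∈ wᵗ∈ {+ suc a} _ e e′ = record { ℓ₀ = ℓ₀ ; w∈ = w∈ ; wᵗ∈ = wᵗ∈ ; a = a ; ℓw = e ; ℓwᵗ = e′ }
  direction {K} {t} {w} ℓ₀ w∈ wᵗ∈ { -[1+ a ] } _ e e′ = record
    { ℓ₀ = ℓ₀ ; w∈ = ⁻¹∈ K w∈ ; wᵗ∈ = resp K (sym (^ᶜ-⁻¹ w t)) (⁻¹∈ K wᵗ∈) ; a = a
    ; ℓw = ≡.trans (fn-⁻¹ ℓ₀ w∈ _) (cong ℤ.-_ e)
    ; ℓwᵗ = ≡.trans (fn-cong ℓ₀ _ (⁻¹∈ K wᵗ∈) (^ᶜ-⁻¹ w t)) (≡.trans (fn-⁻¹ ℓ₀ wᵗ∈ _) (cong ℤ.-_ e′)) }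

  direction-resp : ∀ {K s t} → s ≈ t → Direction K s → Direction K t
  direction-resp {K} {s} {t} s≈t d = record
    { ℓ₀ = ℓ₀ ; w∈ = w∈ ; wᵗ∈ = resp K (^ᶜ-congʳ w s≈t) wᵗ∈ ; a = a ; ℓw = ℓw
    ; ℓwᵗ = ≡.trans (fn-cong ℓ₀ _ wᵗ∈ (^ᶜ-congʳ w (sym s≈t))) ℓwᵗ }
    where open Direction d

  ℤ-product≡1 : ∀ i j → i ℤ.* j ≡ 1ℤ → i ≡ 1ℤ ⊎ i ≡ -[1+ 0 ]
  ℤ-product≡1 i j eq = signed i (ℕₚ.m*n≡1⇒m≡1 ℤ.∣ i ∣ ℤ.∣ j ∣ (≡.trans (≡.sym (ℤₚ.abs-* i j)) (cong ℤ.∣_∣ eq)))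
    where
    signed : ∀ i → ℤ.∣ i ∣ ≡ 1 → i ≡ 1ℤ ⊎ i ≡ -[1+ 0 ]
    signed (+ 1)       ≡.refl = inj₁ ≡.refl
    signed -[1+ 0 ]    ≡.refl = inj₂ ≡.refl

  direction⁺-resp : ∀ {K s t} n → s ≈ t → Direction⁺ n K s → Direction⁺ n K t
  direction⁺-resp zero    s≈t _ = _
  direction⁺-resp (suc _) s≈t d = direction-resp s≈t d

  -- Write θ for the top homomorphism of P and e for its generator. The pair (θ , θ ∘ conjugation by s)
  -- takes the values (1 , b) at e, (b , f) at eˢ and (b′ , 1) at e^(s⁻¹); some combination of these is
  -- a nonzero multiple of (1 , 1), unless b = -1 and f = 1, when s² fixes θ(e).
  module _ {v} {P : Sub} {X : Sub → Set v} (ext : Extension P X) where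
    open Extension ext renaming (t to e; t∈ to e∈; θt≡1 to θe≡1)

    private
      combination : ∀ {x y} i j (x∈ : mem P x) (y∈ : mem P y) q → fn θ (x ^ᶻ i ∙ y ^ᶻ j) q ≡ i ℤ.* fn θ x x∈ ℤ.+ j ℤ.* fn θ y y∈
      combination i j x∈ y∈ q = ≡.trans (fn-∙ θ (mem-^ᶻ P i x∈) (mem-^ᶻ P j y∈) q) (cong₂ ℤ._+_ (fn-^ᶻ θ i x∈ _) (fn-^ᶻ θ j y∈ _))

      combination-^ᶜ : ∀ {s x y x′ y′} i j → x ^ᶜ s ≈ x′ → y ^ᶜ s ≈ y′ → (x ^ᶻ i ∙ y ^ᶻ j) ^ᶜ s ≈ x′ ^ᶻ i ∙ y′ ^ᶻ j
      combination-^ᶜ {s} {x} {y} i j x≈ y≈ = trans (^ᶜ-∙ _ _ s) (∙-cong (trans (sym (^ᶜ-^ᶻ x s i)) (^ᶻ-cong i x≈)) (trans (sym (^ᶜ-^ᶻ y s j)) (^ᶻ-cong j y≈)))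

      combine : ∀ {s x y x′ y′ d} i j (x∈ : mem P x) (y∈ : mem P y) (x′∈ : mem P x′) (y′∈ : mem P y′) → x ^ᶜ s ≈ x′ → y ^ᶜ s ≈ y′ →
        d ≢ 0ℤ → i ℤ.* fn θ x x∈ ℤ.+ j ℤ.* fn θ y y∈ ≡ d → i ℤ.* fn θ x′ x′∈ ℤ.+ j ℤ.* fn θ y′ y′∈ ≡ d → Direction P s
      combine {s} {x} {y} {x′} {y′} i j x∈ y∈ x′∈ y′∈ x≈ y≈ d≢0 e₁ e₂ =
        direction {w = x ^ᶻ i ∙ y ^ᶻ j} θ (∙∈ P (mem-^ᶻ P i x∈) (mem-^ᶻ P j y∈)) (resp P (sym eq) m′) d≢0
          (≡.trans (combination i j x∈ y∈ _) e₁) (≡.trans (fn-cong θ _ m′ eq) (≡.trans (combination i j x′∈ y′∈ m′) e₂))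
        where
        m′ = ∙∈ P (mem-^ᶻ P i x′∈) (mem-^ᶻ P j y′∈)
        eq = combination-^ᶜ {s} i j x≈ y≈

    find-direction : ∀ {s} → Normalises s P → Σ ℕ λ m → Direction P (s ^ⁿ suc m)
    find-direction {s} (ν , ν⁻¹) = cases (b ℤ.≟ 1ℤ) (b ℤ.≟ -[1+ 0 ]) (f ℤ.≟ 1ℤ)
      where
      eˢ∈ = ν e∈
      eˢˢ∈ = ν eˢ∈
      e⁻∈ = ν⁻¹ e∈
      b = fn θ (e ^ᶜ s) eˢ∈
      f = fn θ ((e ^ᶜ s) ^ᶜ s) eˢˢ∈
      b′ = fn θ (e ^ᶜ (s ⁻¹)) e⁻∈
      one : s ≈ s ^ⁿ 1
      one = sym (identityʳ s)
      cases : Dec (b ≡ 1ℤ) → Dec (b ≡ -[1+ 0 ]) → Dec (f ≡ 1ℤ) → Σ ℕ λ m → Direction P (s ^ⁿ suc m)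
      cases (yes b≡1) _ _ = 0 , direction-resp one (direction θ e∈ eˢ∈ {1ℤ} (λ ()) θe≡1 b≡1)
      cases (no _) (yes _) (yes f≡1) = 1 , direction θ e∈ (resp P eq eˢˢ∈) {1ℤ} (λ ()) θe≡1 (≡.trans (fn-cong θ _ eˢˢ∈ (sym eq)) f≡1)
        where
        eq : (e ^ᶜ s) ^ᶜ s ≈ e ^ᶜ (s ^ⁿ 2)
        eq = solve 2 (λ e s → (inv s ⊙ ((inv s ⊙ e) ⊙ s)) ⊙ s ⊜ (inv (s ⊙ (s ⊙ e₀)) ⊙ e) ⊙ (s ⊙ (s ⊙ e₀))) refl e s
      cases (no _) (yes b≡-1) (no f≢1) = 0 , direction-resp one
        -- Equality of the two coordinates means i - j = -i + j f, solved by (f + 1 , 2) with common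
        -- value f - 1.
        (combine {s} {e} {e ^ᶜ s} {d = f ℤ.- 1ℤ} (f ℤ.+ 1ℤ) (+ 2) e∈ eˢ∈ eˢ∈ eˢˢ∈ refl refl
          (λ eq → f≢1 (ℤₚ.i-j≡0⇒i≡j f 1ℤ eq))
          (≡.trans (cong₂ (λ x y → (f ℤ.+ 1ℤ) ℤ.* x ℤ.+ + 2 ℤ.* y) θe≡1 b≡-1) (lem₁ f))
          (≡.trans (cong (λ x → (f ℤ.+ 1ℤ) ℤ.* x ℤ.+ + 2 ℤ.* f) b≡-1) (lem₂ f)))
        where
        lem₁ : ∀ f → (f ℤ.+ 1ℤ) ℤ.* 1ℤ ℤ.+ + 2 ℤ.* -[1+ 0 ] ≡ f ℤ.- 1ℤ
        lem₁ = ℤRing.solve-∀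
        lem₂ : ∀ f → (f ℤ.+ 1ℤ) ℤ.* -[1+ 0 ] ℤ.+ + 2 ℤ.* f ≡ f ℤ.- 1ℤ
        lem₂ = ℤRing.solve-∀
      cases (no b≢1) (no b≢-1) _ = 0 , direction-resp one
        -- The equation is now i + j b′ = i b + j; its solution (1 - b′ , 1 - b) has the value 1 - b
        -- b′, which is zero only if b is 1 or -1.
        (combine {s} {e} {e ^ᶜ (s ⁻¹)} {d = 1ℤ ℤ.- b ℤ.* b′} (1ℤ ℤ.- b′) (1ℤ ℤ.- b) e∈ e⁻∈ eˢ∈ e∈ refl (^ᶜ-cancel e s)
          (λ eq → case ℤ-product≡1 b b′ (≡.sym (ℤₚ.i-j≡0⇒i≡j 1ℤ (b ℤ.* b′) eq)) of λ { (inj₁ b≡1) → b≢1 b≡1 ; (inj₂ b≡-1) → b≢-1 b≡-1 })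
          (≡.trans (cong (λ x → (1ℤ ℤ.- b′) ℤ.* x ℤ.+ (1ℤ ℤ.- b) ℤ.* b′) θe≡1) (lem₁ b b′))
          (≡.trans (cong (λ x → (1ℤ ℤ.- b′) ℤ.* b ℤ.+ (1ℤ ℤ.- b) ℤ.* x) θe≡1) (lem₂ b b′)))
        where
        lem₁ : ∀ b b′ → (1ℤ ℤ.- b′) ℤ.* 1ℤ ℤ.+ (1ℤ ℤ.- b) ℤ.* b′ ≡ 1ℤ ℤ.- b ℤ.* b′
        lem₁ = ℤRing.solve-∀
        lem₂ : ∀ b b′ → (1ℤ ℤ.- b′) ℤ.* b ℤ.+ (1ℤ ℤ.- b) ℤ.* 1ℤ ≡ 1ℤ ℤ.- b ℤ.* b′
        lem₂ = ℤRing.solve-∀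

  direction⁺ : ∀ {N n P s} → Poly N n P → Normalises s P → Σ ℕ λ m → Direction⁺ n P (s ^ⁿ suc m)
  direction⁺ (base _ _)   _ = 0 , _
  direction⁺ (extend e _) ν = find-direction e ν

  module Adjoin (P : Sub) (s : Carrier) (ν : Normalises s P) where
    private
      shift∙ : ∀ a b x y → ((a ⁻¹ ∙ x) ^ᶜ b) ∙ (b ⁻¹ ∙ y) ≈ (a ∙ b) ⁻¹ ∙ (x ∙ y)
      shift∙ = solve 4 (λ a b x y → ((inv b ⊙ (inv a ⊙ x)) ⊙ b) ⊙ (inv b ⊙ y) ⊜ inv (a ⊙ b) ⊙ (x ⊙ y)) refl
      shift⁻¹ : ∀ a x → ((a ⁻¹ ∙ x) ⁻¹) ^ᶜ (a ⁻¹) ≈ (a ⁻¹) ⁻¹ ∙ x ⁻¹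
      shift⁻¹ = solve 2 (λ a x → (inv (inv a) ⊙ inv (inv a ⊙ x)) ⊙ inv a ⊜ inv (inv a) ⊙ inv x) refl
      by-power : ∀ {x} i → mem P x → mem P (x ^ᶜ (s ^ᶻ i))
      by-power i = proj₁ (normalises-^ᶻ {P} i ν)

    shift-∙ : ∀ {x y} i j → mem P ((s ^ᶻ i) ⁻¹ ∙ x) → mem P ((s ^ᶻ j) ⁻¹ ∙ y) → mem P ((s ^ᶻ (i ℤ.+ j)) ⁻¹ ∙ (x ∙ y))
    shift-∙ {x} {y} i j i∈ j∈ = resp P (trans (shift∙ _ _ x y) (∙-congʳ (⁻¹-cong (sym (^ᶻ-+ s i j))))) (∙∈ P (by-power j i∈) j∈)

    adjoin : Sub
    adjoin = record
      { mem  = λ x → Σ ℤ λ j → mem P ((s ^ᶻ j) ⁻¹ ∙ x)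
      ; resp = λ { eq (j , j∈) → j , resp P (∙-congˡ eq) j∈ }
      ; ε∈   = 0ℤ , resp P (solve 0 (e₀ ⊜ inv e₀ ⊙ e₀) refl) (ε∈ P)
      ; ∙∈   = λ { (i , i∈) (j , j∈) → i ℤ.+ j , shift-∙ i j i∈ j∈ }
      ; ⁻¹∈  = λ { {x} (i , i∈) → ℤ.- i , resp P (trans (^ᶜ-congʳ _ (^ᶻ-neg s i)) (trans (shift⁻¹ (s ^ᶻ i) x) (∙-congʳ (⁻¹-cong (sym (^ᶻ-neg s i)))))) (by-power (ℤ.- i) (⁻¹∈ P i∈)) }
      }

    P⊆adjoin : ∀ {x} → mem P x → mem adjoin x
    P⊆adjoin {x} x∈ = 0ℤ , resp P (solve 1 (λ x → x ⊜ inv e₀ ⊙ x) refl x) x∈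

    module _ (unique : ∀ {j} → mem P (s ^ᶻ j) → j ≡ 0ℤ) where
      same-degree : ∀ {x} i j → mem P ((s ^ᶻ i) ⁻¹ ∙ x) → mem P ((s ^ᶻ j) ⁻¹ ∙ x) → i ≡ j
      same-degree {x} i j i∈ j∈ = ≡.sym (ℤₚ.i-j≡0⇒i≡j j i (unique {j ℤ.- i} (resp P eq (∙∈ P i∈ (⁻¹∈ P j∈)))))
        where
        eq : ((s ^ᶻ i) ⁻¹ ∙ x) ∙ ((s ^ᶻ j) ⁻¹ ∙ x) ⁻¹ ≈ s ^ᶻ (j ℤ.- i)
        eq = begin
          ((s ^ᶻ i) ⁻¹ ∙ x) ∙ ((s ^ᶻ j) ⁻¹ ∙ x) ⁻¹  ≈⟨ solve 3 (λ a b x → (inv a ⊙ x) ⊙ inv (inv b ⊙ x) ⊜ inv a ⊙ b) refl (s ^ᶻ i) (s ^ᶻ j) x ⟩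
          (s ^ᶻ i) ⁻¹ ∙ s ^ᶻ j                      ≈⟨ ∙-congʳ (^ᶻ-neg s i) ⟨
          s ^ᶻ (ℤ.- i) ∙ s ^ᶻ j                     ≈⟨ ^ᶻ-+ s (ℤ.- i) j ⟨
          s ^ᶻ (ℤ.- i ℤ.+ j)                        ≡⟨ cong (s ^ᶻ_) (ℤₚ.+-comm (ℤ.- i) j) ⟩
          s ^ᶻ (j ℤ.- i)                            ∎

      adjoinExtension : ∀ {v} {X : Sub → Set v} → X P → Extension adjoin X
      adjoinExtension rest = record
        { K = P ; K⊆P = P⊆adjoin
        ; θ = record
          { fn = λ _ → proj₁
          ; fn-cong = λ { (i , i∈) (j , j∈) eq → same-degree i j i∈ (resp P (∙-congˡ (sym eq)) j∈) }
          ; fn-∙ = λ { (i , i∈) (j , j∈) (k , k∈) → same-degree k (i ℤ.+ j) k∈ (shift-∙ i j i∈ j∈) }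
          }
        ; t = s ; t∈ = 1ℤ , resp P (trans (sym (inverseˡ s)) (∙-congʳ (⁻¹-cong (sym (identityʳ s))))) (ε∈ P)
        ; θt≡1 = ≡.refl
        ; K⇒0 = λ { {x} x∈ (i , i∈) → same-degree i 0ℤ i∈ (proj₂ (P⊆adjoin x∈)) }
        ; 0⇒K = λ { {x} (i , i∈) eq → resp P (solve 1 (λ x → inv e₀ ⊙ x ⊜ x) refl x) (subst (λ i → mem P ((s ^ᶻ i) ⁻¹ ∙ x)) eq i∈) }
        ; rest = rest
        }

  record Resolution (n : ℕ) (D : Sub) : Set (Level.suc (c ⊔ p) ⊔ ℓ) where
    field
      N      : Sub
      N-list : List Carrier
      N-enum : Enumerated N N-list
      P      : Sub
      P?     : ∀ x → Dec (mem P x)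
      P⊆D    : ∀ {x} → mem P x → mem D x
      reps   : List Carrier
      cover  : Cover D P reps
      poly   : Poly N n P

  module _ {n D} (peel : Peeled n D) (res : Resolution n (Peeled.D′ peel)) (m : ℕ) where
    open Peeled peel renaming (reps to D-reps; cover to D-cover)
    open Resolution res
    private
     ν : Normalises t D′
     ν = normal , normal⁻¹
     s = t ^ⁿ suc m

    module ByPower (νs : Normalises s P) (dir : Direction⁺ n P s) where
      open Adjoin P s νs
      s∈D : mem D s
      s∈D = mem-^ⁿ D (suc m) t∈D
      s^ : ∀ j → s ^ᶻ j ≈ t ^ᶻ (+ suc m ℤ.* j)
      s^ j = sym (^ᶻ-*ⁿ t (suc m) j)
      unique-s : ∀ {j} → mem P (s ^ᶻ j) → j ≡ 0ℤ
      unique-s {j} j∈ = case ℤₚ.i*j≡0⇒i≡0∨j≡0 (+ suc m) (unique {+ suc m ℤ.* j} (resp D′ (s^ j) (P⊆D j∈))) of λ { (inj₁ ()) ; (inj₂ e) → e }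
      module D′-degree = Adjoin D′ t ν
      degree-s : ∀ {x} i j → mem D′ ((t ^ᶻ i) ⁻¹ ∙ x) → mem P ((s ^ᶻ j) ⁻¹ ∙ x) → i ≡ j ℤ.* + suc m
      degree-s i j i∈ j∈ = ≡.trans (D′-degree.same-degree unique i (+ suc m ℤ.* j) i∈ (resp D′ (∙-congʳ (⁻¹-cong (s^ j))) (P⊆D j∈))) (ℤₚ.*-comm (+ suc m) j)
      -- The exponent of x over s, if there is one, is its unique exponent over t divided by
      -- `suc m`. `cyclic?` finds the latter, so that a single membership in P remains to be tested.
      adjoin? : ∀ x → Dec (mem adjoin x)
      adjoin? x with cyclic? x
      ... | no ∉ = no λ { (j , j∈) → ∉ (+ suc m ℤ.* j , resp D′ (∙-congʳ (⁻¹-cong (s^ j))) (P⊆D j∈)) }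
      ... | yes (i , i∈) with + suc m ℤ∣.∣? i
      ... | no ∤ = no λ { (j , j∈) → ∤ (ℤ∣.divides j (degree-s i j i∈ j∈)) }
      ... | yes (ℤ∣.divides q eq) with P? ((s ^ᶻ q) ⁻¹ ∙ x)
      ... | yes q∈ = yes (q , q∈)
      ... | no q∉ = no λ { (j , j∈) → q∉ (subst (λ z → mem P ((s ^ᶻ z) ⁻¹ ∙ x)) (ℤ-*-cancelʳ j q (+ suc m) (λ ()) (≡.trans (≡.sym (degree-s i j i∈ j∈)) eq)) j∈) }
      split : ∀ {x l} → (Σ ℤ λ j → mem D′ ((l ∙ t ^ᶻ j) ⁻¹ ∙ x)) → Any (λ a → Any (λ r → mem adjoin (((l ∙ a) ∙ r) ⁻¹ ∙ x)) reps) (map (t ^ⁿ_) (upTo (suc m)))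
      split {x} {l} (j , d∈) = Anyₚ.map⁺ (lose (∈ₚ.∈-upTo⁺ (ℤ÷.n%ℕd<d j (suc m))) (Any.map (λ {r} u∈ → q , resp P (lem l a b r x) (proj₁ (normalises-^ᶻ {P} q νs) u∈)) (cover d′∈)))
        where
        q = j ℤ÷./ℕ suc m
        a = t ^ⁿ (j ℤ÷.%ℕ suc m)
        b = s ^ᶻ q
        d′∈ : mem D′ (((l ∙ (a ∙ b)) ⁻¹ ∙ x) ^ᶜ (b ⁻¹))
        d′∈ = proj₂ (normalises-^ᶻ {D′} q (normalises-^ⁿ {D′} (suc m) ν)) (resp D′ (∙-congʳ (⁻¹-cong (∙-congˡ (^ᶻ-divMod t m j)))) d∈)
        lem : ∀ l a b r x → (r ⁻¹ ∙ (((l ∙ (a ∙ b)) ⁻¹ ∙ x) ^ᶜ (b ⁻¹))) ^ᶜ b ≈ b ⁻¹ ∙ (((l ∙ a) ∙ r) ⁻¹ ∙ x)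
        lem = solve 5 (λ l a b r x → (inv b ⊙ (inv r ⊙ ((inv (inv b) ⊙ (inv (l ⊙ (a ⊙ b)) ⊙ x)) ⊙ inv b))) ⊙ b ⊜ inv b ⊙ (inv ((l ⊙ a) ⊙ r) ⊙ x)) refl
      resolution : Resolution (suc n) D
      resolution = record
        { N = N ; N-list = N-list ; N-enum = N-enum ; P = adjoin ; P? = adjoin?
        ; P⊆D = λ { {x} (j , j∈) → resp D (solve 2 (λ a x → a ⊙ (inv a ⊙ x) ⊜ x) refl (s ^ᶻ j) x) (∙∈ D (mem-^ᶻ D j s∈D) (D′⊆D (P⊆D j∈))) }
        ; reps = products (products D-reps (map (t ^ⁿ_) (upTo (suc m)))) reps
        ; cover = λ x∈ → products⁺ (products D-reps (map (t ^ⁿ_) (upTo (suc m)))) (products⁺ D-reps (Any.map split (D-cover x∈)))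
        ; poly = extend (adjoinExtension unique-s poly) dir }

  extendResolution : ∀ {n D} (peel : Peeled n D) → Resolution n (Peeled.D′ peel) → Resolution (suc n) D
  extendResolution {n} {D} peel res =
    let k , ν = some-power-normalises {D′} {P} D′? P⊆D (normal , normal⁻¹) (proj₂ (generators series)) cover
        i , d = direction⁺ poly ν
        s≈    = sym (^ⁿ-* t (suc k) (suc i))
    -- `t` is raised to a power once to normalise P and again to have a direction in P; the total
    -- exponent `suc i * suc k` is the successor of `k + i * suc k`.
    in ByPower.resolution peel res (k + i * suc k) (normalises-resp {P} s≈ (normalises-^ⁿ {P} (suc i) ν)) (direction⁺-resp n s≈ d)
    where
    open Peeled peel hiding (reps; cover)
    open Resolution res

  resolve : ∀ n {D} → (∀ x → Dec (mem D x)) → VS n D → Resolution n D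
  resolve zero {D} D? (fin L enum) = record
    { N = D ; N-list = L ; N-enum = enum ; P = D ; P? = D? ; P⊆D = id ; reps = ε ∷ []
    ; cover = λ {x} x∈ → here (resp D (solve 1 (λ x → x ⊜ inv e₀ ⊙ x) refl x) x∈) ; poly = base id id }
  resolve (suc n) D? v = let peel = peelLayer D? v in extendResolution peel (resolve n (Peeled.D′? peel) (Peeled.series peel))

-- Torsion and the quotient by the finite subgroup N

module Quotients {c ℓ p : Level} (G : Group c ℓ) where
  open Group G
  open GroupLemmas G
  open Subgroups {c} {ℓ} {p} G
  open PolyZ {c} {ℓ} {p} G
  open SetoidReasoning setoid

  N⊆P : ∀ {N n P} → Poly N n P → ∀ {x} → mem N x → mem P x
  N⊆P (base _ N⊆)    x∈ = N⊆ x∈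
  N⊆P (extend e _) x∈ = K⊆P (N⊆P rest x∈)
    where open Extension e

  member? : ∀ {N n P} → Poly N n P → ∀ {x} → mem P x → Dec (mem N x)
  member? (base P⊆ _) x∈ = yes (P⊆ x∈)
  member? (extend e _) {x} x∈ with fn θ x x∈ ℤ.≟ 0ℤ
    where open Extension e
  ... | yes eq = member? (Extension.rest e) (Extension.0⇒K e x∈ eq)
  ... | no ≢0  = no λ x∈N → ≢0 (Extension.K⇒0 e (N⊆P (Extension.rest e) x∈N) x∈)

  torsion⇒N : ∀ {N n P} → Poly N n P → ∀ {x} r → mem P x → x ^ⁿ suc r ≈ ε → mem N x
  torsion⇒N (base P⊆ _)  r x∈ _  = P⊆ x∈
  torsion⇒N {P = P} (extend e _) {x} r x∈ eq = torsion⇒N rest r (0⇒K x∈ θx≡0) eq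
    where
    open Extension e
    θx≡0 : fn θ x x∈ ≡ 0ℤ
    θx≡0 = case ℤₚ.i*j≡0⇒i≡0∨j≡0 (+ suc r) (≡.trans (≡.sym (fn-^ⁿ θ (suc r) x∈ (mem-^ⁿ P (suc r) x∈))) (fn-ε θ _ eq)) of λ { (inj₁ ()) ; (inj₂ e) → e }

  enumerated⇒torsion : ∀ {N L} → Enumerated N L → ∀ {x} → mem N x → Σ ℕ λ r → x ^ⁿ suc r ≈ ε
  enumerated⇒torsion {N} {L} enum {x} x∈ =
    let i , r , _ , eq = repeats (λ i → Any.index (enum (mem-^ⁿ N i x∈)))
        atᵢ = Anyₚ.lookup-index (enum (mem-^ⁿ N i x∈))
        atⱼ = Anyₚ.lookup-index (enum (mem-^ⁿ N (i + suc r) x∈))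
    in r , (begin
      x ^ⁿ suc r                                     ≈⟨ solve 2 (λ a b → b ⊜ inv a ⊙ (a ⊙ b)) refl (x ^ⁿ i) (x ^ⁿ suc r) ⟩
      (x ^ⁿ i) ⁻¹ ∙ (x ^ⁿ i ∙ x ^ⁿ suc r)            ≈⟨ ∙-congˡ (^ⁿ-+ x i (suc r)) ⟨
      (x ^ⁿ i) ⁻¹ ∙ x ^ⁿ (i + suc r)                 ≈⟨ ∙-congˡ (trans atⱼ (trans (reflexive (cong (lookup L) (≡.sym eq))) (sym atᵢ))) ⟩
      (x ^ⁿ i) ⁻¹ ∙ x ^ⁿ i                           ≈⟨ inverseˡ _ ⟩
      ε                                              ∎)

  -- Conjugation preserves torsion, and by `torsion⇒N` every torsion element of P lies in N.
  N-normal : ∀ {N L n P} → Enumerated N L → Poly N n P → ∀ {x d} → mem N x → mem P d → mem N (x ^ᶜ d)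
  N-normal {N} {L} {P = P} enum poly {x} {d} x∈ d∈ =
    let r , eq = enumerated⇒torsion {N} {L} enum x∈
    in torsion⇒N poly r (mem-^ᶜ P (N⊆P poly x∈) d∈) (trans (^ᶜ-^ⁿ x d (suc r)) (trans (^ᶜ-cong d eq) (^ᶜ-ε d)))

  _/_by_ : (P N : Sub) → (∀ {x d} → mem N x → mem P d → mem N (x ^ᶜ d)) → Group (c ⊔ p) (c ⊔ p)
  P / N by normal = record
    { Carrier = Σ Carrier (mem P)
    ; _≈_ = λ x y → mem N (proj₁ x ⁻¹ ∙ proj₁ y)
    ; _∙_ = λ x y → proj₁ x ∙ proj₁ y , ∙∈ P (proj₂ x) (proj₂ y)
    ; ε   = ε , ε∈ P
    ; _⁻¹ = λ x → proj₁ x ⁻¹ , ⁻¹∈ P (proj₂ x)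
    ; isGroup = record
      { isMonoid = record
        { isSemigroup = record
          { isMagma = record
            { isEquivalence = record
              { refl  = λ {x} → of-≈ (refl {proj₁ x})
              ; sym   = λ {x} {y} e → resp N (solve 2 (λ x y → inv (inv x ⊙ y) ⊜ inv y ⊙ x) refl (proj₁ x) (proj₁ y)) (⁻¹∈ N e)
              ; trans = λ {x} {y} {z} e f → resp N (solve 3 (λ x y z → (inv x ⊙ y) ⊙ (inv y ⊙ z) ⊜ inv x ⊙ z) refl (proj₁ x) (proj₁ y) (proj₁ z)) (∙∈ N e f)
              }
            ; ∙-cong = λ {x} {y} {u} {v} e f → resp N (solve 4 (λ x y u v → ((inv u ⊙ (inv x ⊙ y)) ⊙ u) ⊙ (inv u ⊙ v) ⊜ inv (x ⊙ u) ⊙ (y ⊙ v)) refl (proj₁ x) (proj₁ y) (proj₁ u) (proj₁ v)) (∙∈ N (normal e (proj₂ u)) f)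
            }
          ; assoc = λ x y z → of-≈ (assoc (proj₁ x) (proj₁ y) (proj₁ z))
          }
        ; identity = (λ x → of-≈ (identityˡ (proj₁ x))) , (λ x → of-≈ (identityʳ (proj₁ x)))
        }
      ; inverse = (λ x → of-≈ (inverseˡ (proj₁ x))) , (λ x → of-≈ (inverseʳ (proj₁ x)))
      ; ⁻¹-cong = λ {x} {y} e → resp N (solve 2 (λ x y → (inv (inv x) ⊙ inv (inv x ⊙ y)) ⊙ inv x ⊜ inv (inv x) ⊙ inv y) refl (proj₁ x) (proj₁ y)) (normal (⁻¹∈ N e) (⁻¹∈ P (proj₂ x)))
      }
    }
    where
    of-≈ : ∀ {x y} → x ≈ y → mem N (x ⁻¹ ∙ y)
    of-≈ eq = ≈-quotient N (sym eq)

-- Local rules and subshifts of finite type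

record Finite (A : Set) : Set where
  field
    size    : ℕ
    enc     : A → Fin size
    dec     : Fin size → A
    dec-enc : ∀ x → dec (enc x) ≡ x

  same : A → A → Bool
  same x y = ⌊ enc x Fin.≟ enc y ⌋

  same-≡ : ∀ {x y} → x ≡ y → T (same x y)
  same-≡ {x} ≡.refl = fromWitness {a? = enc x Fin.≟ enc x} ≡.refl

  ≡-same : ∀ {x y} → T (same x y) → x ≡ y
  ≡-same {x} {y} s = ≡.trans (≡.sym (dec-enc x)) (≡.trans (cong dec (toWitness {a? = enc x Fin.≟ enc y} s)) (dec-enc y))

finiteFin : ∀ n → Finite (Fin n)
finiteFin n = record { size = n ; enc = id ; dec = id ; dec-enc = λ _ → ≡.refl }

finiteBool : Finite Bool
finiteBool = record
  { size = 2
  ; enc = λ { false → Fin.zero ; true → Fin.suc Fin.zero }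
  ; dec = λ { Fin.zero → false ; (Fin.suc _) → true }
  ; dec-enc = λ { false → ≡.refl ; true → ≡.refl } }

finite× : ∀ {A B} → Finite A → Finite B → Finite (A × B)
finite× fa fb = record
  { size = A.size * B.size
  ; enc = λ { (a , b) → Fin.combine (A.enc a) (B.enc b) }
  ; dec = λ i → A.dec (proj₁ (Fin.remQuot B.size i)) , B.dec (proj₂ (Fin.remQuot {A.size} B.size i))
  ; dec-enc = λ { (a , b) → cong₂ _,_
      (≡.trans (cong (λ z → A.dec (proj₁ z)) (Finₚ.remQuot-combine (A.enc a) (B.enc b))) (A.dec-enc a))
      (≡.trans (cong (λ z → B.dec (proj₂ z)) (Finₚ.remQuot-combine (A.enc a) (B.enc b))) (B.dec-enc b)) } }
  where
  module A = Finite fa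
  module B = Finite fb

module SFT {c ℓ : Level} (G : Group c ℓ) where
  open Group G
  open GroupLemmas G

  -- Positions are right multiples of g, so rules are invariant under left translation, the shift
  -- action. Three positions are enough for the flow equation.
  record Rule (A : Set) : Set c where
    constructor rule
    field
      h₁ h₂   : Carrier
      allowed : A → A → A → Bool

  Obeys : ∀ {A} → (Carrier → A) → Rule A → Set c
  Obeys x (rule h₁ h₂ allowed) = ∀ g → T (allowed (x g) (x (g ∙ h₁)) (x (g ∙ h₂)))

  Congruent : ∀ {A : Set} → (Carrier → A) → Set (c ⊔ ℓ)
  Congruent x = ∀ {g h} → g ≈ h → x g ≡ x h

  Fixes : ∀ {A : Set} → Carrier → (Carrier → A) → Set c
  Fixes g x = ∀ h → x (g ⁻¹ ∙ h) ≡ x h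

  -- Aperiodicity is assembled piece by piece: each piece is a nonempty SFT none of whose points is
  -- fixed by an element of S, and superposing two of them handles the union.
  record Kill {s} (S : Carrier → Set s) : Set (Level.suc 0ℓ ⊔ c ⊔ ℓ ⊔ s) where
    field
      A          : Set
      finite     : Finite A
      rules      : List (Rule A)
      point      : Carrier → A
      point-cong : Congruent point
      point-ok   : All (Obeys point) rules
      kills      : ∀ (x : Carrier → A) → Congruent x → All (Obeys x) rules → ∀ {g} → S g → ¬ Fixes g x

  kill-⊆ : ∀ {s s′} {S : Carrier → Set s} {S′ : Carrier → Set s′} → (∀ {g} → S′ g → S g) → Kill S → Kill S′
  kill-⊆ ⊆ K = record { Kill K ; kills = λ x x-cong ok Sg → Kill.kills K x x-cong ok (⊆ Sg) }

  kill-∪ : ∀ {s s′} {S : Carrier → Set s} {S′ : Carrier → Set s′} → Kill S → Kill S′ → Kill (λ g → S g ⊎ S′ g)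
  kill-∪ K K′ = record
    { A = K.A × K′.A ; finite = finite× K.finite K′.finite
    ; rules = map left K.rules ++ map right K′.rules
    ; point = λ g → K.point g , K′.point g
    ; point-cong = λ eq → cong₂ _,_ (K.point-cong eq) (K′.point-cong eq)
    ; point-ok = Allₚ.++⁺ (Allₚ.map⁺ K.point-ok) (Allₚ.map⁺ K′.point-ok)
    ; kills = λ x x-cong ok → λ
      { (inj₁ Sg) fix → K.kills (proj₁ ∘ x) (cong proj₁ ∘ x-cong) (Allₚ.map⁻ (Allₚ.++⁻ˡ (map left K.rules) ok)) Sg (cong proj₁ ∘ fix)
      ; (inj₂ Sg) fix → K′.kills (proj₂ ∘ x) (cong proj₂ ∘ x-cong) (Allₚ.map⁻ (Allₚ.++⁻ʳ (map left K.rules) ok)) Sg (cong proj₂ ∘ fix) } }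
    where
    module K = Kill K
    module K′ = Kill K′
    left : Rule K.A → Rule (K.A × K′.A)
    left (rule h₁ h₂ f) = rule h₁ h₂ λ a b c → f (proj₁ a) (proj₁ b) (proj₁ c)
    right : Rule K′.A → Rule (K.A × K′.A)
    right (rule h₁ h₂ f) = rule h₁ h₂ λ a b c → f (proj₂ a) (proj₂ b) (proj₂ c)

  -- If g fixes x, then its conjugate by l fixes the translate of x by l⁻¹, which obeys the same
  -- rules.
  kill-^ᶜ : ∀ {s} {S : Carrier → Set s} → Kill S → Kill (λ g → Σ Carrier λ l → S (g ^ᶜ l))
  kill-^ᶜ K = record { Kill K ; kills = λ x x-cong ok {g} → λ { (l , S-gˡ) fix →
    Kill.kills K (λ h → x (l ∙ h)) (λ eq → x-cong (∙-congˡ eq))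
      (All.map (λ {R} ob h → ≡.subst₂ (λ b c → T (Rule.allowed R (x (l ∙ h)) b c)) (x-cong (assoc l h (Rule.h₁ R))) (x-cong (assoc l h (Rule.h₂ R))) (ob (l ∙ h))) ok)
      S-gˡ (λ h → ≡.trans (x-cong (solve 3 (λ g l h → l ⊙ (inv ((inv l ⊙ g) ⊙ l) ⊙ h) ⊜ inv g ⊙ (l ⊙ h)) refl g l h)) (fix (l ∙ h))) } }

  kill-∅ : Kill (λ _ → ⊥)
  kill-∅ = record { A = Fin 1 ; finite = finiteFin 1 ; rules = [] ; point = λ _ → Fin.zero ; point-cong = λ _ → ≡.refl ; point-ok = [] ; kills = λ _ _ _ () }

  module _ {A : Set} (finite : Finite A) where
    open Finite finite

    private
      Triple : Set
      Triple = Fin size × Fin size × Fin size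

      triples : List Triple
      triples = concatMap (λ i → concatMap (λ j → map (λ k → i , j , k) (allFin size)) (allFin size)) (allFin size)

      ∈-triples : ∀ i j k → (i , j , k) ∈ triples
      ∈-triples i j k = Anyₚ.concatMap⁺ _ (Any.map (λ { ≡.refl → Anyₚ.concatMap⁺ _ (Any.map (λ { ≡.refl → ∈ₚ.∈-map⁺ _ (∈ₚ.∈-allFin k) }) (∈ₚ.∈-allFin j)) }) (∈ₚ.∈-allFin i))

      patternOf : Rule A → Triple → List (Pattern G size)
      patternOf (rule h₁ h₂ allowed) (i , j , k) with allowed (dec i) (dec j) (dec k)
      ... | true  = []
      ... | false = ((ε , i) ∷ (h₁ , j) ∷ (h₂ , k) ∷ []) ∷ []

    forbidden : List (Rule A) → List (Pattern G size)
    forbidden = concatMap (λ r → concatMap (patternOf r) triples)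

    private
      Avoids : Config G size → Carrier → Pattern G size → Set c
      Avoids x g P = Any (λ { (h , a) → shiftAt G g x h ≢ a }) P

      all-concatMap⁻ : ∀ {a b q} {X : Set a} {Y : Set b} {Q : Y → Set q} (f : X → List Y) xs → All Q (concatMap f xs) → All (λ z → All Q (f z)) xs
      all-concatMap⁻ f xs all = Allₚ.map⁻ (Allₚ.concat⁻ {xss = map f xs} all)

      all-concatMap⁺ : ∀ {a b q} {X : Set a} {Y : Set b} {Q : Y → Set q} (f : X → List Y) {xs} → All (λ z → All Q (f z)) xs → All Q (concatMap f xs)
      all-concatMap⁺ f all = Allₚ.concat⁺ (Allₚ.map⁺ all)

      obeys : ∀ (x : Config G size) r → (∀ g → All (Avoids x g) (concatMap (patternOf r) triples)) → Obeys (dec ∘ val x) r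
      -- The shift by g reads a point at g⁻¹ h, so the rule at g is the condition of the SFT at g⁻¹.
      obeys x (rule h₁ h₂ allowed) ok g = go (All.lookup (all-concatMap⁻ (patternOf (rule h₁ h₂ allowed)) triples (ok (g ⁻¹))) (∈-triples (val x g) (val x (g ∙ h₁)) (val x (g ∙ h₂))))
        where
        back : ∀ h → shiftAt G (g ⁻¹) x h ≡ val x (g ∙ h)
        back h = respC x (solve 2 (λ g h → inv (inv g) ⊙ h ⊜ g ⊙ h) refl g h)
        go : All (Avoids x (g ⁻¹)) (patternOf (rule h₁ h₂ allowed) (val x g , val x (g ∙ h₁) , val x (g ∙ h₂))) → T (allowed (dec (val x g)) (dec (val x (g ∙ h₁))) (dec (val x (g ∙ h₂))))
        go all with allowed (dec (val x g)) (dec (val x (g ∙ h₁))) (dec (val x (g ∙ h₂)))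
        ... | true = tt
        go (here ≢ ∷ []) | false = ≢ (≡.trans (back ε) (respC x (identityʳ g)))
        go (there (here ≢) ∷ []) | false = ≢ (back h₁)
        go (there (there (here ≢)) ∷ []) | false = ≢ (back h₂)

    forbidden⇒obeys : ∀ (x : Config G size) rules → InSFT G (forbidden rules) x → All (Obeys (dec ∘ val x)) rules
    forbidden⇒obeys x rules ok = All.tabulate λ {r} r∈ → obeys x r λ g → All.lookup (all-concatMap⁻ (λ r → concatMap (patternOf r) triples) rules (ok g)) r∈

    private
      avoids : ∀ (x : Carrier → A) → Congruent x → (cfg : Config G size) → (∀ g → val cfg g ≡ enc (x g)) → ∀ r → Obeys x r → ∀ g t → All (Avoids cfg g) (patternOf r t)
      avoids x x-cong cfg v (rule h₁ h₂ allowed) ob g (i , j , k) with allowed (dec i) (dec j) (dec k) in eq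
      ... | true  = []
      ... | false with shiftAt G g cfg ε Fin.≟ i | shiftAt G g cfg h₁ Fin.≟ j | shiftAt G g cfg h₂ Fin.≟ k
      ... | no ≢  | _     | _     = here ≢ ∷ []
      ... | yes _ | no ≢  | _     = there (here ≢) ∷ []
      ... | yes _ | yes _ | no ≢  = there (there (here ≢)) ∷ []
      ... | yes p | yes q | yes r = ⊥-elim (subst T (≡.trans (cong₃ allowed (letter p (x-cong (sym (identityʳ _)))) (letter q ≡.refl) (letter r ≡.refl)) eq) (ob (g ⁻¹)))
        where
        cong₃ : ∀ (f : A → A → A → Bool) {a a′ b b′ c c′} → a ≡ a′ → b ≡ b′ → c ≡ c′ → f a b c ≡ f a′ b′ c′
        cong₃ f ≡.refl ≡.refl ≡.refl = ≡.refl
        letter : ∀ {h i u} → shiftAt G g cfg h ≡ i → u ≡ x (g ⁻¹ ∙ h) → u ≡ dec i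
        letter {h} p e = ≡.trans e (≡.trans (≡.sym (dec-enc _)) (cong dec (≡.trans (≡.sym (v (g ⁻¹ ∙ h))) p)))

    obeys⇒forbidden : ∀ (x : Carrier → A) → Congruent x → (cfg : Config G size) → (∀ g → val cfg g ≡ enc (x g)) → ∀ rules → All (Obeys x) rules → InSFT G (forbidden rules) cfg
    obeys⇒forbidden x x-cong cfg v rules ok g =
      all-concatMap⁺ _ (All.map (λ {r} ob → all-concatMap⁺ (patternOf r) (All.universal (avoids x x-cong cfg v r ob g) triples)) ok)

  kill⇒aperiodic : ∀ {s} {S : Carrier → Set s} → Kill S → (L : List Carrier) → (∀ g → S g ⊎ Any (g ≈_) L) → AdmitsStronglyAperiodicSFT G
  kill⇒aperiodic K L cases = size , forbidden finite rules ,
    (cfg , obeys⇒forbidden finite point point-cong cfg (λ _ → ≡.refl) rules point-ok) ,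
    λ x ok → L , λ g fix → case cases g of λ
      { (inj₁ Sg)  → ⊥-elim (kills (dec ∘ val x) (λ eq → cong dec (respC x eq)) (forbidden⇒obeys finite x rules ok) Sg (λ h → cong dec (fix h)))
      ; (inj₂ any) → any }
    where
    open Kill K
    open Finite finite
    cfg : Config G size
    cfg = record { val = enc ∘ point ; respC = λ eq → cong enc (point-cong eq) }

-- Transferring subshifts along retractions

module Transfer {c ℓ c′ ℓ′ : Level} (Λ : Group c′ ℓ′) (Γ : Group c ℓ) where
  private
    module Λ = Group Λ
    module Γ = Group Γ
  open SFT

  -- The kernel of ι is enumerated by ν and r is a retraction of Γ onto Λ commuting with right
  -- multiplication by Λ, so it pulls a point over Λ back to one over Γ.
  record Retraction : Set (c ⊔ ℓ ⊔ c′ ⊔ ℓ′) where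
    field
      ι      : Λ.Carrier → Γ.Carrier
      ι-∙    : ∀ x y → ι (x Λ.∙ y) Γ.≈ ι x Γ.∙ ι y
      ι-⁻¹   : ∀ x → ι (x Λ.⁻¹) Γ.≈ ι x Γ.⁻¹
      ν      : List Γ.Carrier
      ι-cong : ∀ {x y} → x Λ.≈ y → Any (λ n → ι y Γ.≈ ι x Γ.∙ n) ν
      r      : Γ.Carrier → Λ.Carrier
      r-cong : ∀ {g h} → g Γ.≈ h → r g Λ.≈ r h
      r-ι    : ∀ g x → r (g Γ.∙ ι x) Λ.≈ r g Λ.∙ x
      r-ν    : All (λ n → ∀ g → r (g Γ.∙ n) Λ.≈ r g) ν

  -- A point over Γ restricts to Λ along `ι`. The added rules make it constant along `ν`, so that
  -- the restriction respects the equality of Λ.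
  transfer : ∀ {s} {S : Λ.Carrier → Set s} (R : Retraction) → Kill Λ S → Kill Γ (λ g → Σ Λ.Carrier λ x → S x × Retraction.ι R x Γ.≈ g)
  transfer {S = S} R K = record
    { A = A ; finite = finite ; rules = map pushed rules ++ map constant ν
    ; point = point ∘ r ; point-cong = point-cong ∘ r-cong
    ; point-ok = Allₚ.++⁺
        (Allₚ.map⁺ (All.map (λ {R} ob g → ≡.subst₂ (λ b c → T (Rule.allowed R (point (r g)) b c)) (point-cong (Λ.sym (r-ι g (Rule.h₁ R)))) (point-cong (Λ.sym (r-ι g (Rule.h₂ R)))) (ob (r g))) point-ok))
        (Allₚ.map⁺ (All.map (λ inv g → same-≡ (point-cong (Λ.sym (inv g)))) r-ν))
    ; kills = λ x x-cong ok → λ { (y , Sy , ιy≈g) fix →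
        let okᵣ = Allₚ.map⁻ (Allₚ.++⁻ˡ (map pushed rules) ok)
            okᶜ = Allₚ.map⁻ (Allₚ.++⁻ʳ (map pushed rules) ok)
        in kills (x ∘ ι) (λ {a} {b} a≈b → let n , n∈ , eq = find (ι-cong a≈b) in ≡.trans (≡-same (All.lookup okᶜ n∈ (ι a))) (x-cong (Γ.sym eq)))
             (All.map (λ {R} ob g → ≡.subst₂ (λ b c → T (Rule.allowed R (x (ι g)) b c)) (x-cong (Γ.sym (ι-∙ g (Rule.h₁ R)))) (x-cong (Γ.sym (ι-∙ g (Rule.h₂ R)))) (ob (ι g))) okᵣ)
             Sy (λ h → ≡.trans (x-cong (Γ.trans (ι-∙ (y Λ.⁻¹) h) (Γ.∙-congʳ (Γ.trans (ι-⁻¹ y) (Γ.⁻¹-cong ιy≈g))))) (fix (ι h))) }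
    }
    where
    open Retraction R
    open Kill K
    open Finite finite
    pushed : Rule Λ A → Rule Γ A
    pushed (rule h₁ h₂ f) = rule (ι h₁) (ι h₂) f
    constant : Γ.Carrier → Rule Γ A
    constant n = rule n Γ.ε λ a b _ → same a b

-- Colouring a group by the cosets of a subgroup

module Colouring {c ℓ p : Level} (G : Group c ℓ) where
  open Group G
  open GroupLemmas G
  open Subgroups {c} {ℓ} {p} G
  open SFT G

  module _ (D P : Sub) (total : ∀ x → mem D x) (P? : ∀ x → Dec (mem P x)) (reps : List Carrier) (cov : Cover D P reps)
           (S : List Carrier) (gen : ∀ {x} → mem D x → Gen D S x) where
    private
      -- The first l with g l in P depends only on the coset P g, although the list may repeat
      -- cosets.
      first : ∀ L {g} → Any (λ l → mem P (g ∙ l)) L → Fin (length L)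
      first (l ∷ L) {g} a with P? (g ∙ l)
      first (l ∷ L) a          | yes _ = Fin.zero
      first (l ∷ L) (here l∈)  | no ∉  = contradiction l∈ ∉
      first (l ∷ L) (there a)  | no _  = Fin.suc (first L a)

      first-cong : ∀ L {g h} → (∀ l → mem P (g ∙ l) → mem P (h ∙ l)) → (∀ l → mem P (h ∙ l) → mem P (g ∙ l)) →
        (a : Any (λ l → mem P (g ∙ l)) L) (b : Any (λ l → mem P (h ∙ l)) L) → first L a ≡ first L b
      first-cong (l ∷ L) {g} {h} to from a b with P? (g ∙ l) | P? (h ∙ l)
      first-cong (l ∷ L) to from a b | yes _ | yes _ = ≡.refl
      first-cong (l ∷ L) to from a b | yes ∈g | no ∉h = contradiction (to l ∈g) ∉h
      first-cong (l ∷ L) to from a b | no ∉g | yes ∈h = contradiction (from l ∈h) ∉g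
      first-cong (l ∷ L) to from (here l∈) b | no ∉ | no _ = contradiction l∈ ∉
      first-cong (l ∷ L) to from (there a) (here l∈) | no _ | no ∉ = contradiction l∈ ∉
      first-cong (l ∷ L) to from (there a) (there b) | no _ | no _ = cong Fin.suc (first-cong L to from a b)

      first-correct : ∀ L {g} (a : Any (λ l → mem P (g ∙ l)) L) → mem P (g ∙ lookup L (first L a))
      first-correct (l ∷ L) {g} a with P? (g ∙ l)
      first-correct (l ∷ L) a          | yes l∈ = l∈
      first-correct (l ∷ L) (here l∈)  | no ∉  = contradiction l∈ ∉
      first-correct (l ∷ L) (there a)  | no _  = first-correct L a

      coset : ∀ g → Any (λ l → mem P (g ∙ l)) reps
      coset g = Any.map (λ {l} l∈ → resp P (solve 2 (λ l g → inv (inv l ⊙ inv g) ⊜ g ⊙ l) refl l g) (⁻¹∈ P l∈)) (cov (⁻¹∈ D (total g)))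

    colour : Carrier → Fin (length reps)
    colour g = first reps (coset g)

    colour-cong : Congruent colour
    colour-cong {g} {h} eq = first-cong reps (λ l → resp P (∙-congʳ eq)) (λ l → resp P (∙-congʳ (sym eq))) (coset g) (coset h)

    colour-invariant : ∀ {x} g → mem P x → colour (x ∙ g) ≡ colour g
    colour-invariant {x} g x∈ = first-cong reps
      (λ l xgl∈ → resp P (solve 3 (λ x g l → inv x ⊙ ((x ⊙ g) ⊙ l) ⊜ g ⊙ l) refl x g l) (∙∈ P (⁻¹∈ P x∈) xgl∈))
      (λ l gl∈ → resp P (sym (assoc x g l)) (∙∈ P x∈ gl∈)) (coset (x ∙ g)) (coset g)

    colour-correct : ∀ g → mem P (g ∙ lookup reps (colour g))
    colour-correct g = first-correct reps (coset g)

    private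
      rep : Fin (length reps) → Carrier
      rep = lookup reps

      Step : Carrier → Fin (length reps) → Fin (length reps) → Set (c ⊔ p)
      Step s i j = mem P (rep i ⁻¹ ∙ (s ∙ rep j))

      stepRule : Carrier → Rule (Fin (length reps))
      stepRule s = rule s ε λ i j _ → ⌊ P? (rep i ⁻¹ ∙ (s ∙ rep j)) ⌋

    -- The rules make the letters a walk in the Schreier graph: along a word for h, the element l⁻¹
    -- h m lies in P for the representatives l and m at the two ends. If g fixes the point, the walk
    -- from ε to g closes up, and a conjugate of g lies in P.
    colouring : Kill (λ g → ∀ l → l ∈ reps → ¬ mem P (g ^ᶜ l))
    colouring = record
      { A = Fin (length reps) ; finite = finiteFin _ ; rules = map stepRule S ; point = colour ; point-cong = colour-cong
      ; point-ok = Allₚ.map⁺ (All.universal (λ s g → fromWitness (resp P (solve 4 (λ g s l m → inv (g ⊙ l) ⊙ ((g ⊙ s) ⊙ m) ⊜ inv l ⊙ (s ⊙ m)) refl g s (rep (colour g)) (rep (colour (g ∙ s)))) (∙∈ P (⁻¹∈ P (colour-correct g)) (colour-correct (g ∙ s))))) S)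
      ; kills = λ x x-cong ok {g} outside fix →
          let at-ε = x ε
              moved = walk x x-cong (Allₚ.map⁻ ok) (gen (total g)) ε
              returns : x (ε ∙ g) ≡ x ε
              returns = ≡.trans (x-cong (identityˡ g)) (≡.trans (≡.sym (fix g)) (x-cong (inverseˡ g)))
          in outside (rep at-ε) (∈ₚ.∈-lookup at-ε) (resp P (sym (assoc _ _ _)) (subst (λ j → mem P (rep at-ε ⁻¹ ∙ (g ∙ rep j))) returns moved)) }
      where
      walk : ∀ x → Congruent x → All (λ s → Obeys x (stepRule s)) S → ∀ {h} → Gen D S h → ∀ g → Step h (x g) (x (g ∙ h))
      walk x x-cong ok (nil {h} h≈ε) g = subst (Step h (x g)) (x-cong (sym (trans (∙-congˡ h≈ε) (identityʳ g))))
        (resp P (sym (trans (∙-congˡ (∙-congʳ h≈ε)) (solve 1 (λ l → inv l ⊙ (e₀ ⊙ l) ⊜ e₀) refl (rep (x g))))) (ε∈ P))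
      walk x x-cong ok (cons {s} {h} {y} s∈ _ gy eq) g = subst (Step h (x g)) (x-cong (trans (assoc g s y) (∙-congˡ (sym eq))))
        (resp P (trans (solve 5 (λ s y l m n → (inv l ⊙ (s ⊙ m)) ⊙ (inv m ⊙ (y ⊙ n)) ⊜ inv l ⊙ ((s ⊙ y) ⊙ n)) refl s y (rep (x g)) (rep (x (g ∙ s))) (rep (x ((g ∙ s) ∙ y)))) (∙-congˡ (∙-congʳ (sym eq))))
          (∙∈ P (toWitness (All.lookup ok s∈ g)) (walk x x-cong ok gy (g ∙ s))))

-- Beatty sequences and their carries

-- The two inequalities say -1 < z < n after clearing the denominator K.
inRange : ∀ z K M N n → z ℤ.* + K ℤ.+ + M ≡ + N → M < N + K → N < n * K + M → Σ (Fin n) λ i → + toℕ i ≡ z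
inRange (+ m) K M N n eq _ N< = fromℕ< m<n , cong +_ (Finₚ.toℕ-fromℕ< m<n)
  where
  eq′ : m * K + M ≡ N
  eq′ = ℤₚ.+-injective (≡.trans (cong (ℤ._+ + M) (ℤₚ.pos-* m K)) eq)
  m<n : m < n
  m<n = ℕₚ.*-cancelʳ-< K m n (ℕₚ.+-cancelʳ-< M (m * K) (n * K) (subst (_< n * K + M) (≡.sym eq′) N<))
inRange -[1+ m ] K M N n eq M< _ = contradiction (ℕₚ.≤-trans (ℕₚ.+-monoʳ-≤ N (ℕₚ.m≤m+n K (m * K))) (ℕₚ.≤-reflexive eq′)) (ℕₚ.<⇒≱ M<)
  where
  move : ∀ u k m → u ≡ ℤ.- k ℤ.+ m → u ℤ.+ k ≡ m
  move u k m ≡.refl = lem k m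
    where lem : ∀ k m → ℤ.- k ℤ.+ m ℤ.+ k ≡ m
          lem = ℤRing.solve-∀
  eq′ : N + suc m * K ≡ M
  eq′ = ℤₚ.+-injective (move (+ N) (+ (suc m * K)) (+ M) (≡.trans (≡.sym eq) (cong (ℤ._+ + M) (≡.trans (≡.sym (ℤₚ.neg-distribˡ-* (+ suc m) (+ K))) (cong ℤ.-_ (≡.sym (ℤₚ.pos-* (suc m) K)))))))

record Slope : Set where
  constructor slope
  field
    num den₁ : ℕ
  den : ℕ
  den = suc den₁
  field
    lower : den ≤ num
    upper : num < 3 * den

open Slope

numer : Bool → ℕ
numer false = 1
numer true  = 3

numer≤3 : ∀ b → numer b ≤ 3
numer≤3 false = s≤s z≤n
numer≤3 true  = ℕₚ.≤-refl

-- α′ = 2α / numer b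
Follows : Slope → Slope → Bool → Set
Follows α α′ b = numer b * num α′ * den α ≡ 2 * num α * den α′

-- The map α ↦ 2α for α < 3/2 and α ↦ 2α/3 for α ≥ 3/2 is a bijection of [1,3).
next : ∀ α → Σ Slope λ α′ → Σ Bool (Follows α α′)
next α with 2 * num α ℕ.<? 3 * den α
... | yes small = slope (2 * num α) (den₁ α) (ℕₚ.≤-trans (lower α) (ℕₚ.m≤m+n (num α) _)) small , false , lem (num α) (den α)
  where lem : ∀ n d → 1 * (2 * n) * d ≡ 2 * n * d
        lem = ℕRing.solve-∀
... | no large = slope (2 * num α) (den₁ α + 2 * den α) (ℕₚ.≮⇒≥ large)
    (ℕₚ.<-≤-trans (ℕₚ.*-monoʳ-< 2 (upper α)) (ℕₚ.≤-trans (ℕₚ.m≤m+n (2 * (3 * den α)) (3 * den α)) (ℕₚ.≤-reflexive (lem₁ (den α))))) ,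
    true , lem₂ (num α) (den α)
  where lem₁ : ∀ d → 2 * (3 * d) + 3 * d ≡ 3 * (d + 2 * d)
        lem₁ = ℕRing.solve-∀
        lem₂ : ∀ n d → 3 * (2 * n) * d ≡ 2 * n * (d + 2 * d)
        lem₂ = ℕRing.solve-∀

previous : ∀ α′ → Σ Slope λ α → Σ Bool (Follows α α′)
previous α with 2 * den α ℕ.≤? num α
... | yes large = slope (num α) (den₁ α + 1 * den α) large
    (ℕₚ.<-≤-trans (upper α) (ℕₚ.*-monoʳ-≤ 3 (ℕₚ.m≤m+n (den α) (1 * den α)))) , false , lem (num α) (den α)
  where lem : ∀ n d → 1 * n * (d + 1 * d) ≡ 2 * n * d
        lem = ℕRing.solve-∀
... | no small = slope (3 * num α) (den₁ α + 1 * den α)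
    (ℕₚ.≤-trans (ℕₚ.*-monoʳ-≤ 2 (lower α)) (ℕₚ.*-monoˡ-≤ (num α) {2} {3} (s≤s (s≤s z≤n))))
    (ℕₚ.*-monoʳ-< 3 (ℕₚ.≰⇒> small)) , true , lem (num α) (den α)
  where lem : ∀ n d → 3 * n * (d + 1 * d) ≡ 2 * (3 * n) * d
        lem = ℕRing.solve-∀

one : Slope
one = slope 1 0 (s≤s z≤n) (s≤s (s≤s z≤n))

-- The orbit of 1 in both directions, since the cosets of K are indexed by all of ℤ.
slopes : ℤ → Slope
slopes (+ zero)     = one
slopes (+ suc n)    = proj₁ (next (slopes (+ n)))
slopes -[1+ zero ]  = proj₁ (previous one)
slopes -[1+ suc n ] = proj₁ (previous (slopes -[1+ n ]))

branch : ℤ → Bool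
branch (+ n)        = proj₁ (proj₂ (next (slopes (+ n))))
branch -[1+ zero ]  = proj₁ (proj₂ (previous one))
branch -[1+ suc n ] = proj₁ (proj₂ (previous (slopes -[1+ n ])))

slopes-follow : ∀ i → Follows (slopes i) (slopes (ℤ.suc i)) (branch i)
slopes-follow (+ n)        = proj₂ (proj₂ (next (slopes (+ n))))
slopes-follow -[1+ zero ]  = proj₂ (proj₂ (previous one))
slopes-follow -[1+ suc n ] = proj₂ (proj₂ (previous (slopes -[1+ n ])))

module _ (D : ℕ) .{{_ : NonZero D}} where
  remainder : ∀ z → + (z ℤ÷.%ℕ D) ≡ z ℤ.- (z ℤ÷./ℕ D) ℤ.* + D
  remainder z = lem _ _ _ (ℤ÷.a≡a%ℕn+[a/ℕn]*n z D)
    where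
    lem : ∀ z r f → z ≡ r ℤ.+ f → r ≡ z ℤ.- f
    lem z r f ≡.refl = lem′ r f
      where lem′ : ∀ r f → r ≡ r ℤ.+ f ℤ.- f
            lem′ = ℤRing.solve-∀

floor : Slope → ℤ → ℤ
floor α j = (+ num α ℤ.* j) ℤ÷./ℕ den α

module _ (a₁ : ℕ) where
  private
    a = suc a₁

  -- Since 1 ≤ α < 3, the increment of ⌊αj⌋ over the length a lies between 1 and 3a. Its positivity
  -- later bounds a sum of densities from below by the number of terms.
  difference : ∀ α j → Σ (Fin (3 * a)) λ i → + suc (toℕ i) ≡ floor α (j ℤ.+ + a) ℤ.- floor α j
  difference α j = let i , eq = inRange z D (r′ + D) (num α * a + r) (3 * a) eqn low high in i , ≡.trans (cong ℤ.suc eq) (suc-pred _)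
    where
    D  = den α
    f  = floor α j
    f′ = floor α (j ℤ.+ + a)
    r  = (+ num α ℤ.* j) ℤ÷.%ℕ D
    r′ = (+ num α ℤ.* (j ℤ.+ + a)) ℤ÷.%ℕ D
    z  = ℤ.pred (f′ ℤ.- f)
    suc-pred : ∀ z → ℤ.suc (ℤ.pred z) ≡ z
    suc-pred z = ℤₚ.suc-pred z
    r<D : r < D
    r<D = ℤ÷.n%ℕd<d (+ num α ℤ.* j) D
    r′<D : r′ < D
    r′<D = ℤ÷.n%ℕd<d (+ num α ℤ.* (j ℤ.+ + a)) D
    poly : ∀ n D j a f f′ → (-[1+ 0 ] ℤ.+ (f′ ℤ.- f)) ℤ.* D ℤ.+ ((n ℤ.* (j ℤ.+ a) ℤ.- f′ ℤ.* D) ℤ.+ D) ≡ n ℤ.* a ℤ.+ (n ℤ.* j ℤ.- f ℤ.* D)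
    poly = ℤRing.solve-∀
    eqn : z ℤ.* + D ℤ.+ + (r′ + D) ≡ + (num α * a + r)
    eqn = ≡.trans (cong (λ u → z ℤ.* + D ℤ.+ (u ℤ.+ + D)) (remainder D (+ num α ℤ.* (j ℤ.+ + a))))
          (≡.trans (poly (+ num α) (+ D) j (+ a) f f′)
          (cong₂ ℤ._+_ (≡.sym (ℤₚ.pos-* (num α) a)) (≡.sym (remainder D (+ num α ℤ.* j)))))
    low : r′ + D < num α * a + r + D
    low = ℕₚ.+-monoˡ-< D (ℕₚ.<-≤-trans r′<D (ℕₚ.≤-trans (lower α) (ℕₚ.≤-trans (ℕₚ.m≤m*n (num α) a) (ℕₚ.m≤m+n _ r))))
    high : num α * a + r < 3 * a * D + (r′ + D)
    high = ℕₚ.+-mono-≤-< (ℕₚ.≤-trans (ℕₚ.*-monoˡ-≤ a (ℕₚ.<⇒≤ (upper α))) (ℕₚ.≤-reflexive (lem D a))) (ℕₚ.<-≤-trans r<D (ℕₚ.m≤n+m D r′))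
      where lem : ∀ D a → 3 * D * a ≡ 3 * a * D
            lem = ℕRing.solve-∀

  -- numer b ⌊α′j′⌋ - 2 ⌊αj⌋ is within a bounded distance of 2α(j′ - j), which is unchanged when a is added
  -- to j and j′; the summand 3 makes the difference nonnegative.
  carryℤ : Slope → Slope → Bool → ℤ → ℤ → ℤ
  carryℤ α α′ b j j′ = + numer b ℤ.* floor α′ j′ ℤ.- + 2 ℤ.* floor α j ℤ.- (+ (2 * num α) ℤ.* (j′ ℤ.- j)) ℤ÷./ℕ den α ℤ.+ + 3

  -- As n′/D′ is 2n/D divided by A, the quantity equals 3 + 2r/D + s/D - A r′/D′. With A ≤ 3 and
  -- each fraction in [0,1), it lies strictly between 0 and 6.
  carry-bound : ∀ A D D′ n n′ j j′ f f′ v r r′ s → A ≤ 3 → r < D → r′ < D′ → s < D → A * n′ * D ≡ 2 * n * D′ →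
    + r ≡ + n ℤ.* j ℤ.- f ℤ.* + D → + r′ ≡ + n′ ℤ.* j′ ℤ.- f′ ℤ.* + D′ → + s ≡ + (2 * n) ℤ.* (j′ ℤ.- j) ℤ.- v ℤ.* + D →
    Σ (Fin 6) λ i → + toℕ i ≡ + A ℤ.* f′ ℤ.- + 2 ℤ.* f ℤ.- v ℤ.+ + 3
  carry-bound A D D′ n n′ j j′ f f′ v r r′ s A≤3 r<D r′<D′ s<D follows r≡ r′≡ s≡ =
    inRange c (D * D′) (A * (D * r′)) (3 * (D * D′) + (2 * (D′ * r) + D′ * s)) 6 eqn low high
    where
    c = + A ℤ.* f′ ℤ.- + 2 ℤ.* f ℤ.- v ℤ.+ + 3
    instance
      D≢0 : NonZero D
      D≢0 = ℕ.>-nonZero (ℕₚ.≤-<-trans z≤n r<D)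
      D′≢0 : NonZero D′
      D′≢0 = ℕ.>-nonZero (ℕₚ.≤-<-trans z≤n r′<D′)
    followsℤ : + A ℤ.* + n′ ℤ.* + D ≡ + 2 ℤ.* + n ℤ.* + D′
    followsℤ = ≡.trans (≡.sym (pos-*³ A n′ D)) (≡.trans (cong +_ follows) (pos-*³ 2 n D′))
      where
      pos-*³ : ∀ x y z → + (x * y * z) ≡ + x ℤ.* + y ℤ.* + z
      pos-*³ x y z = ≡.trans (ℤₚ.pos-* (x * y) z) (cong (ℤ._* + z) (ℤₚ.pos-* x y))
    poly₁ : ∀ A D D′ n n′ j j′ f f′ v →
      (A ℤ.* f′ ℤ.- + 2 ℤ.* f ℤ.- v ℤ.+ + 3) ℤ.* (D ℤ.* D′) ℤ.+ A ℤ.* (D ℤ.* (n′ ℤ.* j′ ℤ.- f′ ℤ.* D′))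
      ≡ (A ℤ.* n′ ℤ.* D) ℤ.* j′ ℤ.+ (+ 3 ℤ.- + 2 ℤ.* f ℤ.- v) ℤ.* (D ℤ.* D′)
    poly₁ = ℤRing.solve-∀
    poly₂ : ∀ D D′ n j j′ f v →
      (+ 2 ℤ.* n ℤ.* D′) ℤ.* j′ ℤ.+ (+ 3 ℤ.- + 2 ℤ.* f ℤ.- v) ℤ.* (D ℤ.* D′)
      ≡ + 3 ℤ.* (D ℤ.* D′) ℤ.+ (+ 2 ℤ.* (D′ ℤ.* (n ℤ.* j ℤ.- f ℤ.* D)) ℤ.+ D′ ℤ.* (+ 2 ℤ.* n ℤ.* (j′ ℤ.- j) ℤ.- v ℤ.* D))
    poly₂ = ℤRing.solve-∀
    left : + (A * (D * r′)) ≡ + A ℤ.* (+ D ℤ.* (+ n′ ℤ.* j′ ℤ.- f′ ℤ.* + D′))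
    left = ≡.trans (ℤₚ.pos-* A (D * r′)) (cong (λ z → + A ℤ.* z) (≡.trans (ℤₚ.pos-* D r′) (cong (λ z → + D ℤ.* z) r′≡)))
    right : + (3 * (D * D′) + (2 * (D′ * r) + D′ * s)) ≡ + 3 ℤ.* (+ D ℤ.* + D′) ℤ.+ (+ 2 ℤ.* (+ D′ ℤ.* (+ n ℤ.* j ℤ.- f ℤ.* + D)) ℤ.+ + D′ ℤ.* (+ 2 ℤ.* + n ℤ.* (j′ ℤ.- j) ℤ.- v ℤ.* + D))
    right = cong₂ ℤ._+_ (≡.trans (ℤₚ.pos-* 3 (D * D′)) (cong (λ z → + 3 ℤ.* z) (ℤₚ.pos-* D D′)))
      (cong₂ ℤ._+_ (≡.trans (ℤₚ.pos-* 2 (D′ * r)) (cong (λ z → + 2 ℤ.* z) (≡.trans (ℤₚ.pos-* D′ r) (cong (λ z → + D′ ℤ.* z) r≡))))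
                   (≡.trans (ℤₚ.pos-* D′ s) (cong (λ z → + D′ ℤ.* z) (≡.trans s≡ (cong (λ z → z ℤ.* (j′ ℤ.- j) ℤ.- v ℤ.* + D) (ℤₚ.pos-* 2 n))))))
    eqn : c ℤ.* + (D * D′) ℤ.+ + (A * (D * r′)) ≡ + (3 * (D * D′) + (2 * (D′ * r) + D′ * s))
    eqn = ≡.trans (cong₂ (λ x y → c ℤ.* x ℤ.+ y) (ℤₚ.pos-* D D′) left)
          (≡.trans (poly₁ (+ A) (+ D) (+ D′) (+ n) (+ n′) j j′ f f′ v)
          (≡.trans (cong (λ z → z ℤ.* j′ ℤ.+ (+ 3 ℤ.- + 2 ℤ.* f ℤ.- v) ℤ.* (+ D ℤ.* + D′)) followsℤ)
          (≡.trans (poly₂ (+ D) (+ D′) (+ n) j j′ f v) (≡.sym right))))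
    low : A * (D * r′) < 3 * (D * D′) + (2 * (D′ * r) + D′ * s) + D * D′
    low = ℕₚ.≤-<-trans (ℕₚ.*-mono-≤ A≤3 (ℕₚ.*-monoʳ-≤ D (ℕₚ.<⇒≤ r′<D′)))
      (ℕₚ.≤-<-trans (ℕₚ.m≤m+n (3 * (D * D′)) _) (ℕₚ.m<m+n _ {D * D′} (ℕ.>-nonZero⁻¹ (D * D′) {{ℕₚ.m*n≢0 D D′}})))
    high : 3 * (D * D′) + (2 * (D′ * r) + D′ * s) < 6 * (D * D′) + A * (D * r′)
    high = ℕₚ.<-≤-trans (ℕₚ.+-monoʳ-< (3 * (D * D′)) (ℕₚ.+-mono-≤-< (ℕₚ.*-monoʳ-≤ 2 (ℕₚ.*-monoʳ-≤ D′ (ℕₚ.<⇒≤ r<D))) (ℕₚ.*-monoʳ-< D′ s<D)))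
      (ℕₚ.≤-trans (ℕₚ.≤-reflexive (lem D D′)) (ℕₚ.m≤m+n _ _))
      where lem : ∀ D D′ → 3 * (D * D′) + (2 * (D′ * D) + D′ * D) ≡ 6 * (D * D′)
            lem = ℕRing.solve-∀

  carry : ∀ α α′ b → Follows α α′ b → ∀ j j′ → Σ (Fin 6) λ i → + toℕ i ≡ carryℤ α α′ b j j′
  carry α α′ b follows j j′ = carry-bound (numer b) (den α) (den α′) (num α) (num α′) j j′ _ _ _ _ _ _ (numer≤3 b)
    (ℤ÷.n%ℕd<d (+ num α ℤ.* j) (den α)) (ℤ÷.n%ℕd<d (+ num α′ ℤ.* j′) (den α′)) (ℤ÷.n%ℕd<d (+ (2 * num α) ℤ.* (j′ ℤ.- j)) (den α)) follows
    (remainder (den α) (+ num α ℤ.* j)) (remainder (den α′) (+ num α′ ℤ.* j′)) (remainder (den α) (+ (2 * num α) ℤ.* (j′ ℤ.- j)))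

  balance-arith : ∀ A X X′ k k′ {f′₁ f′₀ f₁ f₀ v v′} → v ≡ v′ → + X′ ≡ f′₁ ℤ.- f′₀ → + X ≡ f₁ ℤ.- f₀ →
    + k ≡ + A ℤ.* f′₀ ℤ.- + 2 ℤ.* f₀ ℤ.- v ℤ.+ + 3 → + k′ ≡ + A ℤ.* f′₁ ℤ.- + 2 ℤ.* f₁ ℤ.- v′ ℤ.+ + 3 →
    A * X′ + k ≡ 2 * X + k′
  balance-arith A X X′ k k′ {f′₁} {f′₀} {f₁} {f₀} {v} ≡.refl X′≡ X≡ k≡ k′≡ = ℤₚ.+-injective
    (≡.trans (cong₂ ℤ._+_ (≡.trans (ℤₚ.pos-* A X′) (cong (λ z → + A ℤ.* z) X′≡)) k≡)
    (≡.trans (lem (+ A) f′₁ f′₀ f₁ f₀ v)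
    (≡.sym (cong₂ ℤ._+_ (≡.trans (ℤₚ.pos-* 2 X) (cong (λ z → + 2 ℤ.* z) X≡)) k′≡))))
    where
    lem : ∀ A f′₁ f′₀ f₁ f₀ v → A ℤ.* (f′₁ ℤ.- f′₀) ℤ.+ (A ℤ.* f′₀ ℤ.- + 2 ℤ.* f₀ ℤ.- v ℤ.+ + 3) ≡ + 2 ℤ.* (f₁ ℤ.- f₀) ℤ.+ (A ℤ.* f′₁ ℤ.- + 2 ℤ.* f₁ ℤ.- v ℤ.+ + 3)
    lem = ℤRing.solve-∀

  abstract
    branchℤ : ℤ → Bool
    branchℤ = branch

    densityℤ : ℤ → ℤ → Fin (3 * a)
    densityℤ i j = proj₁ (difference (slopes i) j)

    flow : ℤ → ℤ → ℤ → Fin 6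
    flow i j j′ = proj₁ (carry (slopes i) (slopes (ℤ.suc i)) (branch i) (slopes-follow i) j j′)

    -- Telescoping: up to a term in j′ - j the carry is A ⌊α′j′⌋ - 2 ⌊αj⌋, so its increment is the
    -- same expression in the increments of the two Beatty sequences, which are the densities.
    balance : ∀ i j j′ → numer (branchℤ i) * suc (toℕ (densityℤ (ℤ.suc i) j′)) + toℕ (flow i j j′)
                       ≡ 2 * suc (toℕ (densityℤ i j)) + toℕ (flow i (j ℤ.+ + a) (j′ ℤ.+ + a))
    balance i j j′ = balance-arith (numer (branch i)) _ _ _ _
      (cong (λ z → (+ (2 * num (slopes i)) ℤ.* z) ℤ÷./ℕ den (slopes i)) (same-gap j j′ (+ a)))
      (proj₂ (difference (slopes (ℤ.suc i)) j′)) (proj₂ (difference (slopes i) j))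
      (proj₂ (carry (slopes i) (slopes (ℤ.suc i)) (branch i) (slopes-follow i) j j′))
      (proj₂ (carry (slopes i) (slopes (ℤ.suc i)) (branch i) (slopes-follow i) (j ℤ.+ + a) (j′ ℤ.+ + a)))
      where
      same-gap : ∀ j j′ a → j′ ℤ.- j ≡ (j′ ℤ.+ a) ℤ.- (j ℤ.+ a)
      same-gap = ℤRing.solve-∀

-- Bounded errors and finite sums

record Near (e x y : ℕ) : Set where
  constructor near
  field
    ≤ʳ : x ≤ y + e
    ≤ˡ : y ≤ x + e

near-refl : ∀ {x} → Near 0 x x
near-refl {x} = near (ℕₚ.m≤m+n x 0) (ℕₚ.m≤m+n x 0)

near-sym : ∀ {e x y} → Near e x y → Near e y x
near-sym (near p q) = near q p

near-mono : ∀ {e e′ x y} → e ≤ e′ → Near e x y → Near e′ x y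
near-mono {x = x} {y} e≤ (near p q) = near (ℕₚ.≤-trans p (ℕₚ.+-monoʳ-≤ y e≤)) (ℕₚ.≤-trans q (ℕₚ.+-monoʳ-≤ x e≤))

near-trans : ∀ {e e′ x y z} → Near e x y → Near e′ y z → Near (e + e′) x z
near-trans {e} {e′} {x} {y} {z} (near p q) (near p′ q′) =
  near (ℕₚ.≤-trans p (ℕₚ.≤-trans (ℕₚ.+-monoˡ-≤ e p′) (ℕₚ.≤-reflexive (lem z e′ e))))
       (ℕₚ.≤-trans q′ (ℕₚ.≤-trans (ℕₚ.+-monoˡ-≤ e′ q) (ℕₚ.≤-reflexive (ℕₚ.+-assoc x e e′))))
  where lem : ∀ z e′ e → z + e′ + e ≡ z + (e + e′)
        lem = ℕRing.solve-∀

near-+ : ∀ {e e′ x y x′ y′} → Near e x y → Near e′ x′ y′ → Near (e + e′) (x + x′) (y + y′)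
near-+ {e} {e′} {x} {y} {x′} {y′} (near p q) (near p′ q′) =
  near (ℕₚ.≤-trans (ℕₚ.+-mono-≤ p p′) (ℕₚ.≤-reflexive (lem y y′ e e′))) (ℕₚ.≤-trans (ℕₚ.+-mono-≤ q q′) (ℕₚ.≤-reflexive (lem x x′ e e′)))
  where lem : ∀ y y′ e e′ → y + e + (y′ + e′) ≡ y + y′ + (e + e′)
        lem = ℕRing.solve-∀

near-* : ∀ {e x y} k → Near e x y → Near (k * e) (k * x) (k * y)
near-* {e} {x} {y} k (near p q) =
  near (ℕₚ.≤-trans (ℕₚ.*-monoʳ-≤ k p) (ℕₚ.≤-reflexive (ℕₚ.*-distribˡ-+ k y e))) (ℕₚ.≤-trans (ℕₚ.*-monoʳ-≤ k q) (ℕₚ.≤-reflexive (ℕₚ.*-distribˡ-+ k x e)))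

near-/ : ∀ {e x y} k → Near (suc k * e) (suc k * x) (suc k * y) → Near e x y
near-/ {e} {x} {y} k (near p q) =
  near (ℕₚ.*-cancelˡ-≤ (suc k) (ℕₚ.≤-trans p (ℕₚ.≤-reflexive (≡.sym (ℕₚ.*-distribˡ-+ (suc k) y e)))))
       (ℕₚ.*-cancelˡ-≤ (suc k) (ℕₚ.≤-trans q (ℕₚ.≤-reflexive (≡.sym (ℕₚ.*-distribˡ-+ (suc k) x e)))))

near-balance : ∀ {e x y p q} → x + p ≡ y + q → Near e q p → Near e x y
near-balance {e} {x} {y} {p} {q} eq (near q≤ p≤) =
  near (ℕₚ.+-cancelʳ-≤ p x (y + e) (ℕₚ.≤-trans (ℕₚ.≤-reflexive eq) (ℕₚ.≤-trans (ℕₚ.+-monoʳ-≤ y q≤) (ℕₚ.≤-reflexive (lem y p e)))))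
       (ℕₚ.+-cancelʳ-≤ q y (x + e) (ℕₚ.≤-trans (ℕₚ.≤-reflexive (≡.sym eq)) (ℕₚ.≤-trans (ℕₚ.+-monoʳ-≤ x p≤) (ℕₚ.≤-reflexive (lem x q e)))))
  where lem : ∀ y p e → y + (p + e) ≡ y + e + p
        lem = ℕRing.solve-∀

near-subst : ∀ {e e′ x x′ y y′} → e ≡ e′ → x ≡ x′ → y ≡ y′ → Near e x y → Near e′ x′ y′
near-subst ≡.refl ≡.refl ≡.refl n = n

total : ∀ {a} {A : Set a} → (A → ℕ) → List A → ℕ
total f []       = 0
total f (x ∷ xs) = f x + total f xs

total-cong : ∀ {a} {A : Set a} {f g : A → ℕ} → (∀ x → f x ≡ g x) → ∀ xs → total f xs ≡ total g xs
total-cong eq []       = ≡.refl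
total-cong eq (x ∷ xs) = cong₂ _+_ (eq x) (total-cong eq xs)

total-++ : ∀ {a} {A : Set a} (f : A → ℕ) xs ys → total f (xs ++ ys) ≡ total f xs + total f ys
total-++ f []       ys = ≡.refl
total-++ f (x ∷ xs) ys = ≡.trans (cong (λ z → f x + z) (total-++ f xs ys)) (≡.sym (ℕₚ.+-assoc (f x) _ _))

total-map : ∀ {a b} {A : Set a} {B : Set b} (f : B → ℕ) (g : A → B) xs → total f (map g xs) ≡ total (f ∘ g) xs
total-map f g []       = ≡.refl
total-map f g (x ∷ xs) = cong (λ z → f (g x) + z) (total-map f g xs)

total-+ : ∀ {a} {A : Set a} (f g : A → ℕ) xs → total (λ x → f x + g x) xs ≡ total f xs + total g xs
total-+ f g []       = ≡.refl
total-+ f g (x ∷ xs) = ≡.trans (cong (λ z → f x + g x + z) (total-+ f g xs)) (lem (f x) (g x) _ _)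
  where lem : ∀ a b c d → a + b + (c + d) ≡ a + c + (b + d)
        lem = ℕRing.solve-∀

total-* : ∀ {a} {A : Set a} k (f : A → ℕ) xs → total (λ x → k * f x) xs ≡ k * total f xs
total-* k f []       = ≡.sym (ℕₚ.*-zeroʳ k)
total-* k f (x ∷ xs) = ≡.trans (cong (λ z → k * f x + z) (total-* k f xs)) (≡.sym (ℕₚ.*-distribˡ-+ k (f x) _))

total-≤ : ∀ {a} {A : Set a} (f : A → ℕ) C → (∀ x → f x ≤ C) → ∀ xs → total f xs ≤ C * length xs
total-≤ f C f≤ []       = z≤n
total-≤ f C f≤ (x ∷ xs) = ℕₚ.≤-trans (ℕₚ.+-mono-≤ (f≤ x) (total-≤ f C f≤ xs)) (ℕₚ.≤-reflexive (≡.sym (ℕₚ.*-suc C (length xs))))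

length≤total : ∀ {a} {A : Set a} (f : A → ℕ) → (∀ x → 1 ≤ f x) → ∀ xs → length xs ≤ total f xs
length≤total f 1≤ []       = z≤n
length≤total f 1≤ (x ∷ xs) = ℕₚ.+-mono-≤ (1≤ x) (length≤total f 1≤ xs)

sumTo : ℕ → (ℕ → ℕ) → ℕ
sumTo zero    f = 0
sumTo (suc n) f = f n + sumTo n f

sumTo-cong : ∀ n {f g : ℕ → ℕ} → (∀ i → f i ≡ g i) → sumTo n f ≡ sumTo n g
sumTo-cong zero    eq = ≡.refl
sumTo-cong (suc n) eq = cong₂ _+_ (eq n) (sumTo-cong n eq)

sumTo-* : ∀ n k (f : ℕ → ℕ) → sumTo n (λ i → k * f i) ≡ k * sumTo n f
sumTo-* zero    k f = ≡.sym (ℕₚ.*-zeroʳ k)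
sumTo-* (suc n) k f = ≡.trans (cong (λ z → k * f n + z) (sumTo-* n k f)) (≡.sym (ℕₚ.*-distribˡ-+ k (f n) _))

sumTo-near : ∀ n {e} {f g : ℕ → ℕ} → (∀ i → i < n → Near e (f i) (g i)) → Near (n * e) (sumTo n f) (sumTo n g)
sumTo-near zero    h = near-refl
sumTo-near (suc n) h = near-+ (h n (ℕₚ.n<1+n n)) (sumTo-near n (λ i i<n → h i (ℕₚ.m<n⇒m<1+n i<n)))

sumTo-suc : ∀ n (f : ℕ → ℕ) → sumTo n (λ i → f (suc i)) + f 0 ≡ sumTo n f + f n
sumTo-suc zero    f = ≡.refl
sumTo-suc (suc n) f = ≡.trans (ℕₚ.+-assoc (f (suc n)) _ _) (≡.trans (cong (λ z → f (suc n) + z) (sumTo-suc n f)) (lem (f (suc n)) _ (f n)))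
  where lem : ∀ a b c → a + (b + c) ≡ c + b + a
        lem = ℕRing.solve-∀

module _ (h : ℤ → ℕ) (B : ℕ) (h≤B : ∀ i → h i ≤ B) where
  private
    shift₁ : ∀ n k → Near B (sumTo n (λ i → h (+ suc i ℤ.+ k))) (sumTo n (λ i → h (+ i ℤ.+ k)))
    shift₁ n k = near-balance (sumTo-suc n (λ i → h (+ i ℤ.+ k)))
      (near (ℕₚ.≤-trans (h≤B _) (ℕₚ.m≤n+m B _)) (ℕₚ.≤-trans (h≤B _) (ℕₚ.m≤n+m B _)))

    shiftℕ : ∀ n j k → Near (j * B) (sumTo n (λ i → h (+ i ℤ.+ (+ j ℤ.+ k)))) (sumTo n (λ i → h (+ i ℤ.+ k)))
    shiftℕ n zero    k = near-subst ≡.refl (sumTo-cong n (λ i → cong (λ z → h (+ i ℤ.+ z)) (≡.sym (ℤₚ.+-identityˡ k)))) ≡.refl near-refl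
    shiftℕ n (suc j) k = near-trans
      (near-subst ≡.refl (sumTo-cong n (λ i → cong h (lem (+ i) (+ j) k))) ≡.refl (shift₁ n (+ j ℤ.+ k)))
      (shiftℕ n j k)
      where lem : ∀ i j k → (+ 1 ℤ.+ i) ℤ.+ (j ℤ.+ k) ≡ i ℤ.+ ((+ 1 ℤ.+ j) ℤ.+ k)
            lem = ℤRing.solve-∀

  -- Each unit of the shift exchanges one term for another, and both are at most B.
  sumTo-shift : ∀ n j → Near (ℤ.∣ j ∣ * B) (sumTo n (λ i → h (+ i ℤ.+ j))) (sumTo n (λ i → h (+ i)))
  sumTo-shift n (+ j) = near-subst ≡.refl
    (sumTo-cong n (λ i → cong (λ z → h (+ i ℤ.+ z)) (ℤₚ.+-identityʳ (+ j)))) (sumTo-cong n (λ i → cong h (ℤₚ.+-identityʳ (+ i)))) (shiftℕ n j 0ℤ)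
  sumTo-shift n -[1+ j ] = near-sym (near-subst ≡.refl
    (sumTo-cong n (λ i → cong h (lem (+ i) (+ suc j)))) ≡.refl (shiftℕ n (suc j) -[1+ j ]))
    where lem : ∀ i k → i ℤ.+ (k ℤ.+ ℤ.- k) ≡ i
          lem = ℤRing.solve-∀

-- Følner sets and extensions by ℤ

module _ {c ℓ : Level} (Γ : Group c ℓ) where
  open Group Γ

  -- Ω is a list rather than a set, so that no decidable equality is needed.
  AlmostInvariant : List Carrier → List Carrier → ℕ → Set (c ⊔ ℓ)
  AlmostInvariant Ω ss M = ∀ C (F : Carrier → ℕ) → (∀ {x y} → x ≈ y → F x ≡ F y) → (∀ x → F x ≤ C) →
    ∀ {s} → s ∈ ss → Near (C * length Ω) (M * total (λ ω → F (ω ∙ s)) Ω) (M * total F Ω)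

  -- Amenability in functional form: for functions bounded by C, right translation changes the
  -- average over Ω by at most C/M.
  Følner : Set (c ⊔ ℓ)
  Følner = ∀ ss M → Σ (List Carrier) λ Ω → 0 < length Ω × AlmostInvariant Ω ss M

  -- Generation tested on invariant functions is what the level rule calls for; it spares words and
  -- the inverses of generators.
  Generates : List Carrier → Set (Level.suc 0ℓ ⊔ c ⊔ ℓ)
  Generates S = ∀ {A : Set} (f : Carrier → A) → (∀ {x y} → x ≈ y → f x ≡ f y) → (∀ {s} → s ∈ S → ∀ g → f (g ∙ s) ≡ f g) → ∀ g x → f (g ∙ x) ≡ f g

  module _ (trivial : ∀ x → x ≈ ε) where
    trivial-følner : Følner
    trivial-følner ss M = ε ∷ [] , s≤s z≤n , λ C F F-cong F≤ {s} _ →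
      near-mono z≤n (near-subst ≡.refl ≡.refl (cong (λ z → M * (z + 0)) (F-cong (trivial (ε ∙ s)))) near-refl)

    trivial-generates : Generates []
    trivial-generates f f-cong _ g x = f-cong (trans (trivial _) (sym (trivial g)))

record Ext {c′ ℓ′ c ℓ : Level} (Λ : Group c′ ℓ′) (Γ : Group c ℓ) : Set (c ⊔ ℓ ⊔ c′ ⊔ ℓ′) where
  private
    module Λ = Group Λ
  open Group Γ
  open GroupLemmas Γ
  open SetoidReasoning setoid
  field
    ι      : Λ.Carrier → Carrier
    ι-cong : ∀ {x y} → x Λ.≈ y → ι x ≈ ι y
    ι-∙    : ∀ x y → ι (x Λ.∙ y) ≈ ι x ∙ ι y
    ι-⁻¹   : ∀ x → ι (x Λ.⁻¹) ≈ ι x ⁻¹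
    ι-inj  : ∀ {x y} → ι x ≈ ι y → x Λ.≈ y
    θ      : Carrier → ℤ
    θ-cong : ∀ {x y} → x ≈ y → θ x ≡ θ y
    θ-∙    : ∀ x y → θ (x ∙ y) ≡ θ x ℤ.+ θ y
    t      : Carrier
    θt≡1   : θ t ≡ 1ℤ
    θι≡0   : ∀ x → θ (ι x) ≡ 0ℤ
    pull   : ∀ x → θ x ≡ 0ℤ → Σ Λ.Carrier λ y → ι y ≈ x

  θ-ε : θ ε ≡ 0ℤ
  θ-ε = ℤ-+-cancelˡ (θ ε) (≡.trans (≡.sym (θ-∙ ε ε)) (≡.trans (θ-cong (identityˡ ε)) (≡.sym (ℤₚ.+-identityʳ (θ ε)))))

  θ-⁻¹ : ∀ x → θ (x ⁻¹) ≡ ℤ.- θ x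
  θ-⁻¹ x = ℤ-+-cancelˡ (θ x) (≡.trans (≡.sym (θ-∙ x (x ⁻¹))) (≡.trans (θ-cong (inverseʳ x)) (≡.trans θ-ε (≡.sym (ℤₚ.+-inverseʳ (θ x))))))

  θ-tⁿ : ∀ n → θ (t ^ⁿ n) ≡ + n
  θ-tⁿ zero    = θ-ε
  θ-tⁿ (suc n) = ≡.trans (θ-∙ t _) (cong₂ ℤ._+_ θt≡1 (θ-tⁿ n))

  θ-t : ∀ j → θ (t ^ᶻ j) ≡ j
  θ-t (+ n)    = θ-tⁿ n
  θ-t -[1+ n ] = ≡.trans (θ-cong (^ⁿ-⁻¹ t (suc n))) (≡.trans (θ-⁻¹ _) (cong ℤ.-_ (θ-tⁿ (suc n))))

  kernelPart : ∀ g j → θ g ≡ j → Σ Λ.Carrier λ y → ι y ≈ (t ^ᶻ j) ⁻¹ ∙ g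
  kernelPart g j eq = pull _ (≡.trans (θ-∙ _ g) (≡.trans (cong₂ ℤ._+_ (≡.trans (θ-⁻¹ _) (cong ℤ.-_ (θ-t j))) eq) (ℤₚ.+-inverseˡ j)))

  -- The power of `t` stands on the left, so that right multiplication by `ι x` acts on `ρ` by right
  -- multiplication.
  ρ : Carrier → Λ.Carrier
  ρ g = proj₁ (kernelPart g (θ g) ≡.refl)

  ι-ρ : ∀ g → ι (ρ g) ≈ (t ^ᶻ θ g) ⁻¹ ∙ g
  ι-ρ g = proj₂ (kernelPart g (θ g) ≡.refl)

  decompose : ∀ g → g ≈ t ^ᶻ θ g ∙ ι (ρ g)
  decompose g = trans (solve 2 (λ a g → g ⊜ a ⊙ (inv a ⊙ g)) refl (t ^ᶻ θ g) g) (∙-congˡ (sym (ι-ρ g)))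

  ρ-cong : ∀ {g h} → g ≈ h → ρ g Λ.≈ ρ h
  ρ-cong {g} {h} eq = ι-inj (trans (ι-ρ g) (trans (∙-cong (⁻¹-cong (reflexive (cong (t ^ᶻ_) (θ-cong eq)))) eq) (sym (ι-ρ h))))

  θ-ι : ∀ g x → θ (g ∙ ι x) ≡ θ g
  θ-ι g x = ≡.trans (θ-∙ g (ι x)) (≡.trans (cong (λ z → θ g ℤ.+ z) (θι≡0 x)) (ℤₚ.+-identityʳ (θ g)))

  ρ-ι : ∀ g x → ρ (g ∙ ι x) Λ.≈ ρ g Λ.∙ x
  ρ-ι g x = ι-inj (begin
    ι (ρ (g ∙ ι x))                         ≈⟨ ι-ρ (g ∙ ι x) ⟩
    (t ^ᶻ θ (g ∙ ι x)) ⁻¹ ∙ (g ∙ ι x)       ≡⟨ cong (λ j → (t ^ᶻ j) ⁻¹ ∙ (g ∙ ι x)) (θ-ι g x) ⟩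
    (t ^ᶻ θ g) ⁻¹ ∙ (g ∙ ι x)               ≈⟨ assoc _ _ _ ⟨
    ((t ^ᶻ θ g) ⁻¹ ∙ g) ∙ ι x               ≈⟨ ∙-congʳ (ι-ρ g) ⟨
    ι (ρ g) ∙ ι x                           ≈⟨ ι-∙ (ρ g) x ⟨
    ι (ρ g Λ.∙ x)                           ∎)

  conjugate : Λ.Carrier → Carrier → Λ.Carrier
  conjugate x g = proj₁ (pull (ι x ^ᶜ g) (≡.trans (θ-∙ _ g) (≡.trans (cong (ℤ._+ θ g) (θ-ι (g ⁻¹) x)) (≡.trans (cong (ℤ._+ θ g) (θ-⁻¹ g)) (ℤₚ.+-inverseˡ (θ g))))))

  ι-conjugate : ∀ x g → ι (conjugate x g) ≈ ι x ^ᶜ g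
  ι-conjugate x g = proj₂ (pull (ι x ^ᶜ g) (≡.trans (θ-∙ _ g) (≡.trans (cong (ℤ._+ θ g) (θ-ι (g ⁻¹) x)) (≡.trans (cong (ℤ._+ θ g) (θ-⁻¹ g)) (ℤₚ.+-inverseˡ (θ g))))))

  generates : ∀ {S} → Generates Λ S → Generates Γ (t ∷ map ι S)
  generates {S} gen f f-cong inv-S g x =
    ≡.trans (f-cong (trans (∙-congˡ (decompose x)) (sym (assoc _ _ _)))) (≡.trans (by-ι (g ∙ t ^ᶻ θ x) (ρ x)) (by-t (θ x) g))
    where
    by-ι : ∀ g y → f (g ∙ ι y) ≡ f g
    by-ι g y = ≡.trans (f-cong (∙-congˡ (ι-cong (Λ.sym (Λ.identityˡ y)))))
      (≡.trans (gen (λ z → f (g ∙ ι z)) (λ eq → f-cong (∙-congˡ (ι-cong eq)))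
          (λ {s} s∈ z → ≡.trans (f-cong (trans (∙-congˡ (ι-∙ z s)) (sym (assoc _ _ _)))) (inv-S (there (∈ₚ.∈-map⁺ ι s∈)) (g ∙ ι z))) Λ.ε y)
        (f-cong (trans (∙-congˡ (trans (ι-cong (Λ.sym (Λ.inverseʳ Λ.ε))) (trans (ι-∙ _ _) (trans (∙-congˡ (ι-⁻¹ _)) (inverseʳ _))))) (identityʳ g))))
    by-tⁿ : ∀ s → (∀ g → f (g ∙ s) ≡ f g) → ∀ n g → f (g ∙ s ^ⁿ n) ≡ f g
    by-tⁿ s h zero    g = f-cong (identityʳ g)
    by-tⁿ s h (suc n) g = ≡.trans (f-cong (sym (assoc _ _ _))) (≡.trans (by-tⁿ s h n (g ∙ s)) (h g))
    by-t⁻¹ : ∀ g → f (g ∙ t ⁻¹) ≡ f g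
    by-t⁻¹ g = ≡.trans (≡.sym (inv-S (here ≡.refl) (g ∙ t ⁻¹))) (f-cong (solve 2 (λ g t → (g ⊙ inv t) ⊙ t ⊜ g) refl g t))
    by-t : ∀ j g → f (g ∙ t ^ᶻ j) ≡ f g
    by-t (+ n)    = by-tⁿ t (inv-S (here ≡.refl)) n
    by-t -[1+ n ] = by-tⁿ (t ⁻¹) by-t⁻¹ (suc n)

  module _ (føl : Følner Λ) where
    private
      -- With this y, ι ω tⁱ s = ι (ω y) t^(i + θ s): right multiplication by s shifts the layers
      -- and translates each of them inside Λ.
      skew : ∀ (s : Carrier) (i : ℕ) → Σ Λ.Carrier λ y → ι y ≈ (t ^ⁿ i ∙ s) ∙ (t ^ᶻ (+ i ℤ.+ θ s)) ⁻¹
      skew s i = pull _ (≡.trans (θ-∙ _ _) (≡.trans (cong₂ ℤ._+_ (≡.trans (θ-∙ _ s) (cong (ℤ._+ θ s) (θ-tⁿ i))) (≡.trans (θ-⁻¹ _) (cong ℤ.-_ (θ-t (+ i ℤ.+ θ s))))) (ℤₚ.+-inverseʳ (+ i ℤ.+ θ s))))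

      layers : List Λ.Carrier → ℕ → List Carrier
      layers Ω zero    = []
      layers Ω (suc n) = map (λ ω → ι ω ∙ t ^ⁿ n) Ω ++ layers Ω n

      length-layers : ∀ Ω n → length (layers Ω n) ≡ n * length Ω
      length-layers Ω zero    = ≡.refl
      length-layers Ω (suc n) = ≡.trans (Data.List.Properties.length-++ (map _ Ω)) (cong₂ _+_ (Data.List.Properties.length-map _ Ω) (length-layers Ω n))

      total-layers : ∀ (F : Carrier → ℕ) Ω n → total F (layers Ω n) ≡ sumTo n (λ i → total (λ ω → F (ι ω ∙ t ^ⁿ i)) Ω)
      total-layers F Ω zero    = ≡.refl
      total-layers F Ω (suc n) = ≡.trans (total-++ F (map _ Ω) _) (cong₂ _+_ (total-map F _ Ω) (total-layers F Ω n))

      degrees : List Carrier → ℕ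
      degrees []       = 0
      degrees (s ∷ ss) = ℤ.∣ θ s ∣ + degrees ss

      degree≤ : ∀ {s ss} → s ∈ ss → ℤ.∣ θ s ∣ ≤ degrees ss
      degree≤ (here ≡.refl) = ℕₚ.m≤m+n _ _
      degree≤ {ss = s ∷ ss} (there s∈) = ℕₚ.≤-trans (degree≤ s∈) (ℕₚ.m≤n+m _ ℤ.∣ θ s ∣)

      skews : List Carrier → ℕ → List Λ.Carrier
      skews ss n = concatMap (λ s → map (λ i → proj₁ (skew s i)) (upTo n)) ss

      ∈-skews : ∀ {s ss i n} → s ∈ ss → i < n → proj₁ (skew s i) ∈ skews ss n
      ∈-skews s∈ i<n = Anyₚ.concatMap⁺ _ (Any.map (λ { ≡.refl → ∈ₚ.∈-map⁺ _ (∈ₚ.∈-upTo⁺ i<n) }) s∈)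

    følner : Følner Γ
    følner ss M =
      -- With precision 2M in Λ and at least 2M times |θ s| layers, translating inside the layers
      -- and shifting the layers each cost at most half of the permitted error.
      let n = suc (2 * M * degrees ss)
          Ω , pos , almost = føl (skews ss n) (2 * M)
      in layers Ω n ,
         ℕₚ.<-≤-trans pos (ℕₚ.≤-trans (ℕₚ.m≤m+n (length Ω) _) (ℕₚ.≤-reflexive (≡.sym (length-layers Ω n)))) ,
         λ C F F-cong F≤ {s} s∈ → estimate n Ω C F F-cong F≤ s (ℕₚ.≤-trans (ℕₚ.*-monoʳ-≤ (2 * M) (degree≤ s∈)) (ℕₚ.n≤1+n _))
           (λ i i<n G G-cong G≤ → almost C G G-cong G≤ (∈-skews s∈ i<n))
      where
      estimate : ∀ n Ω C F → (∀ {x y} → x ≈ y → F x ≡ F y) → (∀ x → F x ≤ C) → ∀ s → 2 * M * ℤ.∣ θ s ∣ ≤ n →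
        (∀ i → i < n → ∀ (G : Λ.Carrier → ℕ) → (∀ {x y} → x Λ.≈ y → G x ≡ G y) → (∀ x → G x ≤ C) → Near (C * length Ω) (2 * M * total (λ ω → G (ω Λ.∙ proj₁ (skew s i))) Ω) (2 * M * total G Ω)) →
        Near (C * length (layers Ω n)) (M * total (λ ω → F (ω ∙ s)) (layers Ω n)) (M * total F (layers Ω n))
      estimate n Ω C F F-cong F≤ s n≥ almost = near-/ 1 (near-subst ≡.refl
          (≡.trans (sumTo-* n (2 * M) _) (≡.trans (ℕₚ.*-assoc 2 M _) (cong (λ z → 2 * (M * z)) (≡.sym (≡.trans (total-layers (λ ω → F (ω ∙ s)) Ω n) (sumTo-cong n moved))))))
          (≡.trans (ℕₚ.*-assoc 2 M _) (cong (λ z → 2 * (M * z)) (≡.sym (total-layers F Ω n))))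
          (near-mono error (near-trans rows columns)))
        where
        B = C * length Ω
        h : ℤ → ℕ
        h i = total (λ ω → F (ι ω ∙ t ^ᶻ i)) Ω
        h≤B : ∀ i → h i ≤ B
        h≤B i = total-≤ _ C (λ ω → F≤ _) Ω
        row : ℕ → ℕ
        row i = total (λ ω → F (ι (ω Λ.∙ proj₁ (skew s i)) ∙ t ^ᶻ (+ i ℤ.+ θ s))) Ω
        moved : ∀ i → total (λ ω → F ((ι ω ∙ t ^ⁿ i) ∙ s)) Ω ≡ row i
        moved i = total-cong (λ ω → F-cong (sym (trans (∙-congʳ (trans (ι-∙ ω _) (∙-congˡ (proj₂ (skew s i)))))
          (solve 4 (λ w a s b → (w ⊙ ((a ⊙ s) ⊙ inv b)) ⊙ b ⊜ (w ⊙ a) ⊙ s) refl (ι ω) (t ^ⁿ i) s (t ^ᶻ (+ i ℤ.+ θ s)))))) Ω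
        rows : Near (n * B) (sumTo n (λ i → 2 * M * row i)) (2 * M * sumTo n (λ i → h (+ i ℤ.+ θ s)))
        rows = near-subst ≡.refl ≡.refl (sumTo-* n (2 * M) _)
          (sumTo-near n (λ i i<n → almost i i<n (λ ω → F (ι ω ∙ t ^ᶻ (+ i ℤ.+ θ s))) (λ eq → F-cong (∙-congʳ (ι-cong eq))) (λ ω → F≤ _)))
        columns : Near (2 * M * (ℤ.∣ θ s ∣ * B)) (2 * M * sumTo n (λ i → h (+ i ℤ.+ θ s))) (2 * M * sumTo n (λ i → h (+ i)))
        columns = near-* (2 * M) (sumTo-shift h B h≤B n (θ s))
        error : n * B + 2 * M * (ℤ.∣ θ s ∣ * B) ≤ 2 * (C * length (layers Ω n))
        error = ℕₚ.≤-trans (ℕₚ.+-monoʳ-≤ (n * B) (ℕₚ.≤-trans (ℕₚ.≤-reflexive (≡.sym (ℕₚ.*-assoc (2 * M) ℤ.∣ θ s ∣ B))) (ℕₚ.*-monoˡ-≤ B n≥)))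
          (ℕₚ.≤-reflexive (≡.trans (lem n C (length Ω)) (cong (λ z → 2 * (C * z)) (≡.sym (length-layers Ω n)))))
          where lem : ∀ n C l → n * (C * l) + n * (C * l) ≡ 2 * (C * (n * l))
                lem = ℕRing.solve-∀

-- Powers of an odd and of an even number

numers : (ℕ → Bool) → ℕ → ℕ
numers b zero    = 1
numers b (suc n) = numers b n * numer (b n)

numers-odd : ∀ b n → Σ ℕ λ k → numers b n ≡ suc (2 * k)
numers-odd b zero = 0 , ≡.refl
numers-odd b (suc n) with numers-odd b n | b n
... | k , eq | false = k , ≡.trans (ℕₚ.*-identityʳ _) eq
... | k , eq | true  = 3 * k + 1 , ≡.trans (cong (_* 3) eq) (lem k)
  where lem : ∀ k → suc (2 * k) * 3 ≡ suc (2 * (3 * k + 1))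
        lem = ℕRing.solve-∀

numers-positive : ∀ b n → 1 ≤ numers b n
numers-positive b n = let k , eq = numers-odd b n in ℕₚ.≤-trans (s≤s z≤n) (ℕₚ.≤-reflexive (≡.sym eq))

numers-periodic : ∀ b m → (∀ i → b (i + m) ≡ b i) → ∀ N → numers b (N * m) ≡ numers b m ^ N
numers-periodic b m periodic zero    = ≡.refl
numers-periodic b m periodic (suc N) = ≡.trans (cong (numers b) (ℕₚ.+-comm m (N * m)))
  (≡.trans (concat (N * m)) (≡.trans (ℕₚ.*-comm _ (numers b m)) (cong (λ z → numers b m * z) (numers-periodic b m periodic N))))
  where
  concat : ∀ n → numers b (n + m) ≡ numers b n * numers b m
  concat zero    = ≡.sym (ℕₚ.*-identityˡ _)
  concat (suc n) = ≡.trans (cong₂ _*_ (concat n) (cong numer (periodic n))) (lem (numers b n) (numers b m) (numer (b n)))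
    where lem : ∀ x y z → x * y * z ≡ x * z * y
          lem = ℕRing.solve-∀

-- Bernoulli's inequality for 1 + 1/P, cleared of denominators.
bernoulli : ∀ P N → P ^ N * (P + N) ≤ suc P ^ N * P
bernoulli P zero    = ℕₚ.≤-reflexive (lem P)
  where lem : ∀ P → 1 * (P + 0) ≡ 1 * P
        lem = ℕRing.solve-∀
bernoulli P (suc N) = ℕₚ.≤-trans (ℕₚ.≤-trans (ℕₚ.m≤m+n _ (P ^ N * N)) (ℕₚ.≤-reflexive (lem P N (P ^ N))))
  (ℕₚ.≤-trans (ℕₚ.*-monoʳ-≤ (suc P) (bernoulli P N)) (ℕₚ.≤-reflexive (≡.sym (ℕₚ.*-assoc (suc P) (suc P ^ N) P))))
  where lem : ∀ P N X → P * X * (P + suc N) + X * N ≡ suc P * (X * (P + N))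
        lem = ℕRing.solve-∀

-- Q/P is at least 1 + 1/P, so its power with exponent P K is at least 1 + K.
outgrows : ∀ P Q K → 1 ≤ P → P < Q → suc K * P ^ (P * K) ≤ Q ^ (P * K)
outgrows P@(suc _) Q K _ P<Q = ℕₚ.≤-trans (ℕₚ.*-cancelʳ-≤ _ _ P (ℕₚ.≤-trans (ℕₚ.≤-reflexive (lem K P (P ^ (P * K)))) (bernoulli P (P * K)))) (ℕₚ.^-monoˡ-≤ (P * K) P<Q)
  where lem : ∀ K P X → suc K * X * P ≡ X * (P + P * K)
        lem = ℕRing.solve-∀

-- A ratio p/q of at least 2 + H exceeds what sums between l and H l, with an error of l, can
-- compensate.
not-comparable : ∀ {p q x y l H} → 1 ≤ q → 0 < l → (2 + H) * q ≤ p → l ≤ x → y ≤ H * l → ¬ p * x ≤ q * y + l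
not-comparable {p} {q} {x} {y} {l} {H} 1≤q 0<l big l≤x y≤ le = ℕₚ.<⇒≱ strict (ℕₚ.≤-trans (ℕₚ.*-monoʳ-≤ p l≤x) (ℕₚ.≤-trans le (ℕₚ.+-monoˡ-≤ l (ℕₚ.*-monoʳ-≤ q y≤))))
  where
  strict : q * (H * l) + l < p * l
  strict = ℕₚ.<-≤-trans (ℕₚ.+-monoʳ-< (q * (H * l)) (ℕₚ.<-≤-trans (ℕₚ.m<m+n l 0<l) (ℕₚ.≤-trans (ℕₚ.≤-reflexive (≡.sym (ℕₚ.*-identityˡ (l + l)))) (ℕₚ.*-monoˡ-≤ (l + l) 1≤q))))
    (ℕₚ.≤-trans (ℕₚ.≤-reflexive (lem q H l)) (ℕₚ.*-monoˡ-≤ l big))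
    where lem : ∀ q H l → q * (H * l) + q * (l + l) ≡ (2 + H) * q * l
          lem = ℕRing.solve-∀

-- Each new layer doubles the old error and adds its own, weighted by the product of the numerators
-- so far.
errors : (ℕ → Bool) → ℕ → ℕ
errors b zero    = 0
errors b (suc n) = numers b n + 2 * errors b n

-- Kari's construction over an extension by ℤ

module Kari {c′ ℓ′ c ℓ : Level} {Λ : Group c′ ℓ′} {Γ : Group c ℓ} (ext : Ext Λ Γ)
            (S : List (Group.Carrier Λ)) (gen : Generates Λ S) (føl : Følner Λ)
            (height : Group.Carrier Λ → ℤ) (height-cong : ∀ {x y} → Group._≈_ Λ x y → height x ≡ height y)
            (height-∙ : ∀ x y → height (Group._∙_ Λ x y) ≡ height x ℤ.+ height y)
            (w : Group.Carrier Λ) (a₁ : ℕ) (height-w : height w ≡ + suc a₁)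
            (height-wᵗ : height (Ext.conjugate ext w (Ext.t ext)) ≡ + suc a₁) where
  private
    module Λ = Group Λ
  open Group Γ
  open GroupLemmas Γ
  open SFT Γ
  open Ext ext

  private
    a H : ℕ
    a = suc a₁
    H = 3 * a

    Letter : Set
    Letter = Fin H × Bool × Fin 6

    density carried : Letter → ℕ
    density (i , _ , _) = suc (toℕ i)
    carried (_ , _ , k) = toℕ k

    level : Letter → Bool
    level (_ , b , _) = b

    -- Both carries belong to one coset, at g and at g w, so they nearly cancel when summed over a
    -- set almost invariant under w. What remains compares the densities of two neighbouring cosets.
    flowRule : Rule Letter
    flowRule = rule t (ι w) λ x y z → ⌊ numer (level x) * density y + carried x ℕ.≟ 2 * density x + carried z ⌋

    levelRule : Λ.Carrier → Rule Letter
    levelRule s = rule (ι s) ε λ x y _ → Finite.same finiteBool (level x) (level y)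

    point : Carrier → Letter
    point g = densityℤ a₁ (θ g) (height (ρ g)) , branchℤ a₁ (θ g) , flow a₁ (θ g) (height (ρ g)) (height (ρ (g ∙ t)))

    point-cong : Congruent point
    point-cong {g} {h} eq = cong₃ (θ-cong eq) (height-cong (ρ-cong eq)) (height-cong (ρ-cong (∙-congʳ eq)))
      where
      cong₃ : ∀ {i i′ j j′ k k′} → i ≡ i′ → j ≡ j′ → k ≡ k′ → (densityℤ a₁ i j , branchℤ a₁ i , flow a₁ i j k) ≡ (densityℤ a₁ i′ j′ , branchℤ a₁ i′ , flow a₁ i′ j′ k′)
      cong₃ ≡.refl ≡.refl ≡.refl = ≡.refl

    θ-∙t : ∀ g → θ (g ∙ t) ≡ ℤ.suc (θ g)
    θ-∙t g = ≡.trans (θ-∙ g t) (≡.trans (cong (λ z → θ g ℤ.+ z) θt≡1) (ℤₚ.+-comm (θ g) 1ℤ))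

    height-∙w : ∀ g → height (ρ (g ∙ ι w)) ≡ height (ρ g) ℤ.+ + a
    height-∙w g = ≡.trans (height-cong (ρ-ι g w)) (≡.trans (height-∙ (ρ g) w) (cong (λ z → height (ρ g) ℤ.+ z) height-w))

    -- The step w at g is the step wᵗ at g t. As both have height `a`, the arguments j and j′ of the
    -- carry grow together, as `balance` demands.
    height-∙wt : ∀ g → height (ρ ((g ∙ ι w) ∙ t)) ≡ height (ρ (g ∙ t)) ℤ.+ + a
    height-∙wt g = ≡.trans
      (height-cong (ρ-cong (trans (solve 3 (λ g w t → (g ⊙ w) ⊙ t ⊜ (g ⊙ t) ⊙ ((inv t ⊙ w) ⊙ t)) refl g (ι w) t) (∙-congˡ (sym (ι-conjugate w t))))))
      (≡.trans (height-cong (ρ-ι (g ∙ t) _)) (≡.trans (height-∙ _ _) (cong (λ z → height (ρ (g ∙ t)) ℤ.+ z) height-wᵗ)))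

    flow-cong : ∀ {i i′ j j′ k k′} → i ≡ i′ → j ≡ j′ → k ≡ k′ → flow a₁ i j k ≡ flow a₁ i′ j′ k′
    flow-cong ≡.refl ≡.refl ≡.refl = ≡.refl

    point-flow : Obeys point flowRule
    point-flow g = fromWitness
      (≡.trans (cong (λ i → numer (branchℤ a₁ (θ g)) * suc (toℕ (densityℤ a₁ i (height (ρ (g ∙ t))))) + carried (point g)) (θ-∙t g))
      (≡.trans (balance a₁ (θ g) (height (ρ g)) (height (ρ (g ∙ t))))
               (cong (λ k → 2 * density (point g) + toℕ k) (flow-cong (≡.sym (θ-ι g w)) (≡.sym (height-∙w g)) (≡.sym (height-∙wt g))))))

    point-level : ∀ s → Obeys point (levelRule s)
    point-level s g = Finite.same-≡ finiteBool (cong (branchℤ a₁) (≡.sym (θ-ι g s)))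

    module _ (x : Carrier → Letter) (x-cong : Congruent x) (obeys-flow : Obeys x flowRule) (obeys-level : All (λ s → Obeys x (levelRule s)) S) where
      level-ι : ∀ g y → level (x (g ∙ ι y)) ≡ level (x g)
      level-ι g y = ≡.trans (cong level (x-cong (∙-congˡ (ι-cong (Λ.sym (Λ.identityˡ y))))))
        (≡.trans (gen (λ z → level (x (g ∙ ι z))) (λ eq → cong level (x-cong (∙-congˡ (ι-cong eq))))
            (λ {s} s∈ z → ≡.trans (cong level (x-cong (trans (∙-congˡ (ι-∙ z s)) (sym (assoc _ _ _))))) (≡.sym (Finite.≡-same finiteBool (All.lookup obeys-level s∈ (g ∙ ι z))))) Λ.ε y)
          (cong level (x-cong (trans (∙-congˡ (trans (ι-cong (Λ.sym (Λ.inverseʳ Λ.ε))) (trans (ι-∙ _ _) (trans (∙-congˡ (ι-⁻¹ _)) (inverseʳ _))))) (identityʳ g)))))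

      level-θ : ∀ {g h} → θ g ≡ θ h → level (x g) ≡ level (x h)
      level-θ {g} {h} eq =
        let y , ιy≈ = pull (g ⁻¹ ∙ h) (≡.trans (θ-∙ _ h) (≡.trans (cong₂ ℤ._+_ (θ-⁻¹ g) (≡.sym eq)) (ℤₚ.+-inverseˡ (θ g))))
        in ≡.trans (≡.sym (level-ι g y)) (cong level (x-cong (trans (∙-congˡ ιy≈) (solve 2 (λ g h → g ⊙ (inv g ⊙ h) ⊜ h) refl g h))))

      b : ℕ → Bool
      b n = level (x (t ^ⁿ n))

      densityAt : ℕ → Λ.Carrier → ℕ
      densityAt n ω = density (x (ι ω ∙ t ^ⁿ n))

      carriedAt : ℕ → Λ.Carrier → ℕ
      carriedAt n ω = carried (x (ι ω ∙ t ^ⁿ n))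

      carriedAt≤6 : ∀ n ω → carriedAt n ω ≤ 6
      carriedAt≤6 n ω = ℕₚ.<⇒≤ (Finₚ.toℕ<n (proj₂ (proj₂ (x (ι ω ∙ t ^ⁿ n)))))

      -- In Λ, the step w at ι ω tⁿ is right multiplication of ω by this conjugate. It varies with
      -- n, so one almost invariant set must serve N elements.
      wₙ : ℕ → Λ.Carrier
      wₙ n = conjugate w ((t ^ⁿ n) ⁻¹)

      flow-at : ∀ n ω → numer (b n) * densityAt (suc n) ω + carriedAt n ω ≡ 2 * densityAt n ω + carriedAt n (ω Λ.∙ wₙ n)
      flow-at n ω = ≡.trans (cong₂ (λ u v → numer u * density v + carriedAt n ω) (level-θ {t ^ⁿ n} {g} (≡.sym (≡.trans (θ-∙ _ _) (≡.trans (cong (ℤ._+ θ (t ^ⁿ n)) (θι≡0 ω)) (ℤₚ.+-identityˡ _)))))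
            (x-cong (trans (∙-congˡ (^ⁿ-comm t n)) (sym (assoc _ _ _)))))
        (≡.trans (toWitness (obeys-flow g))
        (cong (λ u → 2 * densityAt n ω + carried u) (x-cong (trans (solve 3 (λ o a w → (o ⊙ a) ⊙ w ⊜ (o ⊙ ((inv (inv a) ⊙ w) ⊙ inv a)) ⊙ a) refl (ι ω) (t ^ⁿ n) (ι w))
           (∙-congʳ (trans (∙-congˡ (sym (ι-conjugate w _))) (sym (ι-∙ ω _))))))))
        where g = ι ω ∙ t ^ⁿ n

      module _ (Ω : List Λ.Carrier) (M N : ℕ) (almost : AlmostInvariant Λ Ω (map wₙ (upTo N)) M) where
        δ : ℕ
        δ = 6 * length Ω

        Σd : ℕ → ℕ
        Σd n = total (densityAt n) Ω

        layer-step : ∀ n → n < N → Near δ (M * (numer (b n) * Σd (suc n))) (M * (2 * Σd n))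
        layer-step n n<N = near-balance balanced (almost 6 (carriedAt n) (λ eq → cong carried (x-cong (∙-congʳ (ι-cong eq)))) (carriedAt≤6 n) (∈ₚ.∈-map⁺ wₙ (∈ₚ.∈-upTo⁺ n<N)))
          where
          sums : numer (b n) * Σd (suc n) + total (carriedAt n) Ω ≡ 2 * Σd n + total (λ ω → carriedAt n (ω Λ.∙ wₙ n)) Ω
          sums = ≡.trans (cong (_+ total (carriedAt n) Ω) (≡.sym (total-* (numer (b n)) (densityAt (suc n)) Ω)))
            (≡.trans (≡.sym (total-+ _ _ Ω)) (≡.trans (total-cong (flow-at n) Ω)
            (≡.trans (total-+ _ _ Ω) (cong (_+ total (λ ω → carriedAt n (ω Λ.∙ wₙ n)) Ω) (total-* 2 (densityAt n) Ω)))))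
          balanced : M * (numer (b n) * Σd (suc n)) + M * total (carriedAt n) Ω ≡ M * (2 * Σd n) + M * total (λ ω → carriedAt n (ω Λ.∙ wₙ n)) Ω
          balanced = ≡.trans (≡.sym (ℕₚ.*-distribˡ-+ M _ _)) (≡.trans (cong (λ z → M * z) sums) (ℕₚ.*-distribˡ-+ M _ _))

        accumulated : ∀ n → n ≤ N → Near (errors b n * δ) (M * (numers b n * Σd n)) (M * (2 ^ n * Σd 0))
        accumulated zero    _   = near-refl
        accumulated (suc n) n<N = near-subst (lem₁ (numers b n) (errors b n) δ) (lem₂ (numers b n) M (numer (b n)) (Σd (suc n))) (lem₃ M (2 ^ n) (Σd 0))
          (near-trans (near-* (numers b n) (layer-step n n<N)) (near-subst ≡.refl (lem₄ M (numers b n) (Σd n)) ≡.refl (near-* 2 (accumulated n (ℕₚ.<⇒≤ n<N)))))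
          where
          lem₁ : ∀ p e d → p * d + 2 * (e * d) ≡ (p + 2 * e) * d
          lem₁ = ℕRing.solve-∀
          lem₂ : ∀ p M A s → p * (M * (A * s)) ≡ M * (p * A * s)
          lem₂ = ℕRing.solve-∀
          lem₃ : ∀ M q s → 2 * (M * (q * s)) ≡ M * (2 * q * s)
          lem₃ = ℕRing.solve-∀
          lem₄ : ∀ M p s → 2 * (M * (p * s)) ≡ p * (M * (2 * s))
          lem₄ = ℕRing.solve-∀

      comparable : ∀ N → Σ ℕ λ l → Σ ℕ λ s → Σ ℕ λ s′ → 0 < l × (l ≤ s × s ≤ H * l) × (l ≤ s′ × s′ ≤ H * l) × Near l (numers b N * s) (2 ^ N * s′)
      comparable N =
        -- The accumulated error is `errors b N * 6` per point of Ω; division by the larger M leaves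
        -- at most `length Ω` in all.
        let M = suc (errors b N * 6)
            Ω , pos , almost = føl (map wₙ (upTo N)) M
            bounds : ∀ n → length Ω ≤ total (densityAt n) Ω × total (densityAt n) Ω ≤ H * length Ω
            bounds n = length≤total _ (λ _ → s≤s z≤n) Ω , total-≤ _ H (λ ω → Finₚ.toℕ<n (proj₁ (x (ι ω ∙ t ^ⁿ n)))) Ω
        in length Ω , _ , _ , pos , bounds N , bounds 0 ,
           near-/ (errors b N * 6) (near-mono (ℕₚ.≤-trans (ℕₚ.≤-reflexive (≡.sym (ℕₚ.*-assoc (errors b N) 6 (length Ω)))) (ℕₚ.*-monoˡ-≤ (length Ω) (ℕₚ.n≤1+n (errors b N * 6))))
             (accumulated Ω M N almost N ℕₚ.≤-refl))

      -- Over a period the numerators multiply to an odd P, while Q = 2^(m+1) is even. So P and Q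
      -- differ, and the powers of the larger one outgrow the bounded ratio of the density sums.
      not-periodic : ∀ m → ¬ (∀ i → b (i + suc m) ≡ b i)
      not-periodic m periodic = compare (ℕₚ.<-cmp (numers b (suc m)) (2 ^ suc m))
        where
        open import Relation.Binary.Definitions using (Tri; tri<; tri≈; tri>)
        P = numers b (suc m)
        Q = 2 ^ suc m
        Q≥1 : 1 ≤ Q
        Q≥1 = ℕₚ.m^n>0 2 (suc m)
        powers : ∀ N → Σ ℕ λ l → Σ ℕ λ s → Σ ℕ λ s′ → 0 < l × (l ≤ s × s ≤ H * l) × (l ≤ s′ × s′ ≤ H * l) × Near l (P ^ N * s) (Q ^ N * s′)
        powers N = let l , s , s′ , pos , bs , bs′ , n = comparable (N * suc m)
                   in l , s , s′ , pos , bs , bs′ , near-subst ≡.refl (cong (_* s) (numers-periodic b (suc m) periodic N)) (cong (_* s′) (≡.trans (cong (2 ^_) (ℕₚ.*-comm N (suc m))) (≡.sym (ℕₚ.^-*-assoc 2 (suc m) N)))) n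
        compare : Tri (P < Q) (P ≡ Q) (Q < P) → ⊥
        compare (tri≈ _ P≡Q _) = let k , odd = numers-odd b (suc m) in ℕₚ.even≢odd (2 ^ m) k (≡.trans (≡.sym P≡Q) odd)
        -- `outgrows` at `suc H` yields the factor 2 + H that `not-comparable` requires.
        compare (tri< P<Q _ _) = let N = P * suc H ; l , s , s′ , pos , (_ , s≤) , (l≤ , _) , near _ q = powers N
          in not-comparable {Q ^ N} {P ^ N} {s′} {s} {l} {H} (pos-^ P N (numers-positive b (suc m))) pos (outgrows P Q (suc H) (numers-positive b (suc m)) P<Q) l≤ s≤ q
          where pos-^ : ∀ x n → 1 ≤ x → 1 ≤ x ^ n
                pos-^ x n 1≤x = ℕₚ.m^n>0 x {{ℕ.>-nonZero 1≤x}} n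
        compare (tri> _ _ Q<P) = let N = Q * suc H ; l , s , s′ , pos , (l≤ , _) , (_ , s≤) , near p _ = powers N
          in not-comparable {P ^ N} {Q ^ N} {s} {s′} {l} {H} (ℕₚ.m^n>0 Q {{ℕ.>-nonZero Q≥1}} N) pos (outgrows Q P (suc H) Q≥1 Q<P) l≤ s≤ p

      fixed⇒θ≡0 : ∀ {g} → Fixes g x → θ g ≡ 0ℤ
      fixed⇒θ≡0 {g} fix = by-degree (θ g) ≡.refl
        where
        by-degree : ∀ j → θ g ≡ j → θ g ≡ 0ℤ
        by-degree (+ zero)   eq = eq
        by-degree (+ suc m)  eq = ⊥-elim (not-periodic m λ i → ≡.sym (≡.trans (level-θ (≡.trans (θ-tⁿ i) (≡.sym (shifted i)))) (cong level (fix (t ^ⁿ (i + suc m))))))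
          where
          lem : ∀ i k → ℤ.- k ℤ.+ (i ℤ.+ k) ≡ i
          lem = ℤRing.solve-∀
          shifted : ∀ i → θ (g ⁻¹ ∙ t ^ⁿ (i + suc m)) ≡ + i
          shifted i = ≡.trans (θ-∙ _ _) (≡.trans (cong₂ ℤ._+_ (≡.trans (θ-⁻¹ g) (cong ℤ.-_ eq)) (θ-tⁿ (i + suc m))) (lem (+ i) (+ suc m)))
        by-degree -[1+ m ]   eq = ⊥-elim (not-periodic m λ i → ≡.trans (level-θ (≡.trans (θ-tⁿ (i + suc m)) (≡.sym (shifted i)))) (cong level (fix (t ^ⁿ i))))
          where
          shifted : ∀ i → θ (g ⁻¹ ∙ t ^ⁿ i) ≡ + (i + suc m)
          shifted i = ≡.trans (θ-∙ _ _) (≡.trans (cong₂ ℤ._+_ (≡.trans (θ-⁻¹ g) (cong ℤ.-_ eq)) (θ-tⁿ i)) (ℤₚ.+-comm (+ suc m) (+ i)))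

  kari : Kill (λ g → θ g ≢ 0ℤ)
  kari = record
    { A = Letter ; finite = finite× (finiteFin H) (finite× finiteBool (finiteFin 6))
    ; rules = flowRule ∷ map levelRule S
    ; point = point ; point-cong = point-cong
    ; point-ok = point-flow ∷ Allₚ.map⁺ (All.universal point-level S)
    ; kills = λ { x x-cong (ok-flow ∷ ok-level) θg≢0 fix → θg≢0 (fixed⇒θ≡0 x x-cong ok-flow (Allₚ.map⁻ ok-level) fix) }
    }

-- Aperiodicity for the quotient P/N

ℤ-group : Group 0ℓ 0ℓ
ℤ-group = AbelianGroup.group ℤₚ.+-0-abelianGroup

-- Viewing ℤ as an extension of the trivial group provides its Følner sets and its generator; ℤ is
-- the kernel Λ of the exchanged extension in Hirsch number 2.
ℤ-ext : Ext (Terminal.group {0ℓ} {0ℓ}) ℤ-group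
ℤ-ext = record
  { ι = λ _ → 0ℤ ; ι-cong = λ _ → ≡.refl ; ι-∙ = λ _ _ → ≡.refl ; ι-⁻¹ = λ _ → ≡.refl ; ι-inj = λ _ → _
  ; θ = id ; θ-cong = id ; θ-∙ = λ _ _ → ≡.refl ; t = 1ℤ ; θt≡1 = ≡.refl ; θι≡0 = λ _ → ≡.refl
  ; pull = λ x eq → _ , ≡.sym eq }

ℤ-følner : Følner ℤ-group
ℤ-følner = Ext.følner ℤ-ext (trivial-følner _ (λ _ → _))

ℤ-generates : Generates ℤ-group (1ℤ ∷ [])
ℤ-generates = Ext.generates ℤ-ext (trivial-generates _ (λ _ → _))

module Assembly {c ℓ p : Level} (G : Group c ℓ) where
  open Group G
  open GroupLemmas G
  open Subgroups {c} {ℓ} {p} G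
  open PolyZ {c} {ℓ} {p} G
  open Quotients {c} {ℓ} {p} G
  open Colouring {c} {ℓ} {p} G
  open SetoidReasoning setoid
  open SFT

  module _ (N : Sub) (torsion : ∀ {x} → mem N x → Σ ℕ λ r → x ^ⁿ suc r ≈ ε) where
    Normal : Sub → Set _
    Normal P = ∀ {x d} → mem N x → mem P d → mem N (x ^ᶜ d)

    -- N is torsion and ℤ is torsion-free; hence homomorphisms to ℤ descend to the quotient by N.
    vanishes : ∀ {K x} (f : Hom K) (x∈ : mem K x) → mem N x → fn f x x∈ ≡ 0ℤ
    vanishes {K} {x} f x∈ x∈N =
      let r , eq = torsion x∈N
      in case ℤₚ.i*j≡0⇒i≡0∨j≡0 (+ suc r) (≡.trans (≡.sym (fn-^ⁿ f (suc r) x∈ (mem-^ⁿ K (suc r) x∈))) (fn-ε f _ eq)) of λ { (inj₁ ()) ; (inj₂ e) → e }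

    hom-cong : ∀ {K x y} (f : Hom K) (x∈ : mem K x) (y∈ : mem K y) → mem N (x ⁻¹ ∙ y) → fn f x x∈ ≡ fn f y y∈
    hom-cong {K} {x} {y} f x∈ y∈ eq = ≡.sym
      (≡.trans (fn-cong f y∈ (∙∈ K x∈ q∈) (solve 2 (λ x y → y ⊜ x ⊙ (inv x ⊙ y)) refl x y))
      (≡.trans (fn-∙ f x∈ q∈ _) (≡.trans (cong (λ z → fn f x x∈ ℤ.+ z) (vanishes f q∈ eq)) (ℤₚ.+-identityʳ _))))
      where q∈ = ∙∈ K (⁻¹∈ K x∈) y∈

    module _ {n P} (e : Extension P (Poly N n)) (normal : Normal P) where
      open Extension e

      normalK : Normal K
      normalK x∈ d∈ = normal x∈ (K⊆P d∈)

      quotientExt : Ext (K / N by normalK) (P / N by normal)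
      quotientExt = record
        { ι = λ { (x , x∈) → x , K⊆P x∈ }
        ; ι-cong = id
        ; ι-∙ = λ _ _ → ≈-quotient N refl
        ; ι-⁻¹ = λ _ → ≈-quotient N refl
        ; ι-inj = id
        ; θ = λ { (x , x∈) → fn θ x x∈ }
        ; θ-cong = λ { {x , x∈} {y , y∈} → hom-cong θ x∈ y∈ }
        ; θ-∙ = λ { (x , x∈) (y , y∈) → fn-∙ θ x∈ y∈ _ }
        ; t = t , t∈
        ; θt≡1 = θt≡1
        ; θι≡0 = λ { (x , x∈) → K⇒0 x∈ _ }
        ; pull = λ { (x , x∈) eq → (x , 0⇒K x∈ eq) , ≈-quotient N refl }
        }

    poly-følner : ∀ {n P} (poly : Poly N n P) (normal : Normal P) → Følner (P / N by normal)
    poly-følner {P = P} (base P⊆N N⊆P) normal = trivial-følner (P / N by normal) λ { (x , x∈) → P⊆N (∙∈ P (⁻¹∈ P x∈) (ε∈ P)) }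
    poly-følner (extend e _) normal = Ext.følner (quotientExt e normal) (poly-følner (Extension.rest e) (normalK e normal))

    poly-generates : ∀ {n P} (poly : Poly N n P) (normal : Normal P) → Σ (List (Σ Carrier (mem P))) (Generates (P / N by normal))
    poly-generates {P = P} (base P⊆N N⊆P) normal = [] , trivial-generates (P / N by normal) λ { (x , x∈) → P⊆N (∙∈ P (⁻¹∈ P x∈) (ε∈ P)) }
    poly-generates (extend e _) normal = _ , Ext.generates (quotientExt e normal) (proj₂ (poly-generates (Extension.rest e) (normalK e normal)))

    kill-outside-K : ∀ {n P} (e : Extension P (Poly N n)) (d : Direction (Extension.K e) (Extension.t e)) (normal : Normal P) →
      Kill (P / N by normal) (λ x → Ext.θ (quotientExt e normal) x ≢ 0ℤ)
    kill-outside-K e d normal = Kari.kari (quotientExt e normal) _ (proj₂ (poly-generates rest (normalK e normal))) (poly-følner rest (normalK e normal))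
      (λ { (x , x∈) → fn ℓ₀ x x∈ }) (λ { {x , x∈} {y , y∈} → hom-cong ℓ₀ x∈ y∈ }) (λ { (x , x∈) (y , y∈) → fn-∙ ℓ₀ x∈ y∈ _ })
      (w , w∈) a ℓw (≡.trans (fn-irr ℓ₀ _ _) ℓwᵗ)
      where
      open Extension e
      open Direction d

    -- When P/N is generated by t and the infinite cyclic K/N = ⟨z⟩, the direction forces t and z to
    -- commute modulo N, so that z may play the role of t.
    module _ {P} (e : Extension P (Poly N 1)) (d : Direction (Extension.K e) (Extension.t e)) (normal : Normal P)
             (e′ : Extension (Extension.K e) (Poly N 0)) where
      open Extension e using (K; K⊆P; θ; t; t∈; θt≡1; K⇒0; 0⇒K; K-normal)
      open Direction d
      private
        module E = Extension e′
        z = E.t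
        z∈ = E.t∈
        θ₂ = E.θ

        K₂⊆N : ∀ {x} → mem E.K x → mem N x
        K₂⊆N with E.rest
        ... | base K₂⊆N _ = K₂⊆N

        -- K/N is infinite cyclic on `z`, so a homomorphism is determined by its value there.
        proportional : ∀ (f : Hom K) {x} (x∈ : mem K x) → fn f x x∈ ≡ fn θ₂ x x∈ ℤ.* fn f z z∈
        proportional f {x} x∈ = ≡.trans (≡.sym (hom-cong f zj∈ x∈ (K₂⊆N (E.0⇒K (∙∈ K (⁻¹∈ K zj∈) x∈) degree0)))) (fn-^ᶻ f j z∈ zj∈)
          where
          j = fn θ₂ x x∈
          zj∈ = mem-^ᶻ K j z∈
          degree0 : fn θ₂ ((z ^ᶻ j) ⁻¹ ∙ x) (∙∈ K (⁻¹∈ K zj∈) x∈) ≡ 0ℤ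
          degree0 = ≡.trans (fn-∙ θ₂ (⁻¹∈ K zj∈) x∈ _) (≡.trans (cong (ℤ._+ j) (≡.trans (fn-⁻¹ θ₂ zj∈ _) (cong ℤ.-_ (≡.trans (fn-^ᶻ θ₂ j z∈ zj∈) (≡.trans (cong (λ u → j ℤ.* u) E.θt≡1) (ℤₚ.*-identityʳ j)))))) (ℤₚ.+-inverseˡ j))

        twisted : ∀ {d} → mem P d → Hom K
        twisted {d} d∈ = record
          { fn = λ x x∈ → fn θ₂ (x ^ᶜ d) (K-normal x∈ d∈)
          ; fn-cong = λ _ _ eq → fn-cong θ₂ _ _ (^ᶜ-cong d eq)
          ; fn-∙ = λ {x} {y} x∈ y∈ _ → ≡.trans (fn-cong θ₂ _ (∙∈ K (K-normal x∈ d∈) (K-normal y∈ d∈)) (^ᶜ-∙ x y d)) (fn-∙ θ₂ _ _ _) }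

        nonzero-cancel : ∀ i k {a} → i ℤ.* k ≡ + suc a → i ≢ 0ℤ × k ≢ 0ℤ
        nonzero-cancel i k eq = (λ { ≡.refl → case ≡.trans (≡.sym (ℤₚ.*-zeroˡ k)) eq of λ () }) , (λ { ≡.refl → case ≡.trans (≡.sym (ℤₚ.*-zeroʳ i)) eq of λ () })

        -- Both `ℓ₀` and the conjugate of `θ₂` by t are multiples of `θ₂`. The first shows that w
        -- and wᵗ have the same nonzero value under `θ₂`, and the second then forces the value 1 at
        -- zᵗ.
        fixes-z : fn θ₂ (z ^ᶜ t) (K-normal z∈ t∈) ≡ 1ℤ
        fixes-z = ℤ-*-cancelʳ (fn θ₂ (z ^ᶜ t) (K-normal z∈ t∈)) 1ℤ i (proj₁ nonzero)
          (≡.trans (ℤₚ.*-comm _ i) (≡.trans (≡.sym (proportional (twisted t∈) w∈)) (≡.trans same-degree (≡.sym (ℤₚ.*-identityˡ i)))))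
          where
          i = fn θ₂ w w∈
          k = fn ℓ₀ z z∈
          nonzero = nonzero-cancel i k (≡.trans (≡.sym (proportional ℓ₀ w∈)) ℓw)
          same-degree : fn θ₂ (w ^ᶜ t) (K-normal w∈ t∈) ≡ i
          same-degree = ℤ-*-cancelʳ _ i k (proj₂ nonzero)
            (≡.trans (≡.sym (proportional ℓ₀ (K-normal w∈ t∈))) (≡.trans (≡.trans (fn-irr ℓ₀ _ _) ℓwᵗ) (≡.trans (≡.sym ℓw) (proportional ℓ₀ w∈))))

        invariant-t : ∀ {x} (x∈ : mem K x) q → fn θ₂ (x ^ᶜ t) q ≡ fn θ₂ x x∈
        invariant-t {x} x∈ q = ≡.trans (fn-irr θ₂ _ _) (≡.trans (proportional (twisted t∈) x∈) (≡.trans (cong (λ u → fn θ₂ x x∈ ℤ.* u) fixes-z) (ℤₚ.*-identityʳ _)))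

        Invariant : Carrier → Set _
        Invariant d = ∀ {x} (x∈ : mem K x) q → fn θ₂ (x ^ᶜ d) q ≡ fn θ₂ x x∈

        invariant-ⁿ : ∀ {s} → mem P s → Invariant s → ∀ n → Invariant (s ^ⁿ n)
        invariant-ⁿ s∈ h zero    {x} x∈ q = fn-cong θ₂ _ _ (^ᶜ-by-ε x)
        invariant-ⁿ {s} s∈ h (suc n) {x} x∈ q =
          ≡.trans (fn-cong θ₂ q (resp K (sym (^ᶜ-^ᶜ x s (s ^ⁿ n))) q) (sym (^ᶜ-^ᶜ x s (s ^ⁿ n))))
          (≡.trans (invariant-ⁿ s∈ h n (K-normal x∈ s∈) _) (h x∈ _))

        invariant : ∀ j → Invariant (t ^ᶻ j)
        invariant (+ n)    = invariant-ⁿ t∈ invariant-t n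
        invariant -[1+ n ] = invariant-ⁿ (⁻¹∈ P t∈) (λ {x} x∈ q → ≡.trans (≡.sym (invariant-t q (K-normal q t∈))) (fn-cong θ₂ _ _ (^ᶜ-cancel x t))) (suc n)

        θt^ : ∀ j q → fn θ (t ^ᶻ j) q ≡ j
        θt^ j q = ≡.trans (fn-^ᶻ θ j t∈ q) (≡.trans (cong (λ u → j ℤ.* u) θt≡1) (ℤₚ.*-identityʳ j))

        part∈ : ∀ {x} j (x∈ : mem P x) → fn θ x x∈ ≡ j → mem K ((t ^ᶻ j) ⁻¹ ∙ x)
        part∈ j x∈ eq = 0⇒K (∙∈ P (⁻¹∈ P (mem-^ᶻ P j t∈)) x∈)
          (≡.trans (fn-∙ θ (⁻¹∈ P (mem-^ᶻ P j t∈)) x∈ _) (≡.trans (cong₂ ℤ._+_ (≡.trans (fn-⁻¹ θ (mem-^ᶻ P j t∈) _) (cong ℤ.-_ (θt^ j _))) eq) (ℤₚ.+-inverseˡ j)))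

        -- The exponent of z in the normal form tⁱ zʲ modulo N; it is additive because conjugation
        -- by t preserves `θ₂`.
        degree₂ : ∀ {x} → mem P x → ℤ
        degree₂ {x} x∈ = fn θ₂ ((t ^ᶻ fn θ x x∈) ⁻¹ ∙ x) (part∈ _ x∈ ≡.refl)

        degree₂-at : ∀ {x} (x∈ : mem P x) j (q : mem K ((t ^ᶻ j) ⁻¹ ∙ x)) → fn θ x x∈ ≡ j → degree₂ x∈ ≡ fn θ₂ ((t ^ᶻ j) ⁻¹ ∙ x) q
        degree₂-at x∈ j q ≡.refl = fn-irr θ₂ _ _

        degree₂-K : ∀ {x} (x∈ : mem P x) (k∈ : mem K x) → degree₂ x∈ ≡ fn θ₂ x k∈
        degree₂-K {x} x∈ k∈ = ≡.trans (degree₂-at x∈ 0ℤ (part∈ 0ℤ x∈ (K⇒0 k∈ x∈)) (K⇒0 k∈ x∈)) (fn-cong θ₂ _ k∈ (solve 1 (λ x → inv e₀ ⊙ x ⊜ x) refl x))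

      swappedExt : Ext ℤ-group (P / N by normal)
      swappedExt = record
        { ι = λ j → t ^ᶻ j , mem-^ᶻ P j t∈
        ; ι-cong = λ { ≡.refl → ≈-quotient N refl }
        ; ι-∙ = λ i j → ≈-quotient N (sym (^ᶻ-+ t i j))
        ; ι-⁻¹ = λ i → ≈-quotient N (sym (^ᶻ-neg t i))
        ; ι-inj = λ {i} {j} eq → ≡.trans (≡.sym (θt^ i (mem-^ᶻ P i t∈))) (≡.trans (hom-cong θ (mem-^ᶻ P i t∈) (mem-^ᶻ P j t∈) eq) (θt^ j (mem-^ᶻ P j t∈)))
        ; θ = λ x → degree₂ (proj₂ x)
        ; θ-cong = λ { {x , x∈} {y , y∈} eq → θ₂-cong x∈ y∈ eq }
        ; θ-∙ = λ { (x , x∈) (y , y∈) → θ₂-∙ x∈ y∈ }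
        ; t = z , K⊆P z∈
        ; θt≡1 = ≡.trans (degree₂-K (K⊆P z∈) z∈) E.θt≡1
        ; θι≡0 = λ j → ≡.trans (degree₂-at (mem-^ᶻ P j t∈) j (resp K (sym (inverseˡ _)) (ε∈ K)) (θt^ j _)) (fn-ε θ₂ _ (inverseˡ _))
        ; pull = λ { (x , x∈) eq → fn θ x x∈ , K₂⊆N (E.0⇒K (part∈ _ x∈ ≡.refl) eq) }
        }
        where
        θ₂-cong : ∀ {x y} (x∈ : mem P x) (y∈ : mem P y) → mem N (x ⁻¹ ∙ y) → degree₂ x∈ ≡ degree₂ y∈
        θ₂-cong {x} {y} x∈ y∈ eq = ≡.trans
          (hom-cong θ₂ (part∈ j x∈ ≡.refl) (part∈ j y∈ θy≡j) (resp N (solve 3 (λ a x y → inv x ⊙ y ⊜ inv (inv a ⊙ x) ⊙ (inv a ⊙ y)) refl (t ^ᶻ j) x y) eq))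
          (≡.sym (degree₂-at y∈ j _ θy≡j))
          where
          j = fn θ x x∈
          θy≡j : fn θ y y∈ ≡ j
          θy≡j = ≡.sym (hom-cong θ x∈ y∈ eq)
        θ₂-∙ : ∀ {x y} (x∈ : mem P x) (y∈ : mem P y) → degree₂ (∙∈ P x∈ y∈) ≡ degree₂ x∈ ℤ.+ degree₂ y∈
        θ₂-∙ {x} {y} x∈ y∈ =
          ≡.trans (degree₂-at (∙∈ P x∈ y∈) (i ℤ.+ j) (part∈ (i ℤ.+ j) (∙∈ P x∈ y∈) (fn-∙ θ x∈ y∈ _)) (fn-∙ θ x∈ y∈ _))
          (≡.trans (fn-cong θ₂ _ (∙∈ K x′∈ y′∈) (trans (∙-congʳ (⁻¹-cong (^ᶻ-+ t i j))) (solve 4 (λ a b x y → inv (a ⊙ b) ⊙ (x ⊙ y) ⊜ ((inv b ⊙ (inv a ⊙ x)) ⊙ b) ⊙ (inv b ⊙ y)) refl (t ^ᶻ i) (t ^ᶻ j) x y)))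
          (≡.trans (fn-∙ θ₂ x′∈ y′∈ _) (cong (ℤ._+ degree₂ y∈) (invariant j (part∈ i x∈ ≡.refl) x′∈))))
          where
          i = fn θ x x∈
          j = fn θ y y∈
          x′∈ = K-normal (part∈ i x∈ ≡.refl) (mem-^ᶻ P j t∈)
          y′∈ = part∈ j y∈ ≡.refl

      -- The densities now run along t: the step is t itself, of height 1, and conjugation by z
      -- preserves this height because heights are values of `θ`.
      kill-in-K : Kill (P / N by normal) (λ x → mem K (proj₁ x) × ¬ mem N (proj₁ x))
      kill-in-K = kill-⊆ _ (λ { {x , x∈} (k∈ , ∉N) eq → ∉N (K₂⊆N (E.0⇒K k∈ (≡.trans (≡.sym (degree₂-K x∈ k∈)) eq))) })
        (Kari.kari swappedExt _ ℤ-generates ℤ-følner id id (λ _ _ → ≡.refl) 1ℤ 0 ≡.refl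
          (≡.trans (fn-^ᶜ θ (mem-^ᶻ P 1ℤ t∈) (mem-^ᶜ P (mem-^ᶻ P 1ℤ t∈) (K⊆P z∈)) (K⊆P z∈)) (θt^ 1ℤ _)))

    kill-poly : ∀ n {P} → Poly N (2 + n) P → (normal : Normal P) → Kill (P / N by normal) (λ x → ¬ mem N (proj₁ x))
    kill-poly n {P} (extend e d) normal = kill-⊆ Γ split (kill-∪ Γ (kill-outside-K e d normal) (inside n e d))
      where
      open Extension e
      Γ = P / N by normal
      split : ∀ {x : Group.Carrier Γ} → ¬ mem N (proj₁ x) → (fn θ (proj₁ x) (proj₂ x) ≢ 0ℤ) ⊎ (mem K (proj₁ x) × ¬ mem N (proj₁ x))
      split {x , x∈} ∉N with fn θ x x∈ ℤ.≟ 0ℤ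
      ... | yes eq = inj₂ (0⇒K x∈ eq , ∉N)
      ... | no ≢0  = inj₁ ≢0
      inside : ∀ n (e : Extension P (Poly N (suc n))) (d : Direction (Extension.K e) (Extension.t e)) → Kill (P / N by normal) (λ x → mem (Extension.K e) (proj₁ x) × ¬ mem N (proj₁ x))
      inside zero e d with Extension.rest e
      ... | extend e′ _ = kill-in-K e d normal e′
      inside (suc n) e d = kill-⊆ Γ (λ { {x , x∈} (k∈ , ∉N) → (x , k∈) , ∉N , ≈-quotient N refl })
        (Transfer.transfer _ Γ retraction (kill-poly n (Extension.rest e) (normalK e normal)))
        where
        open Ext (quotientExt e normal) using (ρ; ρ-cong; ρ-ι) renaming (ι to ι′; ι-∙ to ι′-∙; ι-⁻¹ to ι′-⁻¹)
        retraction : Transfer.Retraction (Extension.K e / N by normalK e normal) Γ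
        retraction = record
          { ι = ι′ ; ι-∙ = ι′-∙ ; ι-⁻¹ = ι′-⁻¹ ; ν = Group.ε Γ ∷ []
          ; ι-cong = λ {x} {y} eq → here (resp N (solve 2 (λ x y → inv (inv x ⊙ y) ⊜ inv y ⊙ (x ⊙ e₀)) refl (proj₁ x) (proj₁ y)) (⁻¹∈ N eq))
          ; r = ρ ; r-cong = λ {x} {y} → ρ-cong {x} {y} ; r-ι = ρ-ι
          ; r-ν = (λ g → ρ-cong {Group._∙_ Γ g (Group.ε Γ)} {g} (Group.identityʳ Γ g)) ∷ [] }

-- From P/N back to G

module Main {c ℓ p : Level} (G : Group c ℓ) where
  open Group G
  open GroupLemmas G
  open Subgroups {c} {ℓ} {p} G
  open PolyZ {c} {ℓ} {p} G
  open Quotients {c} {ℓ} {p} G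
  open Colouring {c} {ℓ} {p} G
  open Assembly {c} {ℓ} {p} G
  open SFT

  -- Without infinite factors G itself is enumerated, so every stabiliser is finite and one letter
  -- suffices.
  aperiodic-of-finite : ∀ {D} → (∀ x → mem D x) → VS 0 D → AdmitsStronglyAperiodicSFT G
  aperiodic-of-finite total (fin L enum) = kill⇒aperiodic G (kill-∅ G) L (λ g → inj₂ (enum (total g)))

  module _ {n D} (total : ∀ x → mem D x) (S : List Carrier) (gen : ∀ {x} → mem D x → Gen D S x) (res : Resolution (2 + n) D) where
    open Resolution res

    private
      torsion : ∀ {x} → mem N x → Σ ℕ λ r → x ^ⁿ suc r ≈ ε
      torsion = enumerated⇒torsion {N} {N-list} N-enum

      normal : ∀ {x d} → mem N x → mem P d → mem N (x ^ᶜ d)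
      normal = N-normal {N} {N-list} N-enum poly

      Γ = P / N by normal

      N? : ∀ x → Dec (mem N x)
      N? x with P? x
      ... | yes x∈ = member? poly x∈
      ... | no ∉   = no (∉ ∘ N⊆P poly)

      -- The enumeration may list elements outside N, along which the pulled-back point need not be
      -- constant.
      ν : List Carrier
      ν = Data.List.filter N? N-list

      ν-enum : ∀ {x} → mem N x → Any (x ≈_) ν
      ν-enum x∈ = let l , l∈ , eq = find (N-enum x∈) in lose (∈ₚ.∈-filter⁺ N? l∈ (resp N eq x∈)) eq

      -- `colour` is invariant under left multiplication by P, whereas the retraction calls for
      -- invariance on the right; hence the inverse.
      index : Carrier → Fin (length reps)
      index g = colour D P total P? reps cover S gen (g ⁻¹)

      index-∙ : ∀ g {x} → mem P x → index (g ∙ x) ≡ index g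
      index-∙ g {x} x∈ = ≡.trans (colour-cong D P total P? reps cover S gen (solve 2 (λ g x → inv (g ⊙ x) ⊜ inv x ⊙ inv g) refl g x))
        (colour-invariant D P total P? reps cover S gen (g ⁻¹) (⁻¹∈ P x∈))

      retract : Carrier → Group.Carrier Γ
      retract g = lookup reps (index g) ⁻¹ ∙ g ,
        resp P (solve 2 (λ g l → inv (inv g ⊙ l) ⊜ inv l ⊙ g) refl g _) (⁻¹∈ P (colour-correct D P total P? reps cover S gen (g ⁻¹)))

      same-index : ∀ {g h y} → index g ≡ index h → lookup reps (index h) ⁻¹ ∙ g ≈ y → mem N (proj₁ (retract g) ⁻¹ ∙ y)
      same-index {g} eq e = ≈-quotient N (trans (sym e) (∙-congʳ (⁻¹-cong (reflexive (cong (lookup reps) (≡.sym eq))))))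

      retraction : Transfer.Retraction Γ G
      retraction = record
        { ι = proj₁ ; ι-∙ = λ _ _ → refl ; ι-⁻¹ = λ _ → refl ; ν = ν
        ; ι-cong = λ {x} {y} eq → Any.map (λ {n} e → trans (solve 2 (λ x y → y ⊜ x ⊙ (inv x ⊙ y)) refl (proj₁ x) (proj₁ y)) (∙-congˡ e)) (ν-enum eq)
        ; r = retract
        ; r-cong = λ {g} {h} eq → same-index {g} {h} (colour-cong D P total P? reps cover S gen (⁻¹-cong eq)) (∙-congˡ eq)
        ; r-ι = λ { g (x , x∈) → same-index {g ∙ x} {g} (index-∙ g x∈) (sym (assoc _ g x)) }
        ; r-ν = All.map (λ n∈ g → absorb g n∈) (Allₚ.all-filter N? N-list)
        }
        where
        absorb : ∀ g {n} → mem N n → mem N (proj₁ (retract (g ∙ n)) ⁻¹ ∙ proj₁ (retract g))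
        absorb g {n} n∈ = resp N eq (⁻¹∈ N n∈)
          where
          eq : n ⁻¹ ≈ proj₁ (retract (g ∙ n)) ⁻¹ ∙ proj₁ (retract g)
          eq = trans (solve 3 (λ l g n → inv n ⊜ inv (inv l ⊙ (g ⊙ n)) ⊙ (inv l ⊙ g)) refl (lookup reps (index g)) g n)
            (∙-congʳ (⁻¹-cong (∙-congʳ (⁻¹-cong (reflexive (cong (lookup reps) (≡.sym (index-∙ g (N⊆P poly n∈)))))))))

    aperiodic : AdmitsStronglyAperiodicSFT G
    aperiodic = kill⇒aperiodic G
      (kill-∪ G (colouring D P total P? reps cover S gen) (kill-^ᶜ G (Transfer.transfer Γ G retraction (kill-poly N torsion n poly normal))))
      (concatMap (λ l → map (λ n → (l ∙ n) ∙ l ⁻¹) N-list) reps) cases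
      where
      cases : ∀ g → _ ⊎ Any (g ≈_) (concatMap (λ l → map (λ n → (l ∙ n) ∙ l ⁻¹) N-list) reps)
      cases g with Any.any? (λ l → P? (g ^ᶜ l)) reps
      ... | no ∉ = inj₁ (inj₁ λ l l∈ gˡ∈ → ∉ (lose l∈ gˡ∈))
      ... | yes any with find any
      ... | l , l∈ , gˡ∈ with N? (g ^ᶜ l)
      ... | no ∉N = inj₁ (inj₂ (l , (g ^ᶜ l , gˡ∈) , ∉N , refl))
      ... | yes ∈N = inj₂ (Anyₚ.concatMap⁺ _ (lose l∈ (Anyₚ.map⁺ (Any.map (λ {n} eq → trans (solve 2 (λ g l → g ⊜ (l ⊙ ((inv l ⊙ g) ⊙ l)) ⊙ inv l) refl g l) (∙-congʳ (∙-congˡ eq))) (N-enum ∈N)))))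

  aperiodic-of-VS : ∀ n {D} → (∀ x → mem D x) → VS n D → n ≢ 1 → AdmitsStronglyAperiodicSFT G
  aperiodic-of-VS zero          total v _   = aperiodic-of-finite total v
  aperiodic-of-VS (suc zero)    total v n≢1 = contradiction ≡.refl n≢1
  aperiodic-of-VS (suc (suc n)) total v _   =
    let S , gen = generators v in aperiodic total S gen (resolve (2 + n) (λ x → yes (total x)) v)

theorem5 : ∀ {c ℓ p : Level} (G : Group c ℓ) → IsVirtuallyPolycyclic G p → (Σ ℕ λ n → HirschNumber G p n × n ≢ 1) → AdmitsStronglyAperiodicSFT G
theorem5 {c} {ℓ} {p} G _ (n , (series , count≡n) , n≢1) =
  Main.aperiodic-of-VS {c} {ℓ} {p} G (countInfinite G series) (λ _ → lift _) (FromSeries.fromSeries {c} {ℓ} {p} G series) (λ count≡1 → n≢1 (≡.trans (≡.sym count≡n) count≡1))
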